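{- Let $T$ be a text of length $n$ and let $\mathrm{Stat}(T,i,j)$ be an $O(1)$-size statistic computable, for any fragment $T[i\,..\,j]$, in $O(1)$ time after preprocessing using space $s_{\mathrm{Stat}}$. Let $\bigodot$ be an associative and commutative aggregation function for the output of $\mathrm{Stat}$ that can combine two values in $O(1)$ time. There is an $O(n + s_{\mathrm{Stat}})$-space data structure that, given a pattern $P$ of length $m$, computes $\bigodot_{i \in \mathrm{Occ}_T(P)} \mathrm{Stat}(T, i, i+|P|-1)$ in $O(m)$ time.
   Context: A text is a string $T=T[1\,..\,n]$; a fragment $T[i\,..\,j]$ is the occurrence of the substring $T[i]\cdots T[j]$ at position $i$. A pattern $P$ is a string of length $m=|P| \le n$. $\mathrm{Occ}_T(P)$ is the set of starting positions of occurrences of $P$ in $T$. Space is measured in machine words in the standard word-RAM model. -}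

module Defs where

open import Algebra.Core using (Op₂)
open import Data.Bool using (Bool; true; false; if_then_else_; _∧_; _∨_; _xor_)
open import Data.Fin as Fin using (Fin; toℕ)
open import Data.List using (List; []; _∷_; _++_; length; lookup; map; filter; foldl; take; drop; upTo; _[_]∷=_)
open import Data.List.Properties using (≡-dec)
open import Data.Maybe using (Maybe; just; nothing)
open import Data.Nat using (ℕ; zero; suc; _+_; _*_; _∸_; _^_; _/_; _%_; _≤_; _<_; _≡ᵇ_; _<ᵇ_)
open import Data.Nat.DivMod using (_mod_)
open import Data.Nat.Properties using (m^n≢0)
open import Data.Product using (Σ; ∃; _×_; _,_)
open import Data.Vec using (Vec; toList)
open import Relation.Binary.Definitions using (DecidableEquality)
open import Relation.Binary.PropositionalEquality using (_≡_; _≢_; cong)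
open import Relation.Nullary.Decidable using (map′)

-- The word RAM with word size w.
--
-- A program is a fixed structured program over finitely many registers;
-- it is uniform in w and in all inputs.  Every elementary instruction
-- and every test costs one unit of time.

-- A record rather than a synonym for Fin (2 ^ w), so that w can be inferred.
record Word (w : ℕ) : Set where
  constructor mkWord
  field
    toFin : Fin (2 ^ w)

open Word public

value : ∀ {w} → Word w → ℕ
value x = toℕ (toFin x)

_≟ʷ_ : ∀ {w} → DecidableEquality (Word w)
x ≟ʷ y = map′ (cong mkWord) (cong toFin) (toFin x Fin.≟ toFin y)

word : ∀ {w} → ℕ → Word w
word {w} a = mkWord (_mod_ a (2 ^ w) {{m^n≢0 2 w}})

data Op : Set where
  add sub mul div mod and or xor shl shr eq lt : Op

bit : Bool → ℕ
bit b = if b then 1 else 0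

-- The first argument is the number of low-order bits to process.
bitwise : (Bool → Bool → Bool) → ℕ → ℕ → ℕ → ℕ
bitwise f zero    a b = 0
bitwise f (suc l) a b =
  bit (f (a % 2 ≡ᵇ 1) (b % 2 ≡ᵇ 1)) + 2 * bitwise f l (a / 2) (b / 2)

-- Results are reduced modulo 2 ^ w by evalOp.  Division by zero gives 0.
evalℕ : ℕ → Op → ℕ → ℕ → ℕ
evalℕ w add a b       = a + b
evalℕ w sub a b       = (2 ^ w + a) ∸ b
evalℕ w mul a b       = a * b
evalℕ w div a zero    = 0
evalℕ w div a (suc b) = a / suc b
evalℕ w mod a zero    = 0
evalℕ w mod a (suc b) = a % suc b
evalℕ w and a b       = bitwise _∧_ w a b
evalℕ w or  a b       = bitwise _∨_ w a b
evalℕ w xor a b       = bitwise _xor_ w a b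
evalℕ w shl a b       = a * 2 ^ b
evalℕ w shr a b       = _/_ a (2 ^ b) {{m^n≢0 2 b}}
evalℕ w eq  a b       = bit (a ≡ᵇ b)
evalℕ w lt  a b       = bit (a <ᵇ b)

evalOp : ∀ {w} → Op → Word w → Word w → Word w
evalOp {w} o x y = word (evalℕ w o (value x) (value y))

Reg : Set
Reg = ℕ

infixr 5 _⨾_

data Program : Set where
  skip  : Program
  const : (r : Reg) (a : ℕ) → Program              -- r := a mod 2 ^ w
  op    : (o : Op) (r p q : Reg) → Program         -- r := p o q
  load  : (r p : Reg) → Program                    -- r := memory[p]
  store : (p q : Reg) → Program                    -- memory[p] := q
  _⨾_   : Program → Program → Program
  ifnz  : (r : Reg) → Program → Program → Program  -- then-branch iff r ≠ 0
  while : (r : Reg) → Program → Program            -- repeat as long as r ≠ 0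

Regs : ℕ → Set
Regs w = Reg → Word w

_[_↦_] : ∀ {w} → Regs w → Reg → Word w → Regs w
(ρ [ r ↦ x ]) r′ = if r′ ≡ᵇ r then x else ρ r′

Memory : ℕ → Set
Memory w = List (Word w)

State : ℕ → Set
State w = Regs w × Memory w

-- S ⊢ p ⇓[ t ] S′ : started in S, the program p halts in S′ after exactly
-- t steps.  An access outside the memory has no rule: the machine is stuck.

infix 4 _⊢_⇓[_]_

data _⊢_⇓[_]_ {w : ℕ} : State w → Program → ℕ → State w → Set where

  skip : ∀ {S} → S ⊢ skip ⇓[ 1 ] S

  const : ∀ {ρ μ r a} → (ρ , μ) ⊢ const r a ⇓[ 1 ] (ρ [ r ↦ word a ] , μ)

  op : ∀ {ρ μ o r p q} →
       (ρ , μ) ⊢ op o r p q ⇓[ 1 ] (ρ [ r ↦ evalOp o (ρ p) (ρ q) ] , μ)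

  load : ∀ {ρ μ r p} (i : Fin (length μ)) → toℕ i ≡ value (ρ p) →
         (ρ , μ) ⊢ load r p ⇓[ 1 ] (ρ [ r ↦ lookup μ i ] , μ)

  store : ∀ {ρ μ p q} (i : Fin (length μ)) → toℕ i ≡ value (ρ p) →
          (ρ , μ) ⊢ store p q ⇓[ 1 ] (ρ , (μ [ i ]∷= ρ q))

  seq : ∀ {S S′ S″ p q t u} →
        S ⊢ p ⇓[ t ] S′ → S′ ⊢ q ⇓[ u ] S″ → S ⊢ p ⨾ q ⇓[ t + u ] S″

  if-nonzero : ∀ {ρ μ S′ r p q t} → value (ρ r) ≢ 0 →
               (ρ , μ) ⊢ p ⇓[ t ] S′ → (ρ , μ) ⊢ ifnz r p q ⇓[ suc t ] S′

  if-zero : ∀ {ρ μ S′ r p q t} → value (ρ r) ≡ 0 →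
            (ρ , μ) ⊢ q ⇓[ t ] S′ → (ρ , μ) ⊢ ifnz r p q ⇓[ suc t ] S′

  while-done : ∀ {ρ μ r p} → value (ρ r) ≡ 0 →
               (ρ , μ) ⊢ while r p ⇓[ 1 ] (ρ , μ)

  while-step : ∀ {ρ μ S′ S″ r p t u} → value (ρ r) ≢ 0 →
               (ρ , μ) ⊢ p ⇓[ t ] S′ → S′ ⊢ while r p ⇓[ u ] S″ →
               (ρ , μ) ⊢ while r p ⇓[ suc (t + u) ] S″

-- Registers 0, 1, 2, … contain the given words; the others are arbitrary.
_Holds_ : ∀ {w} → Regs w → List (Word w) → Set
ρ Holds xs = ∀ (i : Fin (length xs)) → ρ (toℕ i) ≡ lookup xs i

-- A query hands over an array (placed in memory right behind the data
-- structure) and some further arguments in registers.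
record Query (w : ℕ) : Set where
  field
    array     : List (Word w)
    arguments : List (Word w)
    answer    : List (Word w)

-- A data structure occupying at most s words of memory on which the given
-- program answers each query q of the family in at most time q steps.
-- Register 0 receives the address of the query's array.  Queries may
-- modify the data structure as long as it stays Valid, that is, able to
-- serve all further queries.  Preprocessing time is not restricted.
record DataStructure {w : ℕ} (program : Program) (s : ℕ) {Q : Set}
                     (query : Q → Query w) (time : Q → ℕ) : Set₁ where
  open Query
  field
    Valid   : Memory w → Set
    initial : ∃ λ D → Valid D
    space   : ∀ {D} → Valid D → length D ≤ s
    correct : ∀ (q : Q) {D} → Valid D →
              ∀ ρ → ρ Holds (word (length D) ∷ arguments (query q)) →
              ∃ λ t → ∃ λ ρ′ → ∃ λ D′ →
                (ρ , D ++ array (query q)) ⊢ program ⇓[ t ] (ρ′ , D′ ++ array (query q))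
                × t ≤ time q
                × Valid D′
                × ρ′ Holds answer (query q)

-- Letters are machine words and positions
-- are counted from 0, so T[i .. j] denotes a fragment when i ≤ j < |T|.

Text : ℕ → Set
Text w = List (Word w)

-- The substring of length m at position i (shorter if T ends before).
substring : ∀ {w} → Text w → (i m : ℕ) → List (Word w)
substring T i m = take m (drop i T)

Occ : ∀ {w} → Text w → List (Word w) → List ℕ
Occ T P = filter (λ i → ≡-dec _≟ʷ_ (substring T i (length P)) P) (upTo (length T))

Fragment : ∀ {w} → Text w → Set
Fragment T = Σ (ℕ × ℕ) λ (i , j) → i ≤ j × j < length T

Pattern : ∀ {w} → Text w → Set
Pattern {w} T = Σ (List (Word w)) λ P → 1 ≤ length P × length P ≤ length T

-- Aggregate of a list of values; undefined (nothing) for the empty list,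
-- since _⊙_ need not have a neutral element.
aggregate : {V : Set} → Op₂ V → List V → Maybe V
aggregate _⊙_ []       = nothing
aggregate _⊙_ (x ∷ xs) = just (foldl _⊙_ x xs)

encodeMaybe : ∀ {w k} {V : Set} → (V → Vec (Word w) k) → Maybe V → List (Word w)
encodeMaybe encode nothing  = word 0 ∷ []
encodeMaybe encode (just v) = word 1 ∷ toList (encode v)

-- The text is at hand as the array, so a structure for Stat need not store it.
statQuery : ∀ {w k} {V : Set} (T : Text w) → (V → Vec (Word w) k) →
            (ℕ → ℕ → V) → Fragment T → Query w
statQuery T encode Stat ((i , j) , _) = record
  { array     = T
  ; arguments = word i ∷ word j ∷ word (length T) ∷ []
  ; answer    = toList (encode (Stat i j))
  }

aggregateQuery : ∀ {w k} {V : Set} (T : Text w) → (V → Vec (Word w) k) →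
                 (ℕ → ℕ → V) → Op₂ V → Pattern T → Query w
aggregateQuery T encode Stat _⊙_ (P , _) = record
  { array     = P
  ; arguments = word (length P) ∷ []
  ; answer    = encodeMaybe encode
      (aggregate _⊙_ (map (λ i → Stat i (i + length P ∸ 1)) (Occ T P)))
  }

-- The program computes _⊙_ on encoded values within t steps, using
-- registers only.
Combines : ∀ {w k} {V : Set} → Program → (V → Vec (Word w) k) → Op₂ V → ℕ → Set
Combines program encode _⊙_ t =
  ∀ u v ρ → ρ Holds (toList (encode u) ++ toList (encode v)) →
  ∃ λ t′ → ∃ λ ρ′ →
    (ρ , []) ⊢ program ⇓[ t′ ] (ρ′ , [])
    × t′ ≤ t
    × ρ′ Holds toList (encode (u ⊙ v))

{-# OPTIONS --safe #-}
module Submission where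

-- The data structure is a compacted suffix tree.  A node stands for the set S of the text positions
-- that share its path label, a string of length d.  A query descends blindly, looking only at the
-- letters P[d], up to the first node with d ≥ m, and compares P with T at one position of S: then
-- Occ T P is either S or empty.  If |S| < m, the positions of S, contiguous in depth-first order, are
-- enumerated in O(m) time.  Otherwise the answer is tabulated at the node.  The tables have O(n)
-- entries, because the subtree of a node whose parent has string depth e - 1 contains at most
-- |S| + 1 - e of them: Σ (|S′| - d) ≤ |S| - d over the children S′ of S.
--
-- Children are found by two-level perfect hashing with the functions x ↦ (a x mod 2 ^ w) / 2 ^ j.
-- Letters are split into halves first; then differences of keys are so small that the multipliers a
-- with a collision can be counted by an amortised argument, without number theory.  As P is compared
-- with T in the end, the dictionaries need not recognise absent keys.

open import Algebra.Core using (Op₂)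
open import Algebra.Structures using (IsCommutativeSemigroup)
open import Data.Bool as Bool using (Bool; true; false; _∧_; not)
open import Data.Fin as Fin using (Fin; toℕ; zero; suc)
open import Data.Fin.Properties using (toℕ-fromℕ<; toℕ-injective; toℕ<n)
open import Data.List using (List; []; _∷_; _++_; length; map; filter; foldl; lookup; take; drop; upTo; downFrom; applyUpTo; concat; concatMap; deduplicate; catMaybes; _[_]∷=_)
open import Data.List.Properties using (length-applyUpTo; length-++; length-downFrom; length-upTo; length-map; length-deduplicate; ++-assoc; ++-identityʳ; map-++; concatMap-map; foldl-++; filter-accept; filter-reject; filter-all; filter-none; filter-notAll; ≡-dec)
open import Data.List.Membership.Propositional using (_∈_)
open import Data.List.Membership.Propositional.Properties using (∈-downFrom⁺; ∈-upTo⁻; ∈-filter⁻; ∈-filter⁺; ∈-map⁺; ∈-map⁻; ∈-deduplicate⁺; ∈-deduplicate⁻; ∈-++⁺ʳ)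
open import Data.List.Relation.Unary.All as All using (All; []; _∷_)
open import Data.List.Relation.Unary.All.Properties using (filter⁺; map⁺; ¬All⇒Any¬)
open import Data.List.Relation.Unary.AllPairs using ([]; _∷_)
open import Data.List.Relation.Unary.Any using (here; there)
open import Data.List.Relation.Unary.Unique.DecPropositional.Properties using (deduplicate-!)
open import Data.List.Relation.Unary.Unique.Propositional using (Unique)
open import Data.List.Relation.Unary.Unique.Propositional.Properties using (upTo⁺) renaming (filter⁺ to Unique-filter; map⁺ to Unique-map⁺)
open import Data.List.Relation.Binary.Permutation.Propositional as ↭ using (_↭_; ↭-refl; ↭-sym; ↭-trans; prep)
open import Data.List.Relation.Binary.Permutation.Propositional.Properties using (++⁺; ++⁺ˡ; ↭-length; ∈-resp-↭) renaming (map⁺ to ↭-map; shift to ↭-shift)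
open import Data.Maybe as Maybe using (Maybe; just; nothing)
open import Data.Maybe.Properties using (just-injective) renaming (≡-dec to Maybe-≡-dec)
open import Data.Nat
open import Data.Nat.DivMod hiding (_div_; _mod_)
open import Data.Nat.Properties
open import Data.Nat.Tactic.RingSolver using (solve-∀)
open import Data.Product using (∃; _×_; _,_; proj₁; proj₂)
open import Data.Sum using (_⊎_; inj₁; inj₂)
open import Data.Unit using (⊤; tt)
open import Data.Vec using (Vec; toList)
open import Data.Vec.Properties using (length-toList)
open import Function using (_∘_; id)
open import Relation.Binary.Definitions using (DecidableEquality; tri<; tri≈; tri>)
open import Relation.Binary.PropositionalEquality
open import Relation.Nullary using (Dec; yes; no; ¬_; contradiction)
open import Defs

-- Two features of the machine shape the construction. An access outside the memory leaves it stuck,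
-- while the letter `P[d]` need not follow any position of the current node; hence every cell of
-- every hash table, even one that no key is mapped to, holds a valid address. Moreover, the
-- structure for `Stat` may rewrite itself and expects the text directly behind it. So the memory
-- consists of that structure, the text, the static part `R` and the pattern, and only the first
-- block ever changes.
--
-- The halving of letters comes from the counting. Two keys at distance `δ` collide in a table of
-- `2 ^ l` cells only if `a * δ` comes within `2 ^ j` of a multiple of `2 ^ w`, where `j = w ∸ l`.
-- How often this happens is known only up to an error proportional to `δ`, which is harmless as
-- long as `δ ≤ 2 ^ j`. Keys of about `w / 2` bits, in tables with fewer cells than there are
-- possible keys, guarantee this.

private variable A B : Set

-- Sums and counting

ind : ∀ {P : Set} → Dec P → ℕ
ind (yes _) = 1
ind (no _)  = 0

∑ : List A → (A → ℕ) → ℕ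
∑ []       f = 0
∑ (x ∷ xs) f = f x + ∑ xs f

∑-mono : ∀ (xs : List A) {f g} → (∀ x → x ∈ xs → f x ≤ g x) → ∑ xs f ≤ ∑ xs g
∑-mono []       h = z≤n
∑-mono (x ∷ xs) h = +-mono-≤ (h x (here refl)) (∑-mono xs (λ y → h y ∘ there))

∑-cong : ∀ (xs : List A) {f g} → (∀ x → f x ≡ g x) → ∑ xs f ≡ ∑ xs g
∑-cong []       h = refl
∑-cong (x ∷ xs) h = cong₂ _+_ (h x) (∑-cong xs h)

∑-const : ∀ (xs : List A) c → ∑ xs (λ _ → c) ≡ length xs * c
∑-const []       c = refl
∑-const (x ∷ xs) c = cong (c +_) (∑-const xs c)

interchange : ∀ a b c d → (a + b) + (c + d) ≡ (a + c) + (b + d)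
interchange = solve-∀

∑-+ : ∀ (xs : List A) f g → ∑ xs (λ x → f x + g x) ≡ ∑ xs f + ∑ xs g
∑-+ []       f g = refl
∑-+ (x ∷ xs) f g = trans (cong ((f x + g x) +_) (∑-+ xs f g)) (interchange (f x) (g x) (∑ xs f) (∑ xs g))

∑-*ˡ : ∀ (xs : List A) f c → ∑ xs (λ x → c * f x) ≡ c * ∑ xs f
∑-*ˡ []       f c = sym (*-zeroʳ c)
∑-*ˡ (x ∷ xs) f c = trans (cong (c * f x +_) (∑-*ˡ xs f c)) (sym (*-distribˡ-+ c (f x) (∑ xs f)))

∑-swap : ∀ (xs : List A) (ys : List B) (f : A → B → ℕ) →
         ∑ xs (λ x → ∑ ys (f x)) ≡ ∑ ys (λ y → ∑ xs (λ x → f x y))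
∑-swap []       ys f = sym (trans (∑-const ys 0) (*-zeroʳ (length ys)))
∑-swap (x ∷ xs) ys f =
  trans (cong (∑ ys (f x) +_) (∑-swap xs ys f)) (sym (∑-+ ys (f x) _))

-- Averaging: if `c * f a` exceeded `K` for every `a`, the sum would be too large. The factor `c`
-- stays on the left to avoid a division.
pigeonhole : ∀ N (f : ℕ → ℕ) c K →
             c * ∑ (downFrom (suc N)) f ≤ suc N * K → ∃ λ a → a < suc N × c * f a ≤ K
pigeonhole zero    f c K h = 0 , s≤s z≤n , subst₂ _≤_ (cong (c *_) (+-identityʳ (f 0))) (+-identityʳ K) h
pigeonhole (suc N) f c K h with c * f (suc N) ≤? K
... | yes p = suc N , ≤-refl , p
... | no ¬p with pigeonhole N f c K
                   (+-cancelˡ-≤ K _ _ (≤-trans (+-monoˡ-≤ _ (<⇒≤ (≰⇒> ¬p)))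
                     (subst (_≤ K + suc N * K) (*-distribˡ-+ c (f (suc N)) (∑ (downFrom (suc N)) f)) h)))
...   | a , a< , q = a , m<n⇒m<1+n a< , q

-- Arithmetic progressions modulo `M` that hit an initial window

module Counting (M : ℕ) .{{_ : NonZero M}} where

  hits : ℕ → ℕ → ℕ
  hits K N = ∑ (downFrom N) (λ y → ind (y % M <? K))

  hits-mono : ∀ K i N → hits K N ≤ hits K (i + N)
  hits-mono K zero    N = ≤-refl
  hits-mono K (suc i) N = ≤-trans (hits-mono K i N) (m≤n+m _ _)

  hits-block : ∀ K q i → i ≤ M → hits K (i + q * M) ≤ hits K (q * M) + (i ⊓ K)
  hits-block K q zero    i≤M = m≤m+n _ _
  hits-block K q (suc i) i<M with ih ← hits-block K q i (<⇒≤ i<M)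
                                | (i + q * M) % M | trans ([m+kn]%n≡m%n i q M) (m<n⇒m%n≡m i<M)
  ... | .i | refl with i <? K
  ...   | yes i<K = ≤-trans (s≤s ih) (≤-reflexive (trans (sym (+-suc _ _))
                      (cong (hits K (q * M) +_) (trans (cong suc (m≤n⇒m⊓n≡m (<⇒≤ i<K))) (sym (m≤n⇒m⊓n≡m i<K))))))
  ...   | no  _   = ≤-trans ih (+-monoʳ-≤ _ (⊓-monoˡ-≤ K (n≤1+n i)))

  hits-period : ∀ K q → hits K (q * M) ≤ q * K
  hits-period K zero    = z≤n
  hits-period K (suc q) = ≤-trans (hits-block K q M ≤-refl)
    (≤-trans (+-mono-≤ (hits-period K q) (m⊓n≤n M K)) (≤-reflexive (+-comm (q * K) K)))

  hits-run : ∀ K δ z → z % M < K → ∀ i → i ≤ δ → i + hits (K + δ) z ≤ hits (K + δ) (i + z)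
  hits-run K δ z z< zero    i≤ = ≤-refl
  hits-run K δ z z< (suc i) i< with ih ← hits-run K δ z z< i (<⇒≤ i<) | (i + z) % M <? K + δ
  ... | yes _ = s≤s ih
  -- Residues are subadditive, so `(i + z) % M` stays below `K + δ` even if `i + z` wraps around.
  ... | no ¬p = contradiction
    (begin-strict
      (i + z) % M       ≡⟨ %-distribˡ-+ i z M ⟩
      (i % M + z % M) % M ≤⟨ m%n≤m _ M ⟩
      i % M + z % M     ≤⟨ +-monoˡ-≤ _ (m%n≤m i M) ⟩
      i + z % M         <⟨ +-mono-< i< z< ⟩
      δ + K             ≡⟨ +-comm δ K ⟩
      K + δ             ∎) ¬p
    where open ≤-Reasoning

  -- Amortised over the progression z = C, δ + C, 2δ + C, …: each hit at z
  -- makes all of z, …, z + δ - 1 hits of the threshold K + δ.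
  progression : ∀ K δ C N → ∑ (downFrom N) (λ a → ind ((a * δ + C) % M <? K)) * δ ≤ hits (K + δ) (N * δ + C)
  progression K δ C zero    = z≤n
  progression K δ C (suc N) with ih ← progression K δ C N | (N * δ + C) % M <? K
  ... | no _  = ≤-trans ih (subst (hits (K + δ) (N * δ + C) ≤_)
                  (cong (hits (K + δ)) (sym (+-assoc δ (N * δ) C))) (hits-mono (K + δ) δ (N * δ + C)))
  ... | yes p = ≤-trans (+-monoʳ-≤ δ ih) (subst (δ + hits (K + δ) (N * δ + C) ≤_)
                  (cong (hits (K + δ)) (sym (+-assoc δ (N * δ) C))) (hits-run K δ _ p δ ≤-refl))

  hits-≤ : ∀ K {m n} → m ≤ n → hits K m ≤ hits K n
  hits-≤ K {m} {n} m≤n = subst (λ j → hits K m ≤ hits K j) (m∸n+n≡m m≤n) (hits-mono K (n ∸ m) m)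

  -- Since `C ≤ M`, the progression stays within `δ + 1` periods of length `M`. Each has at most
  -- `K + δ` hits of the enlarged threshold, and every hit of `K` accounts for `δ` of those, so the
  -- count is at most `(δ + 1) * (K + δ) / δ`.
  progression-count : ∀ K δ C → 1 ≤ δ → C ≤ M →
                      ∑ (downFrom M) (λ a → ind ((a * δ + C) % M <? K)) ≤ 2 * (K + δ)
  progression-count K δ@(suc δ′) C _ C≤M = *-cancelʳ-≤ _ _ δ (begin
    ∑ (downFrom M) _ * δ         ≤⟨ progression K δ C M ⟩
    hits (K + δ) (M * δ + C)     ≤⟨ hits-≤ (K + δ) (≤-trans (+-monoʳ-≤ (M * δ) C≤M)
                                      (≤-reflexive (trans (+-comm (M * δ) M) (cong (M +_) (*-comm M δ))))) ⟩
    hits (K + δ) (suc δ * M)     ≤⟨ hits-period (K + δ) (suc δ) ⟩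
    suc δ * (K + δ)              ≤⟨ *-monoˡ-≤ (K + δ) (+-monoˡ-≤ δ (s≤s (z≤n {δ′}))) ⟩
    (δ + δ) * (K + δ)            ≡⟨ lem δ (K + δ) ⟩
    2 * (K + δ) * δ              ∎)
    where
    open ≤-Reasoning
    lem : ∀ d k → (d + d) * k ≡ 2 * k * d
    lem = solve-∀

-- Hashing

nth : List A → ℕ → Maybe A
nth []       _       = nothing
nth (x ∷ xs) zero    = just x
nth (x ∷ xs) (suc i) = nth xs i

nth-++ˡ : ∀ (xs : List A) {ys i x} → nth xs i ≡ just x → nth (xs ++ ys) i ≡ just x
nth-++ˡ (x ∷ xs) {i = zero}  e = e
nth-++ˡ (x ∷ xs) {i = suc i} e = nth-++ˡ xs e

nth-++ʳ : ∀ (xs : List A) {ys} i → nth (xs ++ ys) (length xs + i) ≡ nth ys i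
nth-++ʳ []       i = refl
nth-++ʳ (x ∷ xs) i = nth-++ʳ xs i

nth-< : ∀ (xs : List A) {i x} → nth xs i ≡ just x → i < length xs
nth-< (x ∷ xs) {zero}  e = z<s
nth-< (x ∷ xs) {suc i} e = s<s (nth-< xs e)

nth-applyUpTo : ∀ (f : ℕ → A) {n i} → i < n → nth (applyUpTo f n) i ≡ just (f i)
nth-applyUpTo f {suc n} {zero}  i<n = refl
nth-applyUpTo f {suc n} {suc i} i<n = nth-applyUpTo (f ∘ suc) (s<s⁻¹ i<n)

∑-0 : ∀ (xs : List A) f → ∑ xs f ≡ 0 → ∀ {x} → x ∈ xs → f x ≡ 0
∑-0 (x ∷ xs) f e (here refl) = m+n≡0⇒m≡0 (f x) e
∑-0 (x ∷ xs) f e (there x∈)  = ∑-0 xs f (m+n≡0⇒n≡0 (f x) e) x∈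

length-filter-∑ : ∀ {P : A → Set} (P? : ∀ x → Dec (P x)) xs → length (filter P? xs) ≡ ∑ xs (ind ∘ P?)
length-filter-∑ P? []       = refl
length-filter-∑ P? (x ∷ xs) with ih ← length-filter-∑ P? xs | P? x
... | yes _ = cong suc ih
... | no _  = ih

∑-point : ∀ (g : ℕ → ℕ) k N → ∑ (downFrom N) (λ i → ind (k ≟ i) * g i) ≤ g k
∑-point g k = go
  where
  below : ∀ N → N ≤ k → ∑ (downFrom N) (λ i → ind (k ≟ i) * g i) ≡ 0
  below zero    _   = refl
  below (suc N) N<k with k ≟ N
  ... | yes refl = contradiction N<k (<-irrefl refl)
  ... | no _     = below N (<⇒≤ N<k)
  go : ∀ N → ∑ (downFrom N) (λ i → ind (k ≟ i) * g i) ≤ g k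
  go zero    = z≤n
  go (suc N) with k ≟ N
  ... | no _     = go N
  ... | yes refl rewrite below k ≤-refl | +-identityʳ (g k + 0) | +-identityʳ (g k) = ≤-refl

-- The binomial coefficient of `n` over 2, without division.
pairs : ℕ → ℕ
pairs zero    = 0
pairs (suc n) = n + pairs n

2pairs : ∀ n → 2 * pairs n ≤ n * n
2pairs zero    = z≤n
2pairs (suc n) = ≤-trans (≤-reflexive (*-distribˡ-+ 2 n (pairs n)))
  (≤-trans (+-monoʳ-≤ (2 * n) (2pairs n)) (≤-trans (n≤1+n _) (≤-reflexive (lem n))))
  where
  lem : ∀ n → 1 + (2 * n + n * n) ≡ (1 + n) * (1 + n)
  lem = solve-∀

collisions : (ℕ → ℕ) → List ℕ → ℕ
collisions f []       = 0
collisions f (x ∷ xs) = ∑ xs (λ y → ind (f y ≟ f x)) + collisions f xs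

bucket : (ℕ → ℕ) → List ℕ → ℕ → List ℕ
bucket f xs i = filter (λ x → f x ≟ i) xs

pairs-filter : ∀ {P : A → Set} (P? : ∀ x → Dec (P x)) x xs →
               pairs (length (filter P? (x ∷ xs))) ≡
               ind (P? x) * length (filter P? xs) + pairs (length (filter P? xs))
pairs-filter P? x xs with P? x
... | yes _ = cong (_+ pairs (length (filter P? xs))) (sym (+-identityʳ (length (filter P? xs))))
... | no _  = refl

-- Two keys share a bucket exactly when they collide. Only an inequality, because buckets from `N`
-- on are not counted.
bucket-pairs : ∀ f xs N → ∑ (downFrom N) (λ i → pairs (length (bucket f xs i))) ≤ collisions f xs
bucket-pairs f []       N = ≤-reflexive (trans (∑-const (downFrom N) 0) (*-zeroʳ (length (downFrom N))))
bucket-pairs f (x ∷ xs) N = begin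
  ∑ (downFrom N) (λ i → pairs (length (bucket f (x ∷ xs) i)))
    ≡⟨ ∑-cong (downFrom N) step ⟩
  ∑ (downFrom N) (λ i → ind (f x ≟ i) * size i + pairs (size i))
    ≡⟨ ∑-+ (downFrom N) _ _ ⟩
  ∑ (downFrom N) (λ i → ind (f x ≟ i) * size i) + ∑ (downFrom N) (pairs ∘ size)
    ≤⟨ +-mono-≤ (∑-point size (f x) N) (bucket-pairs f xs N) ⟩
  size (f x) + collisions f xs
    ≡⟨ cong (_+ collisions f xs) (length-filter-∑ (λ y → f y ≟ f x) xs) ⟩
  collisions f (x ∷ xs) ∎
  where
  open ≤-Reasoning
  size = λ i → length (bucket f xs i)
  step : ∀ i → pairs (length (bucket f (x ∷ xs) i)) ≡ ind (f x ≟ i) * size i + pairs (size i)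
  step i = pairs-filter (λ y → f y ≟ i) x xs

collision-free : ∀ (f : ℕ → ℕ) {x xs} → ∑ xs (λ y → ind (f y ≟ f x)) ≡ 0 → ∀ {y} → y ∈ xs → f x ≢ f y
collision-free f {x} {xs} e {y} y∈ e≡ = go (f y ≟ f x) (∑-0 xs (λ z → ind (f z ≟ f x)) e y∈)
  where
  go : (d : Dec (f y ≡ f x)) → ind d ≢ 0
  go (yes _) ()
  go (no ¬p) _ = ¬p (sym e≡)

injective⇒collisions≡0 : ∀ f xs → (∀ {x y} → x ∈ xs → y ∈ xs → f x ≡ f y → x ≡ y) → Unique xs →
                         collisions f xs ≡ 0
injective⇒collisions≡0 f []       inj uniq       = refl
injective⇒collisions≡0 f (x ∷ xs) inj (x∉ ∷ uniq) = cong₂ _+_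
  (go xs id)
  (injective⇒collisions≡0 f xs (λ p q → inj (there p) (there q)) uniq)
  where
  go : ∀ ys → (∀ {y} → y ∈ ys → y ∈ xs) → ∑ ys (λ y → ind (f y ≟ f x)) ≡ 0
  go []       incl = refl
  go (y ∷ ys) incl with f y ≟ f x
  ... | yes e = contradiction (inj (here refl) (there (incl (here refl))) (sym e)) (All.lookup x∉ (incl (here refl)))
  ... | no _  = go ys (incl ∘ there)

-- Table sizes are powers of two. The strict lower bound makes the number of collisions vanish in
-- `quadratic`; the upper bound keeps the space within a factor of two.
log-approx : ∀ n → ∃ λ l → n < 2 ^ l × 2 ^ l ≤ 2 * n + 1
log-approx zero = 0 , ≤-refl , ≤-refl
log-approx (suc n) with log-approx n
... | l , n< , ≤n with suc n <? 2 ^ l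
...   | yes p = l , p , ≤-trans ≤n (+-monoˡ-≤ 1 (*-monoʳ-≤ 2 (n≤1+n n)))
...   | no ¬p = suc l , <-≤-trans (≤-reflexive (cong suc (≤-antisym n< (≮⇒≥ ¬p)))) (m<m+n (2 ^ l) (subst (0 <_) (sym (+-identityʳ (2 ^ l))) (m^n>0 2 l)))
              , ≤-trans (*-monoʳ-≤ 2 (≮⇒≥ ¬p)) (m≤m+n _ 1)

-- Multiply-shift hashing of `w`-bit words

module Hashing (w : ℕ) where

  M = 2 ^ w

  instance
    M≢0 : NonZero (2 ^ w)
    M≢0 = m^n≢0 2 w

  open Counting M

  hash : (a shift x : ℕ) → ℕ
  hash a j x = _/_ (_%_ (a * x) (2 ^ w) {{m^n≢0 2 w}}) (2 ^ j) {{m^n≢0 2 j}}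

  hash-< : ∀ a l x → l ≤ w → hash a (w ∸ l) x < 2 ^ l
  hash-< a l x l≤w = m<n*o⇒m/o<n {{m^n≢0 2 (w ∸ l)}} (subst ((a * x) % 2 ^ w <_)
    (trans (cong (2 ^_) (sym (m+[n∸m]≡n l≤w))) (^-distribˡ-+-* 2 l (w ∸ l)))
    (m%n<n (a * x) (2 ^ w)))

  -- Equal quotients force the residues of `a * x` and `a * y` to be less than `2 ^ j` apart, in
  -- either direction. Adding `2 ^ j` turns this into a one-sided test, as counted by
  -- `progression-count` with `C = 2 ^ j`.
  window : ∀ a x y j → x ≤ y → hash a j x ≡ hash a j y → (a * (y ∸ x) + 2 ^ j) % M < 2 * 2 ^ j
  window a x y j x≤y e≡ = subst (_< 2 * β) (sym key) (≤-<-trans (m%n≤m v M) v<)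
    where
    β = 2 ^ j
    instance
      β≢0 : NonZero (2 ^ j)
      β≢0 = m^n≢0 2 j
    r = (a * x) % M
    s = (a * y) % M
    near : ∀ m n → m / β ≡ n / β → m < n + β
    near m n e = begin-strict
      m                   ≡⟨ m≡m%n+[m/n]*n m β ⟩
      m % β + m / β * β   <⟨ +-monoˡ-< (m / β * β) (m%n<n m β) ⟩
      β + m / β * β       ≡⟨ cong (λ q → β + q * β) e ⟩
      β + n / β * β       ≤⟨ +-monoʳ-≤ β (m/n*n≤m n β) ⟩
      β + n               ≡⟨ +-comm β n ⟩
      n + β               ∎
      where open ≤-Reasoning
    v = s + β ∸ r
    v< : v < 2 * β
    v< = +-cancelʳ-< r v (2 * β) (begin-strict
      v + r       ≡⟨ m∸n+n≡m (<⇒≤ (near r s e≡)) ⟩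
      s + β       <⟨ +-monoˡ-< β (near s r (sym e≡)) ⟩
      r + β + β   ≡⟨ lem r β ⟩
      2 * β + r   ∎)
      where
      open ≤-Reasoning
      lem : ∀ r β → r + β + β ≡ 2 * β + r
      lem = solve-∀
    -- The multiples of `M` are kept as summands on both sides instead of being subtracted;
    -- reduction modulo `M` removes them in `key`.
    balance : a * (y ∸ x) + β + (a * x) / M * M ≡ v + (a * y) / M * M
    balance = +-cancelʳ-≡ r _ _ (begin
      a * (y ∸ x) + β + (a * x) / M * M + r   ≡⟨ lem₁ (a * (y ∸ x)) β ((a * x) / M * M) r ⟩
      a * (y ∸ x) + (r + (a * x) / M * M) + β ≡⟨ cong (λ z → a * (y ∸ x) + z + β) (sym (m≡m%n+[m/n]*n (a * x) M)) ⟩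
      a * (y ∸ x) + a * x + β                 ≡⟨ cong (_+ β) (sym (*-distribˡ-+ a (y ∸ x) x)) ⟩
      a * (y ∸ x + x) + β                     ≡⟨ cong (λ z → a * z + β) (m∸n+n≡m x≤y) ⟩
      a * y + β                               ≡⟨ cong (_+ β) (m≡m%n+[m/n]*n (a * y) M) ⟩
      s + (a * y) / M * M + β                 ≡⟨ lem₂ s ((a * y) / M * M) β ⟩
      s + β + (a * y) / M * M                 ≡⟨ cong (_+ (a * y) / M * M) (sym (m∸n+n≡m (<⇒≤ (near r s e≡)))) ⟩
      v + r + (a * y) / M * M                 ≡⟨ lem₂ v r ((a * y) / M * M) ⟩
      v + (a * y) / M * M + r                 ∎)
      where
      open ≡-Reasoning
      lem₁ : ∀ p q c r → p + q + c + r ≡ p + (r + c) + q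
      lem₁ = solve-∀
      lem₂ : ∀ p q r → p + q + r ≡ p + r + q
      lem₂ = solve-∀
    key : (a * (y ∸ x) + β) % M ≡ v % M
    key = begin
      (a * (y ∸ x) + β) % M                     ≡⟨ sym ([m+kn]%n≡m%n _ ((a * x) / M) M) ⟩
      (a * (y ∸ x) + β + (a * x) / M * M) % M   ≡⟨ cong (_% M) balance ⟩
      (v + (a * y) / M * M) % M                 ≡⟨ [m+kn]%n≡m%n v ((a * y) / M) M ⟩
      v % M                                     ∎
      where open ≡-Reasoning

  ind-mono : ∀ {P Q : Set} (p : Dec P) (q : Dec Q) → (P → Q) → ind p ≤ ind q
  ind-mono (no _)  q       f = z≤n
  ind-mono (yes p) (yes _) f = ≤-refl
  ind-mono (yes p) (no ¬q) f = contradiction (f p) ¬q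

  -- Here the shortness of the keys enters: `y ∸ x` is at most `2 ^ u ≤ 2 ^ j`, so the window
  -- `2 * 2 ^ j` and the error term add up to `3 * 2 ^ j`.
  collision-count< : ∀ u j x y → u ≤ j → j ≤ w → y < 2 ^ u → x < y → ∀ (P? : ∀ a → Dec (hash a j x ≡ hash a j y)) →
                     ∑ (downFrom M) (λ a → ind (P? a)) ≤ 6 * 2 ^ j
  collision-count< u j x y u≤j j≤w y< x<y P? = begin
    ∑ (downFrom M) (λ a → ind (P? a))     ≤⟨ ∑-mono (downFrom M) (λ a _ → ind-mono (P? a) (_ <? _) (window a x y j (<⇒≤ x<y))) ⟩
    _                                     ≤⟨ progression-count (2 * 2 ^ j) (y ∸ x) (2 ^ j) (m<n⇒0<n∸m x<y) (^-monoʳ-≤ 2 j≤w) ⟩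
    2 * (2 * 2 ^ j + (y ∸ x))             ≤⟨ *-monoʳ-≤ 2 (+-monoʳ-≤ (2 * 2 ^ j) (≤-trans (m∸n≤m y x) (≤-trans (<⇒≤ y<) (^-monoʳ-≤ 2 u≤j)))) ⟩
    2 * (2 * 2 ^ j + 2 ^ j)               ≡⟨ lem (2 ^ j) ⟩
    6 * 2 ^ j                             ∎
    where
    open ≤-Reasoning
    lem : ∀ B → 2 * (2 * B + B) ≡ 6 * B
    lem = solve-∀

  collision-count : ∀ u j x y → u ≤ j → j ≤ w → x < 2 ^ u → y < 2 ^ u → x ≢ y →
                    ∑ (downFrom M) (λ a → ind (hash a j x ≟ hash a j y)) ≤ 6 * 2 ^ j
  collision-count u j x y u≤j j≤w x< y< x≢y = cases (<-cmp x y)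
    where
    cases : _ → _
    cases (tri< x<y _ _) = collision-count< u j x y u≤j j≤w y< x<y (λ a → hash a j x ≟ hash a j y)
    cases (tri≈ _ x≡y _) = contradiction x≡y x≢y
    cases (tri> _ _ y<x) = ≤-trans
      (∑-mono (downFrom M) (λ a _ → ind-mono (hash a j x ≟ hash a j y) (hash a j y ≟ hash a j x) sym))
      (collision-count< u j y x u≤j j≤w x< y<x (λ a → hash a j y ≟ hash a j x))

  total-collisions : ∀ u j xs → u ≤ j → j ≤ w → All (_< 2 ^ u) xs → Unique xs →
                     ∑ (downFrom M) (λ a → collisions (hash a j) xs) ≤ 6 * 2 ^ j * pairs (length xs)
  total-collisions u j []       u≤j j≤w <u uniq = ≤-trans (≤-reflexive (trans (∑-const (downFrom M) 0) (*-zeroʳ (length (downFrom M))))) z≤n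
  total-collisions u j (x ∷ xs) u≤j j≤w (x< ∷ <u) (x∉ ∷ uniq) = begin
    ∑ (downFrom M) (λ a → ∑ xs (λ y → ind (hash a j y ≟ hash a j x)) + collisions (hash a j) xs)
      ≡⟨ ∑-+ (downFrom M) _ _ ⟩
    ∑ (downFrom M) (λ a → ∑ xs (λ y → ind (hash a j y ≟ hash a j x))) + ∑ (downFrom M) (λ a → collisions (hash a j) xs)
      ≡⟨ cong (_+ ∑ (downFrom M) (λ a → collisions (hash a j) xs)) (∑-swap (downFrom M) xs _) ⟩
    ∑ xs (λ y → ∑ (downFrom M) (λ a → ind (hash a j y ≟ hash a j x))) + ∑ (downFrom M) (λ a → collisions (hash a j) xs)
      ≤⟨ +-mono-≤ (∑-mono xs (λ y y∈ → collision-count u j y x u≤j j≤w (All.lookup <u y∈) x< (λ e → All.lookup x∉ y∈ (sym e))))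
                  (total-collisions u j xs u≤j j≤w <u uniq) ⟩
    ∑ xs (λ _ → 6 * 2 ^ j) + 6 * 2 ^ j * pairs (length xs)
      ≡⟨ cong (_+ 6 * 2 ^ j * pairs (length xs)) (trans (∑-const xs (6 * 2 ^ j)) (*-comm (length xs) (6 * 2 ^ j))) ⟩
    6 * 2 ^ j * length xs + 6 * 2 ^ j * pairs (length xs)
      ≡⟨ sym (*-distribˡ-+ (6 * 2 ^ j) (length xs) (pairs (length xs))) ⟩
    6 * 2 ^ j * pairs (length (x ∷ xs)) ∎
    where open ≤-Reasoning

  pigeonhole-nonZero : ∀ N .{{_ : NonZero N}} (f : ℕ → ℕ) c K →
                c * ∑ (downFrom N) f ≤ N * K → ∃ λ a → a < N × c * f a ≤ K
  pigeonhole-nonZero (suc N) = pigeonhole N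

  -- `bound` refers to the requested `l` although the table has only `2 ^ size` cells: a table cut
  -- down to the size of the universe has no collisions at all.
  record Choice (l : ℕ) (xs : List ℕ) : Set where
    field
      size mult  : ℕ
      size≤l     : size ≤ l
      size≤w     : size ≤ w
      mult<      : mult < 2 ^ w
      bound      : 2 ^ l * collisions (hash mult (w ∸ size)) xs ≤ 6 * pairs (length xs)

  -- If the table is at least as large as the universe, the hash function with
  -- multiplier 2 ^ (w ∸ u) is the identity; otherwise a good multiplier exists on average.
  choose : ∀ u → 1 ≤ u → u ≤ w → u + u ≤ suc w → ∀ l xs → All (_< 2 ^ u) xs → Unique xs → Choice l xs
  choose u 1≤u u≤w 2u≤ l xs <u uniq with l <? u
  ... | no l≮u = record
    { size = u ; mult = 2 ^ (w ∸ u) ; size≤l = ≮⇒≥ l≮u ; size≤w = u≤w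
    ; mult< = mult<w
    ; bound = subst (_≤ 6 * pairs (length xs)) (sym (trans (cong (2 ^ l *_) none) (*-zeroʳ (2 ^ l)))) z≤n }
    where
    instance
      shift≢0 : NonZero (2 ^ (w ∸ u))
      shift≢0 = m^n≢0 2 (w ∸ u)
    split : 2 ^ (w ∸ u) * 2 ^ u ≡ 2 ^ w
    split = trans (sym (^-distribˡ-+-* 2 (w ∸ u) u)) (cong (2 ^_) (m∸n+n≡m u≤w))
    identity : ∀ {x} → x < 2 ^ u → hash (2 ^ (w ∸ u)) (w ∸ u) x ≡ x
    identity {x} x< = trans (cong (_/ 2 ^ (w ∸ u)) (m<n⇒m%n≡m (subst (2 ^ (w ∸ u) * x <_) split (*-monoʳ-< (2 ^ (w ∸ u)) x<))))
      (trans (cong (_/ 2 ^ (w ∸ u)) (*-comm (2 ^ (w ∸ u)) x)) (m*n/n≡m x (2 ^ (w ∸ u))))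
    none : collisions (hash (2 ^ (w ∸ u)) (w ∸ u)) xs ≡ 0
    none = injective⇒collisions≡0 _ xs
      (λ x∈ y∈ e → trans (sym (identity (All.lookup <u x∈))) (trans e (identity (All.lookup <u y∈)))) uniq
    mult<w : 2 ^ (w ∸ u) < 2 ^ w
    mult<w = ^-monoʳ-< 2 ≤-refl (∸-monoʳ-< 1≤u u≤w)
  ... | yes l<u with pigeonhole-nonZero M (λ a → collisions (hash a (w ∸ l)) xs) (2 ^ l) (6 * pairs (length xs)) (begin
      2 ^ l * ∑ (downFrom M) (λ a → collisions (hash a (w ∸ l)) xs)
        ≤⟨ *-monoʳ-≤ (2 ^ l) (total-collisions u (w ∸ l) xs u≤j (m∸n≤m w l) <u uniq) ⟩
      2 ^ l * (6 * 2 ^ (w ∸ l) * pairs (length xs))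
        ≡⟨ lem (2 ^ l) (2 ^ (w ∸ l)) (pairs (length xs)) ⟩
      2 ^ l * 2 ^ (w ∸ l) * (6 * pairs (length xs))
        ≡⟨ cong (_* (6 * pairs (length xs))) (trans (sym (^-distribˡ-+-* 2 l (w ∸ l))) (cong (2 ^_) (m+[n∸m]≡n l≤w))) ⟩
      2 ^ w * (6 * pairs (length xs)) ∎)
    where
    open ≤-Reasoning
    l≤w : l ≤ w
    l≤w = ≤-trans (<⇒≤ l<u) u≤w
    -- `u + l < u + u ≤ suc w`, hence `u + l ≤ w`: rounding half the word size up does no harm.
    u≤j : u ≤ w ∸ l
    u≤j = m+n≤o⇒m≤o∸n u (s≤s⁻¹ (≤-trans (subst (_≤ u + u) (+-suc u l) (+-monoʳ-≤ u l<u)) 2u≤))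
    lem : ∀ a b c → a * (6 * b * c) ≡ a * b * (6 * c)
    lem = solve-∀
  ...   | a , a< , b = record
    { size = l ; mult = a ; size≤l = ≤-refl ; size≤w = ≤-trans (<⇒≤ l<u) u≤w ; mult< = a< ; bound = b }

-- Memory and dictionaries

group-sum : ∀ {B : Set} (_≟_ : DecidableEquality B) (f : A → B) (gs : List B) → Unique gs → ∀ xs →
            ∑ gs (λ g → length (filter (λ x → f x ≟ g) xs)) ≤ length xs
group-sum _≟_ f gs uniq []       = ≤-reflexive (trans (∑-const gs 0) (*-zeroʳ (length gs)))
group-sum _≟_ f gs uniq (x ∷ xs) = begin
  ∑ gs (λ g → length (filter (λ y → f y ≟ g) (x ∷ xs)))
    ≡⟨ ∑-cong gs split ⟩
  ∑ gs (λ g → ind (f x ≟ g) + length (filter (λ y → f y ≟ g) xs))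
    ≡⟨ ∑-+ gs _ _ ⟩
  ∑ gs (λ g → ind (f x ≟ g)) + ∑ gs (λ g → length (filter (λ y → f y ≟ g) xs))
    ≤⟨ +-mono-≤ (point gs uniq) (group-sum _≟_ f gs uniq xs) ⟩
  suc (length xs) ∎
  where
  open ≤-Reasoning
  split : ∀ g → length (filter (λ y → f y ≟ g) (x ∷ xs)) ≡
          ind (f x ≟ g) + length (filter (λ y → f y ≟ g) xs)
  split g with f x ≟ g
  ... | yes _ = refl
  ... | no _  = refl
  absent : ∀ hs → All (f x ≢_) hs → ∑ hs (λ g → ind (f x ≟ g)) ≡ 0
  absent []       _          = refl
  absent (h ∷ hs) (≢h ∷ ≢hs) with f x ≟ h
  ... | yes e = contradiction e ≢h
  ... | no _  = absent hs ≢hs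
  point : ∀ hs → Unique hs → ∑ hs (λ g → ind (f x ≟ g)) ≤ 1
  point []       _           = z≤n
  point (h ∷ hs) (h∉ ∷ uniq) with f x ≟ h
  ... | yes refl = ≤-reflexive (cong suc (absent hs h∉))
  ... | no _     = point hs uniq

Unique-map : ∀ {B : Set} (f : A → B) {xs} → (∀ {x y} → x ∈ xs → y ∈ xs → f x ≡ f y → x ≡ y) →
             Unique xs → Unique (map f xs)
Unique-map f inj []           = []
Unique-map f inj (x∉ ∷ uniq) =
  map⁺ (All.tabulate λ y∈ e → All.lookup x∉ y∈ (inj (here refl) (there y∈) e)) ∷
  Unique-map f (λ x∈ y∈ → inj (there x∈) (there y∈)) uniq

-- The static part R of the memory starts at address off, behind the structure for Stat and a copy
-- of the text; all addresses are absolute.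
module Memory (off : ℕ) where

  record At (R : List ℕ) (a v : ℕ) : Set where
    constructor at
    field
      index   : ℕ
      address : a ≡ off + index
      content : nth R index ≡ just v

  record Segment (R : List ℕ) (a : ℕ) (xs : List ℕ) : Set where
    constructor segment
    field
      cell : ∀ {j v} → nth xs j ≡ just v → At R (a + j) v

  open Segment public

  at-mono : ∀ {R a v} ν → At R a v → At (R ++ ν) a v
  at-mono {R} ν (at i e n) = at i e (nth-++ˡ R n)

  segment-mono : ∀ {R a xs} ν → Segment R a xs → Segment (R ++ ν) a xs
  segment-mono ν s = segment λ n → at-mono ν (cell s n)

  segment-end : ∀ R xs → Segment (R ++ xs) (off + length R) xs
  segment-end R xs = segment λ {j} n → at (length R + j) (+-assoc off (length R) j) (trans (nth-++ʳ R j) n)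

  segment-++ˡ : ∀ {R a} xs {ys} → Segment R a (xs ++ ys) → Segment R a xs
  segment-++ˡ xs s = segment λ n → cell s (nth-++ˡ xs n)

  segment-++ʳ : ∀ {R a} xs {ys} → Segment R a (xs ++ ys) → Segment R (a + length xs) ys
  segment-++ʳ {R} {a} xs s = segment λ {j} {v} n →
    subst (λ b → At R b v) (sym (+-assoc a (length xs) j)) (cell s (trans (nth-++ʳ xs j) n))

  segment-concatMap : ∀ {B : Set} {R a} (f : B → List ℕ) {xs x} → x ∈ xs → Segment R a (concatMap f xs) →
                      ∃ λ b → Segment R b (f x)
  segment-concatMap f {y ∷ xs} (here refl) s = _ , segment-++ˡ (f y) s
  segment-concatMap f {y ∷ xs} (there x∈)  s = segment-concatMap f x∈ (segment-++ʳ (f y) s)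

  -- The common scheme for the buckets of a table, the dictionaries of low halves and the children
  -- of a node. Memory only grows at its end, so what has been placed stays in place if both
  -- predicates survive appending.
  allocate : ∀ (Ready : List ℕ → Set) (Placed : List ℕ → ℕ → ℕ → Set) →
             (∀ {R} ν → Ready R → Ready (R ++ ν)) →
             (∀ {R x a} ν → Placed R x a → Placed (R ++ ν) x a) →
             ∀ (cost : ℕ → ℕ) xs →
             (∀ {x} → x ∈ xs → ∀ R → Ready R → ∃ λ ν → ∃ λ a → length ν ≤ cost x × Placed (R ++ ν) x a) →
             ∀ R → Ready R → ∃ λ ν → ∃ λ (p : ℕ → ℕ) →
               length ν ≤ ∑ xs cost × (∀ {x} → x ∈ xs → Placed (R ++ ν) x (p x))
  allocate Ready Placed rmono pmono cost []       h R r = [] , id , z≤n , λ ()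
  allocate Ready Placed rmono pmono cost (x ∷ xs) h R r
    with ν₁ , a , ≤₁ , placed₁ ← h (here refl) R r
    with ν₂ , p , ≤₂ , placed₂ ← allocate Ready Placed rmono pmono cost xs (h ∘ there) (R ++ ν₁) (rmono ν₁ r)
    = ν₁ ++ ν₂ , q , ≤-trans (≤-reflexive (length-++ ν₁)) (+-mono-≤ ≤₁ ≤₂) , placed
    where
    q : ℕ → ℕ
    q y with x ≟ y
    ... | yes _ = a
    ... | no _  = p y
    placed : ∀ {y} → y ∈ x ∷ xs → Placed (R ++ ν₁ ++ ν₂) y (q y)
    placed {y} y∈ with x ≟ y
    ... | yes refl = subst (λ R′ → Placed R′ x a) (++-assoc R ν₁ ν₂) (pmono ν₂ placed₁)
    placed (here refl) | no x≢x = contradiction refl x≢x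
    placed (there y∈)  | no _   = subst (λ R′ → Placed R′ _ (p _)) (++-assoc R ν₁ ν₂) (placed₂ y∈)

  -- Static dictionaries by two-level perfect hashing

  module Dictionary (w : ℕ) where
    open Hashing w public

    -- One table access: multiplier, shift, then the entries. The address is written with `+ 1 + 1`
    -- because the program reaches it by increments; the last two fields ensure that multiplier and
    -- shift fit into words.
    record Probe (R : List ℕ) (b y q : ℕ) : Set where
      constructor probe
      field
        {mult shift} : ℕ
        multAt       : At R b mult
        shiftAt      : At R (b + 1) shift
        entryAt      : At R (b + 1 + 1 + hash mult shift y) q
        mult<        : mult < 2 ^ w
        shift≤       : shift ≤ w

    probe-mono : ∀ {R b y q} ν → Probe R b y q → Probe (R ++ ν) b y q
    probe-mono ν (probe c₁ c₂ c₃ a< j≤) = probe (at-mono ν c₁) (at-mono ν c₂) (at-mono ν c₃) a< j≤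

    table : ∀ R a l (entry : ℕ → ℕ) → a < 2 ^ w → l ≤ w → ∃ λ ν → length ν ≡ 2 + 2 ^ l ×
            (∀ y → Probe (R ++ ν) (off + length R) y (entry (hash a (w ∸ l) y)))
    table R a l entry a< l≤w = ν , cong (2 +_) (length-applyUpTo entry (2 ^ l)) , λ y →
      probe (subst (λ b → At (R ++ ν) b a) (+-identityʳ (off + length R)) (cell s {0} refl))
            (cell s {1} refl)
            (subst (λ b → At (R ++ ν) b (entry (hash a (w ∸ l) y))) (lem (off + length R) (hash a (w ∸ l) y))
              (cell s {2 + hash a (w ∸ l) y} (nth-applyUpTo entry (hash-< a l y l≤w))))
            a< (m∸n≤m w l)
      where
      ν = a ∷ (w ∸ l) ∷ applyUpTo entry (2 ^ l)
      s : Segment (R ++ ν) (off + length R) ν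
      s = segment-end R ν
      lem : ∀ b h → b + (2 + h) ≡ b + 1 + 1 + h
      lem = solve-∀

    -- A left inverse of `f` on the collision-free list `bs`, extended to all cells by the default
    -- `x₀`, so that a lookup of an absent key also ends at an element of `xs`.
    cells : ∀ f bs {xs x₀} → x₀ ∈ xs → (∀ {x} → x ∈ bs → x ∈ xs) → collisions f bs ≡ 0 →
            ∃ λ (c : ℕ → ℕ) → (∀ i → c i ∈ xs) × (∀ {x} → x ∈ bs → c (f x) ≡ x)
    cells f []       x₀∈ incl e = (λ _ → _) , (λ _ → x₀∈) , λ ()
    cells f (x ∷ bs) {xs} x₀∈ incl e
      with c , c∈ , inv ← cells f bs x₀∈ (incl ∘ there) (m+n≡0⇒n≡0 (∑ bs (λ y → ind (f y ≟ f x))) e)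
      = c′ , c′∈ , inv′
      where
      c′ : ℕ → ℕ
      c′ i with f x ≟ i
      ... | yes _ = x
      ... | no _  = c i
      c′∈ : ∀ i → c′ i ∈ xs
      c′∈ i with f x ≟ i
      ... | yes _ = incl (here refl)
      ... | no _  = c∈ i
      inv′ : ∀ {y} → y ∈ x ∷ bs → c′ (f y) ≡ y
      inv′ {y} y∈ with f x ≟ f y
      inv′ (here refl) | yes _ = refl
      inv′ (there y∈)  | yes e′ = contradiction e′ (collision-free f (m+n≡0⇒m≡0 _ e) y∈)
      inv′ (here refl) | no x≢x = contradiction refl x≢x
      inv′ (there y∈)  | no _   = inv y∈

    module _ (u : ℕ) (1≤u : 1 ≤ u) (u≤w : u ≤ w) (2u≤ : u + u ≤ suc w) where

      Bounded = All (_< 2 ^ u)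

      -- With more than `6 * pairs (length bs)` cells, the bound of `choose` leaves less than one
      -- collision. The defaults come from `xs`, since the bucket `bs` may be empty and must still
      -- be answered. The `3` covers the two header words and the rounding to a power of two.
      quadratic : ∀ xs (p : ℕ → ℕ) {x₀} → x₀ ∈ xs → ∀ bs → (∀ {x} → x ∈ bs → x ∈ xs) → Bounded bs → Unique bs →
                  ∀ R → ∃ λ ν → ∃ λ b → length ν ≤ 3 + 12 * pairs (length bs) ×
                  (∀ y → ∃ λ x → x ∈ xs × Probe (R ++ ν) b y (p x) × (y ∈ bs → x ≡ y))
      quadratic xs p x₀∈ bs incl <u uniq R =
        proj₁ tb , off + length R
        , ≤-trans (≤-reflexive (proj₁ (proj₂ tb))) (≤-trans (+-monoʳ-≤ 2 (≤-trans (^-monoʳ-≤ 2 size≤l) (proj₂ (proj₂ lg))))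
            (≤-reflexive (lem (pairs (length bs)))))
        , λ y → proj₁ cs (hash mult (w ∸ size) y) , proj₁ (proj₂ cs) _ , proj₂ (proj₂ tb) y , proj₂ (proj₂ cs)
        where
        lg = log-approx (6 * pairs (length bs))
        l = proj₁ lg
        open Choice (choose u 1≤u u≤w 2u≤ l bs <u uniq)
        cs = cells (hash mult (w ∸ size)) bs x₀∈ incl
               (n<1⇒n≡0 (*-cancelˡ-< (2 ^ l) _ 1 (≤-<-trans bound (subst (6 * pairs (length bs) <_) (sym (*-identityʳ (2 ^ l))) (proj₁ (proj₂ lg))))))
        tb = table R mult size (p ∘ proj₁ cs) mult< size≤w
        lem : ∀ n → 2 + (2 * (6 * n) + 1) ≡ 3 + 12 * n
        lem = solve-∀

      -- The scheme of Fredman, Komlós and Szemerédi: with about as many cells as keys there are at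
      -- most `3 * length xs` collisions, hence that many pairs of keys within buckets, and the
      -- quadratic tables have linear total size. The buckets are placed before the first level,
      -- whose entries are their addresses.
      twoLevel : ∀ xs (p : ℕ → ℕ) {x₀} → x₀ ∈ xs → Bounded xs → Unique xs →
                 ∀ R → ∃ λ ν → ∃ λ b → length ν ≤ 44 * length xs ×
                 (∀ y → ∃ λ q → ∃ λ x → x ∈ xs × Probe (R ++ ν) b y q × Probe (R ++ ν) q y (p x) × (y ∈ xs → x ≡ y))
      twoLevel xs@(_ ∷ xs′) p x₀∈ <u uniq R =
        ν₁ ++ ν₂ , off + length (R ++ ν₁) , size-bound , λ y →
          let x , x∈ , pr , f = placed (∈-downFrom⁺ (hash-< mult size y size≤w)) y
          in q (h y) , x , x∈ , subst (λ R′ → Probe R′ (off + length (R ++ ν₁)) y (q (h y))) (++-assoc R ν₁ ν₂) (proj₂ (proj₂ tb) y)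
           , subst (λ R′ → Probe R′ (q (h y)) y (p x)) (++-assoc R ν₁ ν₂) (probe-mono ν₂ pr)
           , λ y∈ → f (∈-filter⁺ (λ z → h z ≟ h y) y∈ refl)
        where
        d = length xs
        lg = log-approx (length xs′)
        l = proj₁ lg
        open Choice (choose u 1≤u u≤w 2u≤ l xs <u uniq)
        h = hash mult (w ∸ size)
        PlacedBucket : List ℕ → ℕ → ℕ → Set
        PlacedBucket R i b = ∀ y → ∃ λ x → x ∈ xs × Probe R b y (p x) × (y ∈ bucket h xs i → x ≡ y)
        al = allocate (λ _ → ⊤) PlacedBucket
               (λ _ _ → tt) (λ ν g y → let x , x∈ , pr , f = g y in x , x∈ , probe-mono ν pr , f)
               (λ i → 3 + 12 * pairs (length (bucket h xs i))) (downFrom (2 ^ size))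
               (λ {i} _ R _ → quadratic xs p x₀∈ (bucket h xs i)
                  (λ x∈ → proj₁ (∈-filter⁻ (λ z → h z ≟ i) x∈)) (filter⁺ (λ z → h z ≟ i) <u) (Unique-filter (λ z → h z ≟ i) uniq) R)
               R tt
        ν₁ = proj₁ al
        q = proj₁ (proj₂ al)
        ≤₁ = proj₁ (proj₂ (proj₂ al))
        placed : ∀ {i} → i ∈ downFrom (2 ^ size) → PlacedBucket (R ++ ν₁) i (q i)
        placed = proj₂ (proj₂ (proj₂ al))
        tb = table (R ++ ν₁) mult size q mult< size≤w
        ν₂ = proj₁ tb
        len = proj₁ (proj₂ tb)
        few : collisions h xs ≤ 3 * d
        few = *-cancelˡ-≤ (2 ^ l) {{m^n≢0 2 l}} (begin
          2 ^ l * collisions h xs ≤⟨ bound ⟩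
          6 * pairs d             ≡⟨ *-assoc 3 2 (pairs d) ⟩
          3 * (2 * pairs d)       ≤⟨ *-monoʳ-≤ 3 (2pairs d) ⟩
          3 * (d * d)             ≤⟨ *-monoʳ-≤ 3 (*-monoˡ-≤ d (proj₁ (proj₂ lg))) ⟩
          3 * (2 ^ l * d)         ≡⟨ lem (2 ^ l) d ⟩
          2 ^ l * (3 * d)         ∎)
          where
          open ≤-Reasoning
          lem : ∀ a b → 3 * (a * b) ≡ a * (3 * b)
          lem = solve-∀
        size-bound : length (ν₁ ++ ν₂) ≤ 44 * d
        size-bound = begin
          length (ν₁ ++ ν₂)                 ≡⟨ length-++ ν₁ ⟩
          length ν₁ + length ν₂             ≤⟨ +-mono-≤ ≤₁ (≤-reflexive len) ⟩
          ∑ (downFrom (2 ^ size)) (λ i → 3 + 12 * pairs (length (bucket h xs i))) + (2 + 2 ^ size)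
            ≡⟨ cong (_+ (2 + 2 ^ size)) (trans (∑-+ (downFrom (2 ^ size)) (λ _ → 3) (λ i → 12 * pairs (length (bucket h xs i))))
                 (cong₂ _+_ (trans (∑-const (downFrom (2 ^ size)) 3) (cong (_* 3) (length-downFrom (2 ^ size))))
                            (∑-*ˡ (downFrom (2 ^ size)) (λ i → pairs (length (bucket h xs i))) 12))) ⟩
          2 ^ size * 3 + 12 * ∑ (downFrom (2 ^ size)) (λ i → pairs (length (bucket h xs i))) + (2 + 2 ^ size)
            ≤⟨ +-monoˡ-≤ (2 + 2 ^ size) (+-monoʳ-≤ (2 ^ size * 3) (*-monoʳ-≤ 12 (≤-trans (bucket-pairs h xs (2 ^ size)) few))) ⟩
          2 ^ size * 3 + 12 * (3 * d) + (2 + 2 ^ size)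
            ≡⟨ lem₁ (2 ^ size) d ⟩
          4 * 2 ^ size + (36 * d + 2)
            ≤⟨ +-monoˡ-≤ (36 * d + 2) (*-monoʳ-≤ 4 (≤-trans (^-monoʳ-≤ 2 size≤l) (proj₂ (proj₂ lg)))) ⟩
          4 * (2 * length xs′ + 1) + (36 * d + 2)
            ≤⟨ m≤m+n _ 2 ⟩
          4 * (2 * length xs′ + 1) + (36 * d + 2) + 2
            ≡⟨ lem₂ (length xs′) ⟩
          44 * d ∎
          where
          open ≤-Reasoning
          lem₁ : ∀ a d → a * 3 + 12 * (3 * d) + (2 + a) ≡ 4 * a + (36 * d + 2)
          lem₁ = solve-∀
          lem₂ : ∀ e → 4 * (2 * e + 1) + (36 * (1 + e) + 2) + 2 ≡ 44 * (1 + e)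
          lem₂ = solve-∀

    half : ℕ
    half = ⌊ w /2⌋

    instance
      2^half≢0 : NonZero (2 ^ half)
      2^half≢0 = m^n≢0 2 half

    high low : ℕ → ℕ
    high y = y / 2 ^ half
    low  y = y % 2 ^ half

    -- Two probes with the high half find the dictionary of the low halves that occur with it; two
    -- probes with the low half find the value.
    record Lookup (R : List ℕ) (b y p : ℕ) : Set where
      constructor chain
      field
        {q₁ q₂ q₃} : ℕ
        probe₁     : Probe R b (high y) q₁
        probe₂     : Probe R q₁ (high y) q₂
        probe₃     : Probe R q₂ (low y) q₃
        probe₄     : Probe R q₃ (low y) p

    lookup-mono : ∀ {R b y p} ν → Lookup R b y p → Lookup (R ++ ν) b y p
    lookup-mono ν (chain p₁ p₂ p₃ p₄) =
      chain (probe-mono ν p₁) (probe-mono ν p₂) (probe-mono ν p₃) (probe-mono ν p₄)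

    private
      -- The larger half: high halves have `u` bits and low halves `half ≤ u` bits, so both kinds of
      -- keys lie below `2 ^ u`.
      u : ℕ
      u = w ∸ half

      half+u : half + u ≡ w
      half+u = m+[n∸m]≡n (⌊n/2⌋≤n w)

      u≡⌈⌉ : u ≡ ⌈ w /2⌉
      u≡⌈⌉ = +-cancelˡ-≡ half u ⌈ w /2⌉ (trans half+u (sym (⌊n/2⌋+⌈n/2⌉≡n w)))

      u≤w : u ≤ w
      u≤w = m∸n≤m w half

      ⌈n/2⌉≤1+⌊n/2⌋ : ∀ n → ⌈ n /2⌉ ≤ suc ⌊ n /2⌋
      ⌈n/2⌉≤1+⌊n/2⌋ zero          = z≤n
      ⌈n/2⌉≤1+⌊n/2⌋ (suc zero)    = ≤-refl
      ⌈n/2⌉≤1+⌊n/2⌋ (suc (suc n)) = s≤s (⌈n/2⌉≤1+⌊n/2⌋ n)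

      2u≤ : u + u ≤ suc w
      2u≤ = subst (λ v → u + u ≤ suc v) half+u (+-monoˡ-≤ u (subst (_≤ suc half) (sym u≡⌈⌉) (⌈n/2⌉≤1+⌊n/2⌋ w)))

      recombine : ∀ y → y ≡ low y + high y * 2 ^ half
      recombine y = m≡m%n+[m/n]*n y (2 ^ half)

    module _ (1≤w : 1 ≤ w) (xs : List ℕ) (p : ℕ → ℕ) (<w : All (_< 2 ^ w) xs) (uniq : Unique xs) where

      private
        1≤u : 1 ≤ u
        1≤u = subst (1 ≤_) (sym u≡⌈⌉) (⌈n/2⌉-mono 1≤w)

        his : List ℕ
        his = deduplicate _≟_ (map high xs)

        group : ℕ → List ℕ
        group g = filter (λ x → high x ≟ g) xs

        his< : All (_< 2 ^ u) his
        his< = All.tabulate λ g∈ → let x , x∈ , e = ∈-map⁻ high (∈-deduplicate⁻ _≟_ (map high xs) g∈) in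
          subst (_< 2 ^ u) (sym e) (m<n*o⇒m/o<n (subst (x <_)
            (trans (cong (2 ^_) (trans (sym half+u) (+-comm half u))) (^-distribˡ-+-* 2 u half)) (All.lookup <w x∈)))

        PlacedLows : List ℕ → ℕ → ℕ → Set
        PlacedLows R g b = ∀ z → ∃ λ q → ∃ λ x → x ∈ xs × Probe R b z q × Probe R q z (p x) ×
                                (∀ {y} → y ∈ xs → high y ≡ g → low y ≡ z → x ≡ y)

        high-eq : ∀ {g x} → x ∈ group g → high x ≡ g
        high-eq {g} x∈ = proj₂ (∈-filter⁻ (λ x → high x ≟ g) {xs = xs} x∈)

        same : ∀ {x y} → low x ≡ low y → high x ≡ high y → x ≡ y
        same {x} {y} e e′ = trans (recombine x) (trans (cong₂ (λ a b → a + b * 2 ^ half) e e′) (sym (recombine y)))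

        lows : ∀ {g} → g ∈ his → ∀ R → ⊤ → ∃ λ ν → ∃ λ b → length ν ≤ 44 * length (group g) × PlacedLows (R ++ ν) g b
        lows {g} g∈ R _ = proj₁ tl , proj₁ (proj₂ tl) , subst (λ n → length (proj₁ tl) ≤ 44 * n) (length-map low (group g)) (proj₁ (proj₂ (proj₂ tl))) , λ z →
            let q , z′ , z′∈ , pr₁ , pr₂ , i = proj₂ (proj₂ (proj₂ tl)) z
                x , x∈ , e = ∈-map⁻ low z′∈
                e≡ : z′ + g * 2 ^ half ≡ x
                e≡ = trans (cong₂ (λ a b → a + b * 2 ^ half) e (sym (high-eq x∈))) (sym (recombine x))
            in q , x , proj₁ (∈-filter⁻ (λ x → high x ≟ g) x∈) , pr₁ , subst (λ x → Probe _ q z (p x)) e≡ pr₂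
             , λ {y} y∈ hy ly → same (trans (sym e) (trans (i (subst (_∈ map low (group g)) ly (∈-map⁺ low (∈-filter⁺ (λ x → high x ≟ g) y∈ hy)))) (sym ly)))
                                     (trans (high-eq x∈) (sym hy))
          where
          first = ∈-map⁻ high (∈-deduplicate⁻ _≟_ (map high xs) g∈)
          tl = twoLevel u 1≤u u≤w 2u≤ (map low (group g)) (λ z → p (z + g * 2 ^ half))
                 (∈-map⁺ low (∈-filter⁺ (λ x → high x ≟ g) (proj₁ (proj₂ first)) (sym (proj₂ (proj₂ first)))))
                 (All.tabulate λ z∈ → let x , _ , e = ∈-map⁻ low z∈ in
                    subst (_< 2 ^ u) (sym e) (<-≤-trans (m%n<n x (2 ^ half)) (^-monoʳ-≤ 2 (subst (half ≤_) (sym u≡⌈⌉) (⌊n/2⌋≤⌈n/2⌉ w)))))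
                 (Unique-map low (λ x∈ y∈ e → same e (trans (high-eq x∈) (sym (high-eq y∈))))
                    (Unique-filter (λ x → high x ≟ g) uniq)) R

      -- `88 = 44 + 44`: the groups of equal high half together contain each key at most once, and
      -- there are at most as many high halves as keys.
      dictionary : ∀ {x₀} → x₀ ∈ xs → ∀ R → ∃ λ ν → ∃ λ b → length ν ≤ 88 * length xs ×
                   (∀ y → ∃ λ x → x ∈ xs × Lookup (R ++ ν) b y (p x) × (y ∈ xs → x ≡ y))
      dictionary x₀∈ R = ν₁ ++ ν₂ , proj₁ (proj₂ tl) , size-bound , λ y →
          let q₁ , g , g∈ , pr₁ , pr₂ , f = proj₂ (proj₂ (proj₂ tl)) (high y)
              q₃ , x , x∈ , pr₃ , pr₄ , f′ = placed g∈ (low y)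
          in x , x∈ , chain (re pr₁) (re pr₂) (re (probe-mono ν₂ pr₃)) (re (probe-mono ν₂ pr₄))
           , λ y∈ → f′ y∈ (sym (f (∈-deduplicate⁺ _≟_ (∈-map⁺ high y∈)))) refl
        where
        al = allocate (λ _ → ⊤) PlacedLows (λ _ _ → tt)
               (λ ν h z → let q , x , x∈ , pr₁ , pr₂ , f = h z in q , x , x∈ , probe-mono ν pr₁ , probe-mono ν pr₂ , f)
               (λ g → 44 * length (group g)) his lows R tt
        ν₁ = proj₁ al
        q = proj₁ (proj₂ al)
        ≤₁ = proj₁ (proj₂ (proj₂ al))
        placed : ∀ {g} → g ∈ his → PlacedLows (R ++ ν₁) g (q g)
        placed = proj₂ (proj₂ (proj₂ al))
        tl = twoLevel u 1≤u u≤w 2u≤ his q (∈-deduplicate⁺ _≟_ (∈-map⁺ high x₀∈)) his<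
               (deduplicate-! _≟_ (map high xs)) (R ++ ν₁)
        ν₂ = proj₁ tl
        ≤₂ = proj₁ (proj₂ (proj₂ tl))
        re : ∀ {b y q} → Probe ((R ++ ν₁) ++ ν₂) b y q → Probe (R ++ ν₁ ++ ν₂) b y q
        re {b} {y} {q} = subst (λ R′ → Probe R′ b y q) (++-assoc R ν₁ ν₂)
        size-bound : length (ν₁ ++ ν₂) ≤ 88 * length xs
        size-bound = begin
          length (ν₁ ++ ν₂)                                      ≡⟨ length-++ ν₁ ⟩
          length ν₁ + length ν₂                                  ≤⟨ +-mono-≤ ≤₁ ≤₂ ⟩
          ∑ his (λ g → 44 * length (group g)) + 44 * length his  ≡⟨ cong (_+ 44 * length his) (∑-*ˡ his _ 44) ⟩
          44 * ∑ his (λ g → length (group g)) + 44 * length his  ≤⟨ +-mono-≤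
            (*-monoʳ-≤ 44 (group-sum _≟_ high his (deduplicate-! _≟_ (map high xs)) xs))
            (*-monoʳ-≤ 44 (≤-trans (length-deduplicate _≟_ (map high xs)) (≤-reflexive (length-map high xs)))) ⟩
          44 * length xs + 44 * length xs                        ≡⟨ sym (*-distribʳ-+ (length xs) 44 44) ⟩
          88 * length xs                                         ∎
          where open ≤-Reasoning

-- Executions

nth-lookup : ∀ (xs : List A) {a x} → nth xs a ≡ just x → ∃ λ (i : Fin (length xs)) → toℕ i ≡ a × lookup xs i ≡ x
nth-lookup (x ∷ xs) {zero}  refl = zero , refl , refl
nth-lookup (x ∷ xs) {suc a} e    = let i , p , q = nth-lookup xs e in suc i , cong suc p , q

lookup-nth : ∀ (xs : List A) i → nth xs (toℕ i) ≡ just (lookup xs i)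
lookup-nth (x ∷ xs) zero    = refl
lookup-nth (x ∷ xs) (suc i) = lookup-nth xs i

lookup-++ : ∀ (xs ys : List A) i → ∃ λ (j : Fin (length (xs ++ ys))) → toℕ j ≡ toℕ i ×
            lookup (xs ++ ys) j ≡ lookup xs i × (∀ x → (xs ++ ys) [ j ]∷= x ≡ (xs [ i ]∷= x) ++ ys)
lookup-++ (x ∷ xs) ys zero    = zero , refl , refl , λ _ → refl
lookup-++ (x ∷ xs) ys (suc i) =
  let j , p , q , r = lookup-++ xs ys i in suc j , cong suc p , q , cong (x ∷_) ∘ r

length-∷= : ∀ (xs : List A) i x → length (xs [ i ]∷= x) ≡ length xs
length-∷= (y ∷ xs) zero    x = refl
length-∷= (y ∷ xs) (suc i) x = cong suc (length-∷= xs i x)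

-- No instruction resizes the memory. Hence a call of `statProgram` may change its structure, but
-- not the addresses of what lies behind it.
length-preserved : ∀ {w} {S S′ : State w} {p t} → S ⊢ p ⇓[ t ] S′ → length (proj₂ S′) ≡ length (proj₂ S)
length-preserved skip             = refl
length-preserved const            = refl
length-preserved op               = refl
length-preserved (load i e)       = refl
length-preserved {S = ρ , μ} (store i e) = length-∷= μ i _
length-preserved (seq d d′)       = trans (length-preserved d′) (length-preserved d)
length-preserved (if-nonzero _ d) = length-preserved d
length-preserved (if-zero _ d)    = length-preserved d
length-preserved (while-done _)   = refl
length-preserved (while-step _ d d′) = trans (length-preserved d′) (length-preserved d)

shift : ℕ → Program → Program
shift b skip         = skip
shift b (const r a)  = const (b + r) a
shift b (op o r p q) = op o (b + r) (b + p) (b + q)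
shift b (load r p)   = load (b + r) (b + p)
shift b (store p q)  = store (b + p) (b + q)
shift b (p ⨾ q)      = shift b p ⨾ shift b q
shift b (ifnz r p q) = ifnz (b + r) (shift b p) (shift b q)
shift b (while r p)  = while (b + r) (shift b p)

≡ᵇ-+ˡ : ∀ b m n → (b + m ≡ᵇ b + n) ≡ (m ≡ᵇ n)
≡ᵇ-+ˡ zero    m n = refl
≡ᵇ-+ˡ (suc b) m n = ≡ᵇ-+ˡ b m n

<⇒≡ᵇ-false : ∀ {m n} → m < n → (m ≡ᵇ n) ≡ false
<⇒≡ᵇ-false {zero}  (s≤s _)       = refl
<⇒≡ᵇ-false {suc m} (s≤s m<n) = <⇒≡ᵇ-false m<n

≡ᵇ-refl : ∀ m → (m ≡ᵇ m) ≡ true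
≡ᵇ-refl zero    = refl
≡ᵇ-refl (suc m) = ≡ᵇ-refl m

update-below : ∀ {w} (ρ : Regs w) {x r r′} → r′ < r → (ρ [ r ↦ x ]) r′ ≡ ρ r′
update-below ρ {r = r} {r′} r′<r rewrite <⇒≡ᵇ-false r′<r = refl

update-at : ∀ {w} (ρ : Regs w) r {x} → (ρ [ r ↦ x ]) r ≡ x
update-at ρ r rewrite ≡ᵇ-refl r = refl

update-shift : ∀ {w} (σ ρ : Regs w) b {x y} r → (∀ r → σ (b + r) ≡ ρ r) → x ≡ y →
               ∀ r′ → (σ [ b + r ↦ x ]) (b + r′) ≡ (ρ [ r ↦ y ]) r′
update-shift σ ρ b r h refl r′ rewrite ≡ᵇ-+ˡ b r′ r with r′ ≡ᵇ r
... | true  = refl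
... | false = h r′

-- A frame property. The renamed program touches no register below `b`, and a run that never leaves
-- its memory does not notice further words `ν` behind it.
shift-run : ∀ {w} {S S′ : State w} {p t} → S ⊢ p ⇓[ t ] S′ → ∀ b ν σ → (∀ r → σ (b + r) ≡ proj₁ S r) →
            ∃ λ σ′ → (σ , proj₂ S ++ ν) ⊢ shift b p ⇓[ t ] (σ′ , proj₂ S′ ++ ν) ×
                     (∀ r → σ′ (b + r) ≡ proj₁ S′ r) × (∀ {r} → r < b → σ′ r ≡ σ r)
shift-run skip b ν σ h = σ , skip , h , λ _ → refl
shift-run {S = ρ , _} (const {r = r}) b ν σ h =
  _ , const , update-shift σ ρ b r h refl , λ r′<b → update-below σ (≤-trans r′<b (m≤m+n b r))
shift-run {S = ρ , _} (op {o = o} {r} {p} {q}) b ν σ h =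
  _ , op , update-shift σ ρ b r h (cong₂ (evalOp o) (h p) (h q)) , λ r′<b → update-below σ (≤-trans r′<b (m≤m+n b r))
shift-run {S = ρ , μ} (load {r = r} {p} i e) b ν σ h =
  let j , j≡i , l , _ = lookup-++ μ ν i
  in _ , load j (trans j≡i (trans e (cong value (sym (h p))))) , update-shift σ ρ b r h l
       , λ r′<b → update-below σ (≤-trans r′<b (m≤m+n b r))
shift-run {S = ρ , μ} (store {p = p} {q} i e) b ν σ h =
  let j , j≡i , _ , s = lookup-++ μ ν i
  in σ , subst (λ μ′ → (σ , μ ++ ν) ⊢ store (b + p) (b + q) ⇓[ 1 ] (σ , μ′))
           (trans (s (σ (b + q))) (cong (λ x → (μ [ i ]∷= x) ++ ν) (h q)))
           (store j (trans j≡i (trans e (cong value (sym (h p))))))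
       , h , λ _ → refl
shift-run (seq d d′) b ν σ h =
  let σ₁ , e₁ , h₁ , k₁ = shift-run d b ν σ h
      σ₂ , e₂ , h₂ , k₂ = shift-run d′ b ν σ₁ h₁
  in σ₂ , seq e₁ e₂ , h₂ , λ r<b → trans (k₂ r<b) (k₁ r<b)
shift-run (if-nonzero {r = r} nz d) b ν σ h =
  let σ₁ , e₁ , h₁ , k₁ = shift-run d b ν σ h
  in σ₁ , if-nonzero (nz ∘ trans (cong value (sym (h r)))) e₁ , h₁ , k₁
shift-run (if-zero {r = r} z d) b ν σ h =
  let σ₁ , e₁ , h₁ , k₁ = shift-run d b ν σ h
  in σ₁ , if-zero (trans (cong value (h r)) z) e₁ , h₁ , k₁
shift-run (while-done {r = r} z) b ν σ h = σ , while-done (trans (cong value (h r)) z) , h , λ _ → refl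
shift-run (while-step {r = r} nz d d′) b ν σ h =
  let σ₁ , e₁ , h₁ , k₁ = shift-run d b ν σ h
      σ₂ , e₂ , h₂ , k₂ = shift-run d′ b ν σ₁ h₁
  in σ₂ , while-step (nz ∘ trans (cong value (sym (h r)))) e₁ e₂ , h₂ , λ r<b → trans (k₂ r<b) (k₁ r<b)

bit-<-≢0 : ∀ a b → bit (a <ᵇ b) ≢ 0 → a < b
bit-<-≢0 a b h with a <ᵇ b in e
... | true  = <ᵇ⇒< a b (subst Bool.T (sym e) _)
... | false = contradiction refl h

bit-<-≡0 : ∀ a b → bit (a <ᵇ b) ≡ 0 → b ≤ a
bit-<-≡0 a b h = ≮⇒≥ λ a<b → lem (<⇒<ᵇ a<b) h
  where
  lem : ∀ {c} → Bool.T c → bit c ≢ 0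
  lem {true} _ ()

bit-≡-≢0 : ∀ a b → bit (a ≡ᵇ b) ≢ 0 → a ≡ b
bit-≡-≢0 a b h with a ≡ᵇ b in e
... | true  = ≡ᵇ⇒≡ a b (subst Bool.T (sym e) _)
... | false = contradiction refl h

bit-≡-≡0 : ∀ a b → bit (a ≡ᵇ b) ≡ 0 → a ≢ b
bit-≡-≡0 a .a h refl rewrite ≡ᵇ-refl a = contradiction h λ ()

bit-≤1 : ∀ c → bit c ≤ 1
bit-≤1 true  = ≤-refl
bit-≤1 false = z≤n

-- Symbolic execution with time bounds

module Execution (w : ℕ) where

  instance
    W≢0 : NonZero (2 ^ w)
    W≢0 = m^n≢0 2 w

  value-word : ∀ a → value (word {w} a) ≡ a % 2 ^ w
  value-word a = toℕ-fromℕ< (m%n<n a (2 ^ w))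

  value-word-< : ∀ {a} → a < 2 ^ w → value (word {w} a) ≡ a
  value-word-< {a} a< = trans (value-word a) (m<n⇒m%n≡m a<)

  value-< : ∀ (x : Word w) → value x < 2 ^ w
  value-< x = toℕ<n (toFin x)

  value-injective : ∀ {x y : Word w} → value x ≡ value y → x ≡ y
  value-injective e = cong mkWord (toℕ-injective e)

  ≡-word : ∀ {x : Word w} {a} → value x ≡ a → x ≡ word a
  ≡-word {x} refl = value-injective (sym (value-word-< (value-< x)))

  -- Total correctness in the style of weakest preconditions. The time is only bounded, so the
  -- branches of a conditional may take different times.
  Exec : Regs w → Memory w → Program → ℕ → (Regs w → Memory w → Set) → Set
  Exec ρ μ p t Q = ∃ λ t′ → ∃ λ ρ′ → ∃ λ μ′ → ((ρ , μ) ⊢ p ⇓[ t′ ] (ρ′ , μ′)) × t′ ≤ t × Q ρ′ μ′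

  private variable
    ρ : Regs w
    μ : Memory w
    P Q : Regs w → Memory w → Set
    p q : Program
    r r₁ r₂ t t₁ t₂ a b : ℕ

  weaken : t₁ ≤ t₂ → Exec ρ μ p t₁ Q → Exec ρ μ p t₂ Q
  weaken t₁≤ (t , ρ , μ , d , t≤ , post) = t , ρ , μ , d , ≤-trans t≤ t₁≤ , post

  done : Q ρ μ → Exec ρ μ skip (suc t) Q
  done post = 1 , _ , _ , skip , s≤s z≤n , post

  _⟫_ : Exec ρ μ p t₁ P → (∀ {ρ μ} → P ρ μ → Exec ρ μ q t₂ Q) → Exec ρ μ (p ⨾ q) (t₁ + t₂) Q
  (_ , _ , _ , d , ≤₁ , mid) ⟫ f = let _ , _ , _ , d′ , ≤₂ , post = f mid in
    _ , _ , _ , seq d d′ , +-mono-≤ ≤₁ ≤₂ , post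

  infixl 1 _⟫_

  -- The continuation gets an abstract word of known value, so that the state does not accumulate
  -- nested arithmetic terms.
  step : (ρ , μ) ⊢ p ⇓[ 1 ] (ρ [ r ↦ word a ] , μ) → (∀ x → value x ≡ a % 2 ^ w → Exec (ρ [ r ↦ x ]) μ q t Q) →
         Exec ρ μ (p ⨾ q) (suc t) Q
  step {a = a} d f = let _ , _ , _ , d′ , ≤₂ , post = f (word a) (value-word a) in
    _ , _ , _ , seq d d′ , s≤s ≤₂ , post

  module _ (ea : value (ρ r₁) ≡ a) (eb : value (ρ r₂) ≡ b) where

    private
      binary : ∀ o c → evalℕ w o a b % 2 ^ w ≡ c → (∀ x → value x ≡ c → Exec (ρ [ r ↦ x ]) μ q t Q) →
               Exec ρ μ (op o r r₁ r₂ ⨾ q) (suc t) Q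
      binary o c e f = step op (λ x ex → f x (trans ex (trans (cong₂ (λ a b → evalℕ w o a b % 2 ^ w) ea eb) e)))

      a< : a < 2 ^ w
      a< = subst (_< 2 ^ w) ea (value-< _)

    add: : a + b < 2 ^ w → (∀ x → value x ≡ a + b → Exec (ρ [ r ↦ x ]) μ q t Q) → Exec ρ μ (op add r r₁ r₂ ⨾ q) (suc t) Q
    add: h = binary add (a + b) (m<n⇒m%n≡m h)

    mul: : (∀ x → value x ≡ (a * b) % 2 ^ w → Exec (ρ [ r ↦ x ]) μ q t Q) → Exec ρ μ (op mul r r₁ r₂ ⨾ q) (suc t) Q
    mul: = binary mul _ refl

    sub: : b ≤ a → (∀ x → value x ≡ a ∸ b → Exec (ρ [ r ↦ x ]) μ q t Q) → Exec ρ μ (op sub r r₁ r₂ ⨾ q) (suc t) Q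
    sub: b≤a = binary sub (a ∸ b) (begin
      (2 ^ w + a ∸ b) % 2 ^ w       ≡⟨ cong (_% 2 ^ w) (trans (+-∸-assoc (2 ^ w) b≤a) (trans (+-comm (2 ^ w) (a ∸ b)) (cong (a ∸ b +_) (sym (+-identityʳ (2 ^ w)))))) ⟩
      (a ∸ b + 1 * 2 ^ w) % 2 ^ w   ≡⟨ [m+kn]%n≡m%n (a ∸ b) 1 (2 ^ w) ⟩
      (a ∸ b) % 2 ^ w               ≡⟨ m<n⇒m%n≡m (≤-<-trans (m∸n≤m a b) a<) ⟩
      a ∸ b                         ∎)
      where open ≡-Reasoning

    div: : .{{_ : NonZero b}} → (∀ x → value x ≡ a / b → Exec (ρ [ r ↦ x ]) μ q t Q) → Exec ρ μ (op div r r₁ r₂ ⨾ q) (suc t) Q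
    div: = binary div (a / b) (lem b a<)
      where
      lem : ∀ b .{{_ : NonZero b}} → a < 2 ^ w → evalℕ w div a b % 2 ^ w ≡ a / b
      lem (suc b) a< = m<n⇒m%n≡m (≤-<-trans (m/n≤m a (suc b)) a<)

    mod: : .{{_ : NonZero b}} → (∀ x → value x ≡ a % b → Exec (ρ [ r ↦ x ]) μ q t Q) → Exec ρ μ (op mod r r₁ r₂ ⨾ q) (suc t) Q
    mod: = binary mod (a % b) (lem b a<)
      where
      lem : ∀ b .{{_ : NonZero b}} → a < 2 ^ w → evalℕ w mod a b % 2 ^ w ≡ a % b
      lem (suc b) a< = m<n⇒m%n≡m (≤-<-trans (m%n≤m a (suc b)) a<)

    shr: : (∀ x → value x ≡ _/_ a (2 ^ b) {{m^n≢0 2 b}} → Exec (ρ [ r ↦ x ]) μ q t Q) → Exec ρ μ (op shr r r₁ r₂ ⨾ q) (suc t) Q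
    shr: = binary shr _ (m<n⇒m%n≡m (≤-<-trans (m/n≤m a (2 ^ b) {{m^n≢0 2 b}}) a<))

    lt: : 1 < 2 ^ w → (∀ x → value x ≡ bit (a <ᵇ b) → Exec (ρ [ r ↦ x ]) μ q t Q) → Exec ρ μ (op lt r r₁ r₂ ⨾ q) (suc t) Q
    lt: h = binary lt _ (m<n⇒m%n≡m (≤-<-trans (bit-≤1 (a <ᵇ b)) h))

    eq: : 1 < 2 ^ w → (∀ x → value x ≡ bit (a ≡ᵇ b) → Exec (ρ [ r ↦ x ]) μ q t Q) → Exec ρ μ (op eq r r₁ r₂ ⨾ q) (suc t) Q
    eq: h = binary eq _ (m<n⇒m%n≡m (≤-<-trans (bit-≤1 (a ≡ᵇ b)) h))

  const: : a < 2 ^ w → (∀ x → value x ≡ a → Exec (ρ [ r ↦ x ]) μ q t Q) → Exec ρ μ (const r a ⨾ q) (suc t) Q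
  const: h f = step const (λ x ex → f x (trans ex (m<n⇒m%n≡m h)))

  load: : ∀ {y} → value (ρ r₁) ≡ a → nth μ a ≡ just y → Exec (ρ [ r ↦ y ]) μ q t Q → Exec ρ μ (load r r₁ ⨾ q) (suc t) Q
  load: {μ = μ} ea e (_ , _ , _ , d , ≤t , post) with i , i≡ , refl ← nth-lookup μ e =
    _ , _ , _ , seq (load i (trans i≡ (sym ea))) d , s≤s ≤t , post

  ifnz-then : value (ρ r) ≢ 0 → Exec ρ μ p t Q → Exec ρ μ (ifnz r p q) (suc t) Q
  ifnz-then nz (_ , _ , _ , d , ≤t , post) = _ , _ , _ , if-nonzero nz d , s≤s ≤t , post

  ifnz-else : value (ρ r) ≡ 0 → Exec ρ μ q t Q → Exec ρ μ (ifnz r p q) (suc t) Q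
  ifnz-else z (_ , _ , _ , d , ≤t , post) = _ , _ , _ , if-zero z d , s≤s ≤t , post

  -- `i` is a variant bounding the number of remaining rounds. It may drop by more than one, as it
  -- does in the descent, where an edge can skip many letters.
  loop : ∀ (Inv : ℕ → Regs w → Memory w → Set) →
         (∀ {i ρ μ} → Inv i ρ μ → value (ρ r) ≢ 0 → Exec ρ μ p t (λ ρ′ μ′ → ∃ λ j → j < i × Inv j ρ′ μ′)) →
         ∀ {i} → Inv i ρ μ → Exec ρ μ (while r p) (suc (i * suc t)) (λ ρ′ μ′ → (∃ λ j → Inv j ρ′ μ′) × value (ρ′ r) ≡ 0)
  loop {r} {p = p} {t} Inv body {i} inv = go i ≤-refl inv
    where
    -- `n` is fuel: the drop of the variant is not structural.
    go : ∀ n {i ρ μ} → i ≤ n → Inv i ρ μ →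
         Exec ρ μ (while r p) (suc (i * suc t)) (λ ρ′ μ′ → (∃ λ j → Inv j ρ′ μ′) × value (ρ′ r) ≡ 0)
    go n {i} {ρ} {μ} i≤n inv with value (ρ r) ≟ 0
    ... | yes z = 1 , ρ , μ , while-done z , s≤s z≤n , (i , inv) , z
    ... | no nz with body inv nz
    go zero    {zero}  i≤n inv | no nz | _ , _ , _ , d , ≤₁ , _ , () , _
    go (suc n) {suc i} i≤n inv | no nz | u₁ , _ , _ , d , ≤₁ , j , j<i , inv′
      with u₂ , _ , _ , d′ , ≤₂ , post ← go n (≤-trans (s≤s⁻¹ j<i) (s≤s⁻¹ i≤n)) inv′ =
      _ , _ , _ , while-step nz d d′ , bound , post
      where
      bound : suc (u₁ + u₂) ≤ suc (suc i * suc t)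
      bound = s≤s (≤-trans (+-mono-≤ ≤₁ ≤₂) (≤-trans (≤-reflexive (+-suc t _)) (s≤s (+-monoʳ-≤ t (*-monoˡ-≤ (suc t) (s≤s⁻¹ j<i))))))

-- The suffix tree

concatMap-cong-∈ : ∀ {f g : A → List B} xs → (∀ {x} → x ∈ xs → f x ≡ g x) → concatMap f xs ≡ concatMap g xs
concatMap-cong-∈ []       h = refl
concatMap-cong-∈ (x ∷ xs) h = cong₂ _++_ (h (here refl)) (concatMap-cong-∈ xs (h ∘ there))

concatMap-↭ : ∀ {f g : A → List B} xs → (∀ x → f x ↭ g x) → concatMap f xs ↭ concatMap g xs
concatMap-↭ []       h = ↭-refl
concatMap-↭ (x ∷ xs) h = ++⁺ (h x) (concatMap-↭ xs h)

module Grouping (_≟_ : DecidableEquality B) (f : A → B) where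

  group : List A → B → List A
  group xs g = filter (λ x → f x ≟ g) xs

  group-≡ : ∀ {x g} xs → f x ≡ g → group (x ∷ xs) g ≡ x ∷ group xs g
  group-≡ {x} {g} xs e with f x ≟ g
  ... | yes _ = refl
  ... | no ¬e = contradiction e ¬e

  group-≢ : ∀ {x g} xs → f x ≢ g → group (x ∷ xs) g ≡ group xs g
  group-≢ {x} {g} xs ¬e with f x ≟ g
  ... | yes e = contradiction e ¬e
  ... | no _  = refl

  regroup-∷ : ∀ x xs gs → Unique gs → f x ∈ gs → concatMap (group (x ∷ xs)) gs ↭ x ∷ concatMap (group xs) gs
  regroup-∷ x xs (g ∷ gs) (g∉ ∷ _) (here refl)
    rewrite group-≡ xs (refl {x = f x})
          | concatMap-cong-∈ {f = group (x ∷ xs)} {group xs} gs (λ h∈ → group-≢ xs (All.lookup g∉ h∈)) = ↭-refl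
  regroup-∷ x xs (g ∷ gs) (g∉ ∷ uniq) (there fx∈)
    rewrite group-≢ xs (λ e → All.lookup g∉ fx∈ (sym e)) =
    ↭-trans (++⁺ˡ (group xs g) (regroup-∷ x xs gs uniq fx∈)) (↭-shift x (group xs g) (concatMap (group xs) gs))

  regroup : ∀ xs gs → Unique gs → (∀ {x} → x ∈ xs → f x ∈ gs) → concatMap (group xs) gs ↭ xs
  regroup []       gs uniq h = subst (_↭ []) (sym (empty gs)) ↭-refl
    where
    empty : ∀ gs → concatMap (group []) gs ≡ []
    empty []       = refl
    empty (g ∷ gs) = empty gs
  regroup (x ∷ xs) gs uniq h =
    ↭-trans (regroup-∷ x xs gs uniq (h (here refl))) (prep x (regroup xs gs uniq (h ∘ there)))

∈-catMaybes⁺ : ∀ {x : A} {ms} → just x ∈ ms → x ∈ catMaybes ms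
∈-catMaybes⁺ {ms = just x ∷ ms}  (here refl) = here refl
∈-catMaybes⁺ {ms = just y ∷ ms}  (there x∈)  = there (∈-catMaybes⁺ x∈)
∈-catMaybes⁺ {ms = nothing ∷ ms} (there x∈)  = ∈-catMaybes⁺ x∈

∈-catMaybes⁻ : ∀ {x : A} ms → x ∈ catMaybes ms → just x ∈ ms
∈-catMaybes⁻ (just y ∷ ms)  (here refl) = here refl
∈-catMaybes⁻ (just y ∷ ms)  (there x∈)  = there (∈-catMaybes⁻ ms x∈)
∈-catMaybes⁻ (nothing ∷ ms) x∈          = there (∈-catMaybes⁻ ms x∈)

∑-map : ∀ (f : A → B) xs g → ∑ (map f xs) g ≡ ∑ xs (g ∘ f)
∑-map f []       g = refl
∑-map f (x ∷ xs) g = cong (g (f x) +_) (∑-map f xs g)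

∸-superadditive : ∀ a b d → (a ∸ d) + (b ∸ d) ≤ (a + b) ∸ d
∸-superadditive a b zero    = ≤-refl
∸-superadditive zero b (suc d) = ≤-refl
∸-superadditive (suc a) zero (suc d) = ≤-reflexive (trans (+-identityʳ (a ∸ d)) (cong (_∸ d) (sym (+-identityʳ a))))
∸-superadditive (suc a) (suc b) (suc d) =
  ≤-trans (∸-superadditive a b d) (∸-monoˡ-≤ d (+-monoʳ-≤ a (n≤1+n b)))

-- The left side loses up to `d` at every summand, the right side at most once. Applied to the sizes
-- of the children, this bounds the total number of their table rows.
∑-∸ : ∀ (xs : List A) f d → ∑ xs (λ x → f x ∸ d) ≤ ∑ xs f ∸ d
∑-∸ []       f d = z≤n
∑-∸ (x ∷ xs) f d = ≤-trans (+-monoʳ-≤ (f x ∸ d) (∑-∸ xs f d)) (∸-superadditive (f x) (∑ xs f) d)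

nth-defined : ∀ (xs : List A) {i} → i < length xs → ∃ λ x → nth xs i ≡ just x
nth-defined (x ∷ xs) {zero}  _   = x , refl
nth-defined (x ∷ xs) {suc i} i<  = nth-defined xs (s<s⁻¹ i<)

nth-undefined : ∀ (xs : List A) {i} → length xs ≤ i → nth xs i ≡ nothing
nth-undefined []       _  = refl
nth-undefined (x ∷ xs) {suc i} ≤i = nth-undefined xs (s≤s⁻¹ ≤i)

-- Nodes, their layout and their space

module Tree {w k : ℕ} (T : Text w) {V : Set} (encode : V → Vec (Word w) k) (Stat : ℕ → ℕ → V) (_⊙_ : Op₂ V)
            (1≤w : 1 ≤ w) (off : ℕ) where

  open Memory off
  open Dictionary w

  n : ℕ
  n = length T

  -- Past the end of the text, `nothing` plays the part of an end marker, so that distinct suffixes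
  -- differ even if one is a prefix of the other.
  letter : ℕ → ℕ → Maybe ℕ
  letter i l = Maybe.map value (nth T (i + l))

  _≟ᴹ_ : DecidableEquality (Maybe ℕ)
  _≟ᴹ_ = Maybe-≡-dec _≟_

  record Agree (S : List ℕ) (d : ℕ) : Set where
    constructor agreeing
    field
      agree : ∀ {i j} → i ∈ S → j ∈ S → ∀ {l} → l < d → letter i l ≡ letter j l

  open Agree public

  continuing : List ℕ → ℕ → ℕ → List ℕ
  continuing S d x = filter (λ i → letter i d ≟ᴹ just x) S

  encoding : Maybe V → List (Word w)
  encoding (just v) = toList (encode v)
  encoding nothing  = []

  answerFor : ℕ → List ℕ → List ℕ
  answerFor m S = map value (encoding (aggregate _⊙_ (map (λ i → Stat i (i + m ∸ 1)) S)))

  length-answer : ∀ m S → 1 ≤ length S → length (answerFor m S) ≡ k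
  length-answer m (i ∷ S) _ = trans (length-map value (encoding (just v))) (length-toList (encode v))
    where v = foldl _⊙_ (Stat i (i + m ∸ 1)) (map (λ i → Stat i (i + m ∸ 1)) S)

  -- e is one more than the string depth of the parent.  The aggregate is tabulated for the pattern
  -- lengths e ≤ m ≤ d with at least m occurrences; the dictionary may send a letter that does not
  -- follow any position of S to an arbitrary child.
  data Node (R : List ℕ) : (a : ℕ) (S : List ℕ) (e : ℕ) → Set where
    node : ∀ {a S e d start tab dict F} →
           At R a d → At R (a + 1) start → At R (a + 2) (length S) → At R (a + 3) e → At R (a + 4) tab → At R (a + 5) dict →
           1 ≤ length S → All (_< n) S → e ≤ d → d ≤ n → F ↭ S → Segment R start F → Agree S d →
           tab ≤ off + length R →
           (∀ m → e ≤ m → m ≤ d → m ≤ length S → Segment R (tab + (m ∸ e) * k) (answerFor m S)) →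
           (d < n → ∀ y → ∃ λ x → ∃ λ b → Lookup R dict y b × Node R b (continuing S d x) (suc d) ×
                          (∀ {i} → i ∈ S → letter i d ≡ just y → x ≡ y)) →
           Node R a S e

  node-mono : ∀ {R a S e} ν → Node R a S e → Node (R ++ ν) a S e
  node-mono {R} ν (node a₀ a₁ a₂ a₃ a₄ a₅ ne <n e≤d d≤n perm seg agr tab≤ table child) =
    node (at-mono ν a₀) (at-mono ν a₁) (at-mono ν a₂) (at-mono ν a₃) (at-mono ν a₄) (at-mono ν a₅)
      ne <n e≤d d≤n perm (segment-mono ν seg) agr (≤-trans tab≤ (+-monoʳ-≤ off (≤-trans (m≤m+n _ _) (≤-reflexive (sym (length-++ R))))))
      (λ m p q r → segment-mono ν (table m p q r))
      (λ d<n y → let x , b , look , nd , f = child d<n y in x , b , lookup-mono ν look , node-mono ν nd , f)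

  segment-uniform : ∀ {R b} (f : ℕ → List ℕ) k c → (∀ t → length (f t) ≡ k) → Segment R b (concat (applyUpTo f c)) →
                    ∀ {t} → t < c → Segment R (b + t * k) (f t)
  segment-uniform {R} {b} f k (suc c) len seg {zero}  _  = subst (λ a → Segment R a (f 0)) (sym (+-identityʳ b)) (segment-++ˡ (f 0) seg)
  segment-uniform {R} {b} f k (suc c) len seg {suc t} t< = subst (λ a → Segment R a (f (suc t)))
    (trans (cong (λ l → b + l + t * k) (len 0)) (+-assoc b k (t * k)))
    (segment-uniform (f ∘ suc) k c (len ∘ suc) (segment-++ʳ (f 0) seg) (s<s⁻¹ t<))

  length-uniform : ∀ (f : ℕ → List ℕ) k c → (∀ t → length (f t) ≡ k) → length (concat (applyUpTo f c)) ≡ c * k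
  length-uniform f k zero    len = refl
  length-uniform f k (suc c) len = trans (length-++ (f 0)) (cong₂ _+_ (len 0) (length-uniform (f ∘ suc) k c (len ∘ suc)))

  -- The table has one row of `k` words for each length from `e` to the smaller of `d` and
  -- `length S`: the lengths for which a query stops here and does not enumerate.
  placeNode : ∀ R {S e d start dict F} → 1 ≤ length S → All (_< n) S → e ≤ d → d ≤ n → F ↭ S → Segment R start F → Agree S d →
              (d < n → ∀ y → ∃ λ x → ∃ λ b → Lookup R dict y b × Node R b (continuing S d x) (suc d) ×
                             (∀ {i} → i ∈ S → letter i d ≡ just y → x ≡ y)) →
              ∃ λ ν → ∃ λ a → length ν ≡ 6 + (suc (d ⊓ length S) ∸ e) * k × Node (R ++ ν) a S e
  placeNode R {S} {e} {d} {start} {dict} ne <n e≤d d≤n perm seg agr child =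
    ν , a , cong (6 +_) (length-uniform row k rows len) ,
    node (subst (λ b → At (R ++ ν) b d) (+-identityʳ a) (cell s {0} refl)) (cell s {1} refl) (cell s {2} refl) (cell s {3} refl) (cell s {4} refl) (cell s {5} refl)
      ne <n e≤d d≤n perm (segment-mono ν seg) agr tab≤ stored
      (λ d<n y → let x , b , look , nd , f = child d<n y in x , b , lookup-mono ν look , node-mono ν nd , f)
    where
    a = off + length R
    rows = suc (d ⊓ length S) ∸ e
    row = λ t → answerFor (e + t) S
    header = d ∷ start ∷ length S ∷ e ∷ a + 6 ∷ dict ∷ []
    ν = header ++ concat (applyUpTo row rows)
    len : ∀ t → length (row t) ≡ k
    len t = length-answer (e + t) S ne
    s : Segment (R ++ ν) a ν
    s = segment-end R ν
    tab≤ : a + 6 ≤ off + length (R ++ ν)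
    tab≤ = ≤-trans (≤-reflexive (+-assoc off (length R) 6)) (+-monoʳ-≤ off
      (≤-trans (+-monoʳ-≤ (length R) (m≤m+n 6 _)) (≤-reflexive (sym (length-++ R)))))
    stored : ∀ m → e ≤ m → m ≤ d → m ≤ length S → Segment (R ++ ν) (a + 6 + (m ∸ e) * k) (answerFor m S)
    stored m e≤m m≤d m≤s = subst (λ j → Segment (R ++ ν) (a + 6 + (m ∸ e) * k) (answerFor j S)) (m+[n∸m]≡n e≤m)
      (segment-uniform row k rows len (segment-++ʳ header s) (∸-monoˡ-< (s≤s (⊓-glb m≤d m≤s)) e≤m))

  SameAt : List ℕ → ℕ → ℕ → Set
  SameAt S i₀ d = All (λ i → letter i d ≡ letter i₀ d) S

  agree-suc : ∀ {S i₀ d} → Agree S d → SameAt S i₀ d → Agree S (suc d)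
  agree-suc {S} {i₀} {d} agr same = agreeing λ i∈ j∈ l< → go i∈ j∈ (m≤n⇒m<n∨m≡n (s≤s⁻¹ l<))
    where
    go : ∀ {i j l} → i ∈ S → j ∈ S → l < d ⊎ l ≡ d → letter i l ≡ letter j l
    go i∈ j∈ (inj₁ l<d)  = agree agr i∈ j∈ l<d
    go i∈ j∈ (inj₂ refl) = trans (All.lookup same i∈) (sym (All.lookup same j∈))

  -- At offset `n ∸ j` the shorter suffix has ended while the longer one still has a letter.
  suffixes-differ : ∀ {i j} → i < j → j < n → ¬ (∀ {l} → l < n → letter i l ≡ letter j l)
  suffixes-differ {i} {j} i<j j<n same = contradiction
    (trans (sym (cong (Maybe.map value) e)) (trans (same l<n) (cong (Maybe.map value) (nth-undefined T (≤-reflexive (sym (m+[n∸m]≡n (<⇒≤ j<n)))))))) λ ()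
    where
    l<n : n ∸ j < n
    l<n = ∸-monoʳ-< {n} {j} {0} (≤-<-trans z≤n i<j) (<⇒≤ j<n)
    e = proj₂ (nth-defined T {i + (n ∸ j)} (<-≤-trans (+-monoˡ-< (n ∸ j) i<j) (≤-reflexive (m+[n∸m]≡n (<⇒≤ j<n)))))

  ¬agree-n : ∀ {S i j} → i ∈ S → j ∈ S → i ≢ j → All (_< n) S → ¬ Agree S n
  ¬agree-n {i = i} {j} i∈ j∈ i≢j <n agr with <-cmp i j
  ... | tri< i<j _ _ = suffixes-differ i<j (All.lookup <n j∈) (agree agr i∈ j∈)
  ... | tri≈ _ i≡j _ = i≢j i≡j
  ... | tri> _ _ j<i = suffixes-differ j<i (All.lookup <n i∈) (agree agr j∈ i∈)

  -- Scans for the first depth at which `S` splits. The scan stops before `n`, because otherwise all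
  -- positions would agree up to `n`; the fuel is the distance to `n`.
  branchDepth : ∀ {S i₀} fuel e → ¬ Agree S n → Agree S e → e + fuel ≡ n →
                ∃ λ d → e ≤ d × d < n × Agree S d × ¬ SameAt S i₀ d
  branchDepth {S} zero e ¬n agr e≡ = contradiction (subst (Agree S) (trans (sym (+-identityʳ e)) e≡) agr) ¬n
  branchDepth {S} {i₀} (suc fuel) e ¬n agr e≡ with All.all? (λ i → letter i e ≟ᴹ letter i₀ e) S
  ... | no ¬same = e , ≤-refl , subst (e <_) e≡ (m<m+n e z<s) , agr , ¬same
  ... | yes same with d , e<d , rest ← branchDepth {S} {i₀} fuel (suc e) ¬n (agree-suc agr same) (trans (sym (+-suc e fuel)) e≡) =
    d , <⇒≤ e<d , rest

  letters : List ℕ → ℕ → List ℕ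
  letters S d = deduplicate _≟_ (catMaybes (map (λ i → letter i d) S))

  ∈-letters⁺ : ∀ {S d i x} → i ∈ S → letter i d ≡ just x → x ∈ letters S d
  ∈-letters⁺ {S} {d} i∈ e = ∈-deduplicate⁺ _≟_ (∈-catMaybes⁺ (subst (_∈ map (λ i → letter i d) S) e (∈-map⁺ (λ i → letter i d) i∈)))

  ∈-letters⁻ : ∀ {S d x} → x ∈ letters S d → ∃ λ i → i ∈ S × letter i d ≡ just x
  ∈-letters⁻ {S} {d} x∈ =
    let i , i∈ , e = ∈-map⁻ (λ i → letter i d) (∈-catMaybes⁻ _ (∈-deduplicate⁻ _≟_ (catMaybes (map (λ i → letter i d) S)) x∈))
    in i , i∈ , sym e

  letters-< : ∀ {S d} → All (_< 2 ^ w) (letters S d)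
  letters-< {S} {d} = All.tabulate λ x∈ → let i , _ , e = ∈-letters⁻ {S} {d} x∈ in go (nth T (i + d)) e
    where
    go : ∀ (m : Maybe (Word w)) {x} → Maybe.map value m ≡ just x → x < 2 ^ w
    go (just y) refl = toℕ<n (toFin y)

  continuing-smaller : ∀ {S i₀ d} x → i₀ ∈ S → ¬ SameAt S i₀ d → length (continuing S d x) < length S
  continuing-smaller {S} {i₀} {d} x i₀∈ ¬same = filter-notAll (λ i → letter i d ≟ᴹ just x) S (¬All⇒Any¬ (λ i → letter i d ≟ᴹ just x) S
    λ all → ¬same (All.map (λ e → trans e (sym (All.lookup all i₀∈))) all))

  -- A budget of 188 words per position, plus `k` words per table row for the lengths `e` to `s`.
  -- With `C` words per position, a node spends 6 on its header and 88 per child on its dictionary,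
  -- and must hand on `C - 6`. Two children cover this if `2 * (C - 6 - 88) = C`, that is,
  -- `C = 188`.
  Cost : ℕ → ℕ → ℕ
  Cost s e = 188 * s + k * (suc s ∸ e)

  -- The parent receives the unspent `182 = 188 - 6` words. `F` is fixed before any memory is given:
  -- the positions are written once, in a single array, and each subtree is handed the address of
  -- its own stretch.
  Result : List ℕ → ℕ → Set
  Result S e = ∃ λ F → F ↭ S × (1 ≤ length S → ∀ R start → Segment R start F →
                 ∃ λ ν → ∃ λ a → length ν + 182 ≤ Cost (length S) e × Node (R ++ ν) a S e)

  -- The lengths from `e` to the smaller of `d` and `s`, tabulated at the node, and the lengths from
  -- `d + 1` to `s`, reserved for its children, are disjoint parts of the range from `e` to `s`.
  rows-bound : ∀ e d s → e ≤ d → (suc (d ⊓ s) ∸ e) + (s ∸ d) ≤ suc s ∸ e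
  rows-bound e d s e≤d with ≤-total d s
  ... | inj₁ d≤s rewrite m≤n⇒m⊓n≡m d≤s = ≤-reflexive (begin
    (suc d ∸ e) + (s ∸ d)   ≡⟨ cong (_+ (s ∸ d)) (+-∸-assoc 1 e≤d) ⟩
    suc (d ∸ e) + (s ∸ d)   ≡⟨ cong suc (+-comm (d ∸ e) (s ∸ d)) ⟩
    suc (s ∸ d + (d ∸ e))   ≡⟨ cong suc (m∸n+n∸o≡m∸o d≤s e≤d) ⟩
    suc (s ∸ e)             ≡⟨ sym (+-∸-assoc 1 (≤-trans e≤d d≤s)) ⟩
    suc s ∸ e               ∎)
    where
    open ≡-Reasoning
    m∸n+n∸o≡m∸o : ∀ {s d e} → d ≤ s → e ≤ d → s ∸ d + (d ∸ e) ≡ s ∸ e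
    m∸n+n∸o≡m∸o {s} {d} {e} d≤s e≤d = trans (sym (+-∸-assoc (s ∸ d) e≤d)) (cong (_∸ e) (m∸n+n≡m d≤s))
  ... | inj₂ s≤d rewrite m≥n⇒m⊓n≡n s≤d | m≤n⇒m∸n≡0 s≤d = ≤-reflexive (+-identityʳ (suc s ∸ e))

  build : ∀ fuel S e → length S ≤ fuel → Unique S → All (_< n) S → Agree S e → e ≤ n → Result S e
  build fuel [] e _ _ _ _ _ = [] , ↭-refl , λ ()
  -- A leaf gets depth `n` even though its suffix may be shorter. No pattern is longer than `n`, so
  -- the descent stops here and the dummy `dict = 0` is never read.
  build fuel (i ∷ []) e _ _ <n agr e≤n = i ∷ [] , ↭-refl , λ ne R start seg →
    let ν , a , len , nd = placeNode R {e = e} {d = n} {dict = 0} ne <n e≤n ≤-refl ↭-refl seg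
                             (agreeing λ { (here refl) (here refl) _ → refl }) (λ n<n → contradiction n<n (<-irrefl refl))
    in ν , a , (begin
         length ν + 182                             ≡⟨ cong (_+ 182) len ⟩
         6 + (suc (n ⊓ 1) ∸ e) * k + 182            ≤⟨ +-monoˡ-≤ 182 (+-monoʳ-≤ 6 (*-monoˡ-≤ k (∸-monoˡ-≤ e (s≤s (m⊓n≤n n 1))))) ⟩
         6 + (2 ∸ e) * k + 182                      ≡⟨ lem (2 ∸ e) k ⟩
         Cost 1 e                                   ∎) , nd
    where
    open ≤-Reasoning
    lem : ∀ a k → 6 + a * k + 182 ≡ 188 + k * a
    lem = solve-∀
  build (suc fuel) S@(i₀ ∷ i₁ ∷ _) e S≤ uniq@((i₀≢i₁ ∷ _) ∷ _) <n agr e≤n =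
    F , F↭S , place
    where
    branch = branchDepth {S} {i₀} (n ∸ e) e (¬agree-n (here refl) (there (here refl)) i₀≢i₁ <n) agr (m+[n∸m]≡n e≤n)
    d = proj₁ branch
    e≤d : e ≤ d
    e≤d = proj₁ (proj₂ branch)
    d<n : d < n
    d<n = proj₁ (proj₂ (proj₂ branch))
    agree-d : Agree S d
    agree-d = proj₁ (proj₂ (proj₂ (proj₂ branch)))
    ¬same : ¬ SameAt S i₀ d
    ¬same = proj₂ (proj₂ (proj₂ (proj₂ branch)))
    xs = letters S d
    xs-unique : Unique xs
    xs-unique = deduplicate-! _≟_ (catMaybes (map (λ i → letter i d) S))
    size : ℕ → ℕ
    size x = length (continuing S d x)
    P? : ∀ x i → Dec (letter i d ≡ just x)
    P? x i = letter i d ≟ᴹ just x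
    open Grouping _≟ᴹ_ (λ i → letter i d)
    rec : ∀ x → Result (continuing S d x) (suc d)
    rec x = build fuel (continuing S d x) (suc d) (s≤s⁻¹ (≤-trans (continuing-smaller {d = d} x (here refl) ¬same) S≤))
              (Unique-filter (P? x) uniq) (filter⁺ (P? x) <n)
              (agreeing λ {i} {j} i∈ j∈ l< → agree (agree-suc {i₀ = i}
                 (agreeing λ i∈ j∈ → agree agree-d (proj₁ (∈-filter⁻ (P? x) {xs = S} i∈)) (proj₁ (∈-filter⁻ (P? x) {xs = S} j∈)))
                 (All.tabulate λ h∈ → trans (proj₂ (∈-filter⁻ (P? x) {xs = S} h∈)) (sym (proj₂ (∈-filter⁻ (P? x) {xs = S} i∈)))))
                 i∈ j∈ l<)
              d<n
    -- A position whose suffix has ended belongs to no child, but must be listed among the positions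
    -- of this node.
    ended = group S nothing
    F = ended ++ concatMap (proj₁ ∘ rec) xs
    F↭S : F ↭ S
    F↭S = ↭-trans (++⁺ˡ ended (concatMap-↭ xs (λ x → proj₁ (proj₂ (rec x)))))
      (subst (λ L → ended ++ L ↭ S) (concatMap-map (group S) just xs)
        (regroup S (nothing ∷ map just xs) (All.tabulate absent ∷ Unique-map⁺ just-injective xs-unique) covered))
      where
      absent : ∀ {m} → m ∈ map just xs → nothing ≢ m
      absent m∈ refl with ∈-map⁻ just m∈
      ... | _ , _ , ()
      covered : ∀ {i} → i ∈ S → letter i d ∈ nothing ∷ map just xs
      covered {i} i∈ with letter i d in e≡
      ... | nothing = here refl
      ... | just x  = there (∈-map⁺ just (∈-letters⁺ i∈ e≡))
    nonempty : ∀ {x} → x ∈ xs → 1 ≤ size x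
    nonempty {x} x∈ = let i , i∈ , e≡ = ∈-letters⁻ {S} {d} x∈ in ∈⇒1≤length (∈-filter⁺ (P? x) i∈ e≡)
      where
      ∈⇒1≤length : ∀ {x : ℕ} {xs} → x ∈ xs → 1 ≤ length xs
      ∈⇒1≤length (here _)  = s≤s z≤n
      ∈⇒1≤length (there _) = s≤s z≤n
    ∑size : ∑ xs size ≤ length S
    ∑size = ≤-trans (≤-reflexive (sym (∑-map just xs (length ∘ group S))))
              (group-sum _≟ᴹ_ (λ i → letter i d) (map just xs) (Unique-map⁺ just-injective xs-unique) S)

    some-letter : ∃ λ x → x ∈ xs
    some-letter = go xs refl
      where
      go : ∀ ys → xs ≡ ys → ∃ λ x → x ∈ ys
      go (x ∷ _) _  = x , here refl
      go []      e≡ = contradiction (All.tabulate λ i∈ → trans (none i∈) (sym (none (here refl)))) ¬same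
        where
        none : ∀ {i} → i ∈ S → letter i d ≡ nothing
        none {i} i∈ with letter i d in e
        ... | nothing = refl
        ... | just x with () ← subst (x ∈_) e≡ (∈-letters⁺ i∈ e)

    -- Either at least two children, or a single child that misses the suffix ending at depth d.
    branching : 94 * 2 + 188 * ∑ xs size ≤ 94 * length xs + 188 * length S
    branching = go xs refl ∑size
      where
      go : ∀ ys → xs ≡ ys → ∑ ys size ≤ length S → 94 * 2 + 188 * ∑ ys size ≤ 94 * length ys + 188 * length S
      go [] e≡ _ with () ← subst (proj₁ some-letter ∈_) e≡ (proj₂ some-letter)
      go (x ∷ []) e≡ _ = begin
        188 + 188 * (size x + 0)    ≡⟨ lem (size x) ⟩
        188 * suc (size x)          ≤⟨ *-monoʳ-≤ 188 (continuing-smaller {d = d} x (here refl) ¬same) ⟩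
        188 * length S              ≤⟨ m≤n+m _ 94 ⟩
        94 + 188 * length S         ∎
        where
        open ≤-Reasoning
        lem : ∀ a → 188 + 188 * (a + 0) ≡ 188 * (1 + a)
        lem = solve-∀
      go (x ∷ y ∷ ys) e≡ ≤s = +-mono-≤ (*-monoʳ-≤ 94 (s≤s (s≤s z≤n))) (*-monoʳ-≤ 188 ≤s)

    cost : ℕ → ℕ
    cost x = Cost (size x) (suc d) ∸ 182

    ∑cost : ∑ xs cost + 182 * length xs ≤ 188 * ∑ xs size + k * (length S ∸ d)
    ∑cost = begin
      ∑ xs cost + 182 * length xs                                       ≡⟨ cong (∑ xs cost +_) (trans (*-comm 182 (length xs)) (sym (∑-const xs 182))) ⟩
      ∑ xs cost + ∑ xs (λ _ → 182)                                      ≡⟨ sym (∑-+ xs _ _) ⟩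
      ∑ xs (λ x → cost x + 182)                                         ≤⟨ ∑-mono xs (λ x x∈ → ≤-reflexive (m∸n+n≡m
                                                                             (≤-trans (≤-trans (m≤m+n 182 6) (*-monoʳ-≤ 188 (nonempty x∈))) (m≤m+n _ _)))) ⟩
      ∑ xs (λ x → 188 * size x + k * (size x ∸ d))                      ≡⟨ ∑-+ xs _ _ ⟩
      ∑ xs (λ x → 188 * size x) + ∑ xs (λ x → k * (size x ∸ d))         ≡⟨ cong₂ _+_ (∑-*ˡ xs _ 188) (∑-*ˡ xs _ k) ⟩
      188 * ∑ xs size + k * ∑ xs (λ x → size x ∸ d)                     ≤⟨ +-monoʳ-≤ (188 * ∑ xs size) (*-monoʳ-≤ k
                                                                             (≤-trans (∑-∸ xs size d) (∸-monoˡ-≤ d ∑size))) ⟩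
      188 * ∑ xs size + k * (length S ∸ d)                              ∎
      where open ≤-Reasoning

    place : 1 ≤ length S → ∀ R start → Segment R start F →
            ∃ λ ν → ∃ λ a → length ν + 182 ≤ Cost (length S) e × Node (R ++ ν) a S e
    place ne R start seg = ν₁ ++ ν₂ ++ ν₃ , proj₁ (proj₂ nd) , total
      , subst (λ R′ → Node R′ (proj₁ (proj₂ nd)) S e) (trans (++-assoc (R ++ ν₁) ν₂ ν₃) (++-assoc R ν₁ (ν₂ ++ ν₃))) (proj₂ (proj₂ (proj₂ nd)))
      where
      Child : List ℕ → ℕ → ℕ → Set
      Child R x a = Node R a (continuing S d x) (suc d)
      al = allocate (λ R → Segment R start F) Child (λ ν → segment-mono ν) (λ ν → node-mono ν) cost xs
             (λ {x} x∈ R seg → let s , seg′ = segment-concatMap (proj₁ ∘ rec) x∈ (segment-++ʳ ended seg)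
                                   ν , a , ≤c , nd = proj₂ (proj₂ (rec x)) (nonempty x∈) R s seg′
                               in ν , a , m+n≤o⇒m≤o∸n (length ν) ≤c , nd) R seg
      ν₁ = proj₁ al
      p = proj₁ (proj₂ al)
      ≤₁ = proj₁ (proj₂ (proj₂ al))
      placed : ∀ {x} → x ∈ xs → Child (R ++ ν₁) x (p x)
      placed = proj₂ (proj₂ (proj₂ al))
      dc = dictionary 1≤w xs p (letters-< {S} {d}) xs-unique (proj₂ some-letter) (R ++ ν₁)
      ν₂ = proj₁ dc
      ≤₂ = proj₁ (proj₂ (proj₂ dc))
      nd = placeNode ((R ++ ν₁) ++ ν₂) {e = e} {dict = proj₁ (proj₂ dc)} ne <n e≤d (<⇒≤ d<n) F↭S (segment-mono ν₂ (segment-mono ν₁ seg)) agree-d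
             (λ _ y → let x , x∈ , l , f = proj₂ (proj₂ (proj₂ dc)) y in
                      x , p x , l , node-mono ν₂ (placed x∈) , λ i∈ e≡ → f (∈-letters⁺ i∈ e≡))
      ν₃ = proj₁ nd
      len₃ = proj₁ (proj₂ (proj₂ nd))
      total : length (ν₁ ++ ν₂ ++ ν₃) + 182 ≤ Cost (length S) e
      -- `94 = 182 - 88` is what a child leaves after paying for its share of the dictionary. It is
      -- added on both sides to avoid subtraction.
      total = +-cancelʳ-≤ (94 * length xs) _ _ (begin
        length (ν₁ ++ ν₂ ++ ν₃) + 182 + 94 * r
          ≡⟨ cong (λ l → l + 182 + 94 * r) (trans (length-++ ν₁) (cong (length ν₁ +_) (length-++ ν₂))) ⟩
        length ν₁ + (length ν₂ + length ν₃) + 182 + 94 * r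
          ≤⟨ +-monoˡ-≤ (94 * r) (+-monoˡ-≤ 182 (+-mono-≤ ≤₁ (+-mono-≤ ≤₂ (≤-reflexive len₃)))) ⟩
        ∑ xs cost + (88 * r + (6 + rows * k)) + 182 + 94 * r
          ≡⟨ lem₁ (∑ xs cost) r rows k ⟩
        (∑ xs cost + 182 * r) + (188 + rows * k)
          ≤⟨ +-monoˡ-≤ (188 + rows * k) ∑cost ⟩
        188 * ∑ xs size + k * (length S ∸ d) + (188 + rows * k)
          ≡⟨ lem₂ (∑ xs size) k (length S ∸ d) rows ⟩
        (188 + 188 * ∑ xs size) + k * (rows + (length S ∸ d))
          ≤⟨ +-mono-≤ branching (*-monoʳ-≤ k (rows-bound e d (length S) e≤d)) ⟩
        94 * r + 188 * length S + k * (suc (length S) ∸ e)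
          ≡⟨ trans (+-assoc (94 * r) _ _) (+-comm (94 * r) _) ⟩
        Cost (length S) e + 94 * r ∎)
        where
        open ≤-Reasoning
        r = length xs
        rows = suc (d ⊓ length S) ∸ e
        lem₁ : ∀ c r a k → c + (88 * r + (6 + a * k)) + 182 + 94 * r ≡ (c + 182 * r) + (188 + a * k)
        lem₁ = solve-∀
        lem₂ : ∀ s k b a → 188 * s + k * b + (188 + a * k) ≡ (188 + 188 * s) + k * (a + b)
        lem₂ = solve-∀

-- Strings and aggregates

-- For the descent: going to a child filters by `Q?`, and the occurrences, selected by `P?`, must
-- survive unchanged.
filter-refine : ∀ {P Q : A → Set} (P? : ∀ x → Dec (P x)) (Q? : ∀ x → Dec (Q x)) xs →
                (∀ {x} → x ∈ xs → P x → Q x) → filter P? (filter Q? xs) ≡ filter P? xs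
filter-refine P? Q? []       h = refl
filter-refine {P = P} {Q} P? Q? (x ∷ xs) h = go (P? x) (Q? x)
  where
  ih = filter-refine P? Q? xs (h ∘ there)
  go : Dec (P x) → Dec (Q x) → filter P? (filter Q? (x ∷ xs)) ≡ filter P? (x ∷ xs)
  go (yes p) (no ¬q) = contradiction (h (here refl) p) ¬q
  go (yes p) (yes q) = trans (cong (filter P?) (filter-accept Q? q))
    (trans (filter-accept P? p) (trans (cong (x ∷_) ih) (sym (filter-accept P? p))))
  go (no ¬p) (yes q) = trans (cong (filter P?) (filter-accept Q? q))
    (trans (filter-reject P? ¬p) (trans ih (sym (filter-reject P? ¬p))))
  go (no ¬p) (no ¬q) = trans (cong (filter P?) (filter-reject Q? ¬q)) (trans ih (sym (filter-reject P? ¬p)))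

nth-drop : ∀ i (xs : List A) l → nth (drop i xs) l ≡ nth xs (i + l)
nth-drop zero    xs       l = refl
nth-drop (suc i) []       l = refl
nth-drop (suc i) (x ∷ xs) l = nth-drop i xs l

nth-take : ∀ m (xs : List A) {l} → l < m → nth (take m xs) l ≡ nth xs l
nth-take (suc m) []       l<m = refl
nth-take (suc m) (x ∷ xs) {zero}  l<m = refl
nth-take (suc m) (x ∷ xs) {suc l} l<m = nth-take m xs (s<s⁻¹ l<m)

take-≡ : ∀ (xs ys : List A) → (∀ {l} → l < length ys → nth xs l ≡ nth ys l) → take (length ys) xs ≡ ys
take-≡ xs       []       h = refl
take-≡ []       (y ∷ ys) h with () ← h {0} z<s
take-≡ (x ∷ xs) (y ∷ ys) h with refl ← h {0} z<s = cong (x ∷_) (take-≡ xs ys (h ∘ s<s))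

substring-nth : ∀ {w} (T P : List (Word w)) {i} → substring T i (length P) ≡ P →
                ∀ {l} → l < length P → nth T (i + l) ≡ nth P l
substring-nth T P {i} e {l} l< =
  trans (sym (nth-drop i T l)) (trans (sym (nth-take (length P) (drop i T) l<)) (cong (λ L → nth L l) e))

nth-substring : ∀ {w} (T P : List (Word w)) {i} → (∀ {l} → l < length P → nth T (i + l) ≡ nth P l) →
                substring T i (length P) ≡ P
nth-substring T P {i} h = take-≡ (drop i T) P (λ {l} l< → trans (nth-drop i T l) (h l<))

map-value-injective : ∀ {w} {m m′ : Maybe (Word w)} → Maybe.map value m ≡ Maybe.map value m′ → m ≡ m′
map-value-injective {m = just x}  {just y}  e = cong just (Execution.value-injective _ (just-injective e))
map-value-injective {m = nothing} {nothing} e = refl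

module _ {V : Set} {_⊙_ : Op₂ V} (sg : IsCommutativeSemigroup _≡_ _⊙_) where

  open IsCommutativeSemigroup sg using (assoc; comm)

  private
    foldl-swap : ∀ a x y vs → foldl _⊙_ ((a ⊙ x) ⊙ y) vs ≡ foldl _⊙_ ((a ⊙ y) ⊙ x) vs
    foldl-swap a x y vs = cong (λ z → foldl _⊙_ z vs)
      (trans (assoc a x y) (trans (cong (a ⊙_) (comm x y)) (sym (assoc a y x))))

  foldl-↭ : ∀ {us vs} → us ↭ vs → ∀ a → foldl _⊙_ a us ≡ foldl _⊙_ a vs
  foldl-↭ ↭.refl                    a = refl
  foldl-↭ (↭.prep x p)              a = foldl-↭ p (a ⊙ x)
  foldl-↭ (↭.swap {xs = us} x y p)  a = trans (foldl-swap a x y us) (foldl-↭ p ((a ⊙ y) ⊙ x))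
  foldl-↭ (↭.trans p q)             a = trans (foldl-↭ p a) (foldl-↭ q a)

  -- Reconciles the order of `Occ` with the depth-first order in which the positions are stored and
  -- enumerated.
  aggregate-↭ : ∀ {us vs} → us ↭ vs → aggregate _⊙_ us ≡ aggregate _⊙_ vs
  aggregate-↭ ↭.refl        = refl
  aggregate-↭ (↭.prep x p)  = cong just (foldl-↭ p x)
  aggregate-↭ (↭.swap {xs = us} x y p) = cong just (trans (cong (λ z → foldl _⊙_ z us) (comm x y)) (foldl-↭ p (y ⊙ x)))
  aggregate-↭ (↭.trans p q) = trans (aggregate-↭ p) (aggregate-↭ q)

holds⇒nth : ∀ {w} {ρ : Regs w} {xs} → ρ Holds xs → ∀ {i x} → nth xs i ≡ just x → ρ i ≡ x
holds⇒nth {xs = xs} h e with i , refl , refl ← nth-lookup xs e = h i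

nth⇒holds : ∀ {w} {ρ : Regs w} {xs} → (∀ {i x} → nth xs i ≡ just x → ρ i ≡ x) → ρ Holds xs
nth⇒holds {xs = xs} h i = h (lookup-nth xs i)

holds-++ : ∀ {w} {ρ : Regs w} xs {ys} → (∀ {i x} → nth xs i ≡ just x → ρ i ≡ x) →
           (∀ {i x} → nth ys i ≡ just x → ρ (length xs + i) ≡ x) → ρ Holds (xs ++ ys)
holds-++ {ρ = ρ} xs {ys} h h′ = nth⇒holds {xs = xs ++ ys} λ {i} e → go i e (<-≤-connex i (length xs))
  where
  nth-++-< : ∀ (zs : List _) {i} → i < length zs → nth (zs ++ ys) i ≡ nth zs i
  nth-++-< (z ∷ zs) {zero}  _  = refl
  nth-++-< (z ∷ zs) {suc i} i< = nth-++-< zs (s<s⁻¹ i<)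
  go : ∀ i {x} → nth (xs ++ ys) i ≡ just x → i < length xs ⊎ length xs ≤ i → ρ i ≡ x
  go i e (inj₁ i<) = h (trans (sym (nth-++-< xs i<)) e)
  go i e (inj₂ ≤i) = subst (λ j → ρ j ≡ _) (m+[n∸m]≡n ≤i)
    (h′ (trans (sym (nth-++ʳ xs (i ∸ length xs))) (trans (cong (nth (xs ++ ys)) (m+[n∸m]≡n ≤i)) e)))

-- The query program

-- Registers: 0 end of the data structure (address of P), 1 |P|, 2 the constant 1, 4 address of T, 5 |T|,
-- 6 current node, 7 splitting factor for letters, 8 string depth, 9 loop condition, 15 first position of
-- the node, 16 number of its positions, 17 current position, 18 loop counter, 19 result of the comparison
-- with T.  Aggregates are accumulated in registers 40, …, 39 + k, where the shifted combineProgram leaves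
-- its result; statProgram is shifted to put its result behind them, as the second operand.

setup : Program
setup =
  const 2 1 ⨾ const 3 4 ⨾ op sub 3 0 3 ⨾ load 4 3 ⨾
  op add 3 3 2 ⨾ load 5 3 ⨾ op add 3 3 2 ⨾ load 6 3 ⨾ op add 3 3 2 ⨾ load 7 3 ⨾
  load 8 6 ⨾ op lt 9 8 1 ⨾ skip

probing : Program → Program
probing p =
  load 12 10 ⨾ op mul 12 12 11 ⨾ op add 10 10 2 ⨾ load 13 10 ⨾ op shr 12 12 13 ⨾
  op add 10 10 2 ⨾ op add 10 10 12 ⨾ load 10 10 ⨾ p

descend : Program
descend =
  op add 3 0 8 ⨾ load 14 3 ⨾ const 3 5 ⨾ op add 3 6 3 ⨾ load 10 3 ⨾
  op div 11 14 7 ⨾ probing (probing (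
  op mod 11 14 7 ⨾ probing (probing (
  -- There is no move instruction; adding zero copies register 10 to register 6.
  const 3 0 ⨾ op add 6 10 3 ⨾ load 8 6 ⨾ op lt 9 8 1 ⨾ skip))))

represent : Program
represent =
  op add 3 6 2 ⨾ load 15 3 ⨾ op add 3 3 2 ⨾ load 16 3 ⨾ load 17 15 ⨾
  -- Register 19 starts as the test `i₀ + m < n + 1`: a suffix shorter than `P` is refuted without
  -- reading past the text. The product in register 9 is a conjunction.
  op add 3 17 1 ⨾ op add 13 5 2 ⨾ op lt 19 3 13 ⨾
  const 18 0 ⨾ op lt 9 18 1 ⨾ op mul 9 9 19 ⨾ skip

verify : Program
verify =
  op add 3 4 17 ⨾ op add 3 3 18 ⨾ load 12 3 ⨾ op add 3 0 18 ⨾ load 13 3 ⨾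
  op eq 19 12 13 ⨾ op add 18 18 2 ⨾ op lt 9 18 1 ⨾ op mul 9 9 19 ⨾ skip

-- Register `suc i` is its own scratch space and register 0 keeps the base address to the end, so
-- the low registers may be overwritten for any `k`.
fetch : ℕ → Program
fetch zero    = const 0 1 ⨾ skip
fetch (suc i) = const (suc i) i ⨾ op add (suc i) 0 (suc i) ⨾ load (suc i) (suc i) ⨾ fetch i

-- For large `k` the target registers overlap the sources. Ascending order is safe: a source that
-- gets overwritten has been read 39 rounds earlier.
copyOut : ℕ → ℕ → Program
copyOut i zero    = const 0 1 ⨾ skip
copyOut i (suc c) = op add (suc i) (40 + i) 0 ⨾ copyOut (suc i) c

module Code (k : ℕ) (statProgram combineProgram : Program) where

  tabulated : Program
  tabulated =
    const 12 3 ⨾ op add 3 6 12 ⨾ load 13 3 ⨾ op add 3 3 2 ⨾ load 12 3 ⨾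
    op sub 13 1 13 ⨾ const 10 k ⨾ op mul 13 13 10 ⨾ op add 0 12 13 ⨾ fetch k

  statAt : ℕ → Program
  statAt b =
    (op add 12 17 1 ⨾ op sub 12 12 2 ⨾ const 3 0 ⨾
     op add (b + 0) 4 3 ⨾ op add (b + 1) 17 3 ⨾ op add (b + 2) 12 3 ⨾ op add (b + 3) 5 3 ⨾ skip) ⨾
    shift b statProgram

  accumulate : Program
  accumulate =
    (op add 3 15 18 ⨾ load 17 3 ⨾ skip) ⨾
    statAt (40 + k) ⨾
    shift 40 combineProgram ⨾
    (op add 18 18 2 ⨾ op lt 9 18 16 ⨾ skip)

  enumerate : Program
  enumerate =
    -- `_⊙_` need not have a neutral element, so the statistic of the first position initialises the
    -- accumulator and the counter starts at 1.
    statAt 40 ⨾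
    (const 18 1 ⨾ op lt 9 18 16 ⨾ skip) ⨾
    while 9 accumulate ⨾
    (const 0 0 ⨾ copyOut 0 k)

  query : Program
  query =
    setup ⨾ while 9 descend ⨾ represent ⨾ while 9 verify ⨾
    ifnz 19 (op lt 9 16 1 ⨾ ifnz 9 enumerate tabulated) (const 0 0 ⨾ skip)

n<2^n : ∀ n → n < 2 ^ n
n<2^n zero    = z<s
n<2^n (suc n) = ≤-trans (s≤s (n<2^n n)) (≤-trans (≤-reflexive (+-comm 1 (2 ^ n))) (+-monoʳ-≤ (2 ^ n) (≤-trans (m^n>0 2 n) (m≤m+n _ 0))))

-- Correctness and running time of the query program

record Setting (w k t : ℕ) (statProgram combineProgram : Program) : Set₁ where
  field
    {s}           : ℕ
    T P           : Text w
    {V}           : Set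
    encode        : V → Vec (Word w) k
    Stat          : ℕ → ℕ → V
    _⊙_           : Op₂ V
    semigroup     : IsCommutativeSemigroup _≡_ _⊙_
    statStructure : DataStructure statProgram s (statQuery T encode Stat) (λ _ → t)
    combines      : Combines combineProgram encode _⊙_ t
    1≤w           : 1 ≤ w
    L₀            : ℕ
    R R₀          : List ℕ
    root          : ℕ

  n : ℕ
  n = length T

  m : ℕ
  m = length P

  off : ℕ
  off = L₀ + n

  top : ℕ
  top = off + length R

  open Memory off
  open Tree T encode Stat _⊙_ 1≤w off hiding (n)

  field
    -- The header stands at the end of the structure because this end is the one address that a
    -- query receives.
    R≡       : R ≡ R₀ ++ L₀ ∷ n ∷ root ∷ 2 ^ ⌊ w /2⌋ ∷ []
    rootNode : Node R root (upTo n) 0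
    room     : top + (n + n + n * k + k + 100) ≤ 2 ^ w
    1≤m      : 1 ≤ m
    m≤n      : m ≤ n

module Correctness {w k t : ℕ} {statProgram combineProgram : Program} (setting : Setting w k t statProgram combineProgram) where

  open Setting setting
  open Memory off
  open Tree T encode Stat _⊙_ 1≤w off hiding (n)
  open Code k statProgram combineProgram
  open Dictionary w
  open Execution w
  module S = DataStructure statStructure

  -- The invariant under calls of `statProgram`: the first block may change as long as it stays
  -- valid and keeps its length.
  Mem : Memory w → Set
  Mem μ = ∃ λ D → S.Valid D × length D ≡ L₀ × μ ≡ (D ++ T) ++ (map word R ++ P)

  fits : ∀ {a} → a ≤ top + (n + n + n * k + k + 99) → a < 2 ^ w
  fits h = ≤-trans (s≤s h) (≤-trans (≤-reflexive (lem top (n + n + n * k + k))) room)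
    where
    lem : ∀ a b → 1 + (a + (b + 99)) ≡ a + (b + 100)
    lem = solve-∀

  top+small : ∀ c → c ≤ 99 → top + c < 2 ^ w
  top+small c c≤ = fits (+-monoʳ-≤ top (≤-trans c≤ (m≤n+m 99 (n + n + n * k + k))))

  top-fits : top < 2 ^ w
  top-fits = fits (m≤m+n top _)

  small : ∀ c → c ≤ 99 → c < 2 ^ w
  small c c≤ = ≤-<-trans (m≤n+m c top) (top+small c c≤)

  2n+99 : ∀ {a} → a ≤ n + n + 99 → a < 2 ^ w
  2n+99 h = fits (≤-trans h (≤-trans (+-monoˡ-≤ 99 (≤-trans (m≤m+n (n + n) (n * k)) (m≤m+n _ k))) (m≤n+m _ top)))

  n-fits : ∀ {a} → a ≤ n → a < 2 ^ w
  n-fits h = 2n+99 (≤-trans h (≤-trans (m≤m+n n n) (m≤m+n _ 99)))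

  1<2^w : 1 < 2 ^ w
  1<2^w = small 1 (s≤s z≤n)

  at-< : ∀ {a v} → At R a v → a < top
  at-< (at i refl e) = +-monoʳ-< off (nth-< R e)

  nth-map : ∀ {A B : Set} (f : A → B) xs {i x} → nth xs i ≡ just x → nth (map f xs) i ≡ just (f x)
  nth-map f (x ∷ xs) {zero}  refl = refl
  nth-map f (x ∷ xs) {suc i} e    = nth-map f xs e

  module Read {μ : Memory w} (mem : Mem μ) where

    private
      D = proj₁ mem
      lenD : length D ≡ L₀
      lenD = proj₁ (proj₂ (proj₂ mem))

      rest : ∀ i → nth μ (off + i) ≡ nth (map word R ++ P) i
      rest i = trans (cong₂ nth (proj₂ (proj₂ (proj₂ mem)))
        (cong (_+ i) (trans (cong (_+ n) (sym lenD)) (sym (length-++ D))))) (nth-++ʳ (D ++ T) i)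

    text : ∀ {i x} → nth T i ≡ just x → nth μ (L₀ + i) ≡ just x
    text {i} e = trans (cong₂ nth (proj₂ (proj₂ (proj₂ mem))) (cong (_+ i) (sym lenD)))
      (nth-++ˡ (D ++ T) (trans (nth-++ʳ D i) e))

    pattern′ : ∀ {j x} → nth P j ≡ just x → nth μ (top + j) ≡ just x
    pattern′ {j} e = trans (cong (nth μ) (+-assoc off (length R) j)) (trans (rest (length R + j))
      (trans (cong (nth (map word R ++ P)) (cong (_+ j) (sym (length-map word R)))) (trans (nth-++ʳ (map word R) j) e)))

    static : ∀ {a v} → At R a v → nth μ a ≡ just (word v)
    static (at i refl e) = trans (rest i) (nth-++ˡ (map word R) (nth-map word R e))

  private variable
    ρ σ : Regs w
    μ : Memory w
    p : Program
    Q : Regs w → Memory w → Set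
    c : ℕ

  loadR: : ∀ {r r₁ a v} → Mem μ → value (ρ r₁) ≡ a → At R a v → v < 2 ^ w →
           (∀ x → value x ≡ v → Exec (ρ [ r ↦ x ]) μ p c Q) → Exec ρ μ (load r r₁ ⨾ p) (suc c) Q
  loadR: mem ea cell v< f = load: ea (Read.static mem cell) (f (word _) (value-word-< v<))

  probe: : ∀ {b y q} → Mem μ → Probe R b y q → q < 2 ^ w → value (ρ 2) ≡ 1 → value (ρ 10) ≡ b → value (ρ 11) ≡ y →
           (∀ x₁ x₂ x₃ x₄ x₅ x₆ x₇ x₈ → value x₈ ≡ q →
             Exec (ρ [ 12 ↦ x₁ ] [ 12 ↦ x₂ ] [ 10 ↦ x₃ ] [ 13 ↦ x₄ ] [ 12 ↦ x₅ ] [ 10 ↦ x₆ ] [ 10 ↦ x₇ ] [ 10 ↦ x₈ ]) μ p c Q) →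
           Exec ρ μ (probing p) (8 + c) Q
  probe: mem (probe {j} {l} c₁ c₂ c₃ j< l≤) q< one eb ey f =
    loadR: mem eb c₁ j< λ x₁ e₁ →
    mul: e₁ ey λ x₂ e₂ →
    add: eb one (<-trans (at-< c₂) top-fits) λ x₃ e₃ →
    loadR: mem e₃ c₂ (≤-<-trans l≤ (n<2^n w)) λ x₄ e₄ →
    shr: e₂ e₄ λ x₅ e₅ →
    add: e₃ one (≤-<-trans (m≤m+n _ _) (<-trans (at-< c₃) top-fits)) λ x₆ e₆ →
    add: e₆ e₅ (<-trans (at-< c₃) top-fits) λ x₇ e₇ →
    loadR: mem e₇ c₃ q< λ x₈ e₈ →
    f x₁ x₂ x₃ x₄ x₅ x₆ x₇ x₈ e₈

  Base : Regs w → Set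
  Base ρ = value (ρ 0) ≡ top × value (ρ 1) ≡ m × value (ρ 2) ≡ 1 × value (ρ 4) ≡ L₀ × value (ρ 5) ≡ n

  matches? : ∀ i → Dec (substring T i m ≡ P)
  matches? i = ≡-dec _≟ʷ_ (substring T i m) P

  depth : ∀ {a S e} → Node R a S e → ℕ
  depth (node {d = d} _ _ _ _ _ _ _ _ _ _ _ _ _ _ _ _) = d

  depth-≥ : ∀ {a S e} (nd : Node R a S e) → e ≤ depth nd
  depth-≥ (node _ _ _ _ _ _ _ _ e≤d _ _ _ _ _ _ _) = e≤d

  depth-at : ∀ {a S e} (nd : Node R a S e) → At R a (depth nd)
  depth-at (node a₀ _ _ _ _ _ _ _ _ _ _ _ _ _ _ _) = a₀

  depth-≤n : ∀ {a S e} (nd : Node R a S e) → depth nd ≤ n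
  depth-≤n (node _ _ _ _ _ _ _ _ _ d≤n _ _ _ _ _ _) = d≤n

  -- Nothing is claimed about `P` and the path label, since skipped letters are not compared. The
  -- invariant `occurrences` says that restricting the candidates to `positions` has lost no
  -- occurrence.
  record Located (i : ℕ) (ρ : Regs w) : Set where
    constructor located
    field
      {address parent} : ℕ
      {positions}      : List ℕ
      here-node        : Node R address positions parent
      parent≤m         : parent ≤ m
      r₆               : value (ρ 6) ≡ address
      r₈               : value (ρ 8) ≡ depth here-node
      r₉               : value (ρ 9) ≡ bit (depth here-node <ᵇ m)
      occurrences      : Occ T P ≡ filter matches? positions
      measure          : i ≡ m ∸ depth here-node

  Descending : Memory w → ℕ → Regs w → Memory w → Set
  Descending μ i ρ μ′ = μ′ ≡ μ × Base ρ × value (ρ 7) ≡ 2 ^ half × Located i ρ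

  setup-exec : Mem μ → value (ρ 0) ≡ top → value (ρ 1) ≡ m → Exec ρ μ setup 13 (λ ρ′ μ′ → ∃ λ i → i ≤ m × Descending μ i ρ′ μ′)
  setup-exec mem v₀ v₁ =
    const: 1<2^w λ x₁ e₁ →
    const: (small 4 (≤ᵇ⇒≤ 4 99 tt)) λ x₂ e₂ →
    sub: v₀ e₂ 4≤top λ x₃ e₃ →
    loadR: mem (trans e₃ header) (hdr 0 refl) (≤-<-trans (≤-trans (m≤m+n L₀ n) (m≤m+n off (length R))) top-fits) λ x₄ e₄ →
    add: (trans e₃ header) e₁ (<-trans (at-< (hdr+ 1 refl)) top-fits) λ x₅ e₅ →
    loadR: mem e₅ (hdr+ 1 refl) (n-fits ≤-refl) λ x₆ e₆ →
    add: e₅ e₁ (<-trans (at-< (hdr+1 1 refl)) top-fits) λ x₇ e₇ →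
    loadR: mem e₇ (hdr+1 1 refl) (<-trans (at-< (depth-at rootNode)) top-fits) λ x₈ e₈ →
    add: e₇ e₁ (<-trans (at-< (hdr+1+1 1 refl)) top-fits) λ x₉ e₉ →
    loadR: mem e₉ (hdr+1+1 1 refl) (^-monoʳ-< 2 ≤-refl (half< 1≤w)) λ x₁₀ e₁₀ →
    loadR: mem e₈ (depth-at rootNode) (n-fits (depth-≤n rootNode)) λ x₁₁ e₁₁ →
    lt: e₁₁ v₁ 1<2^w λ x₁₂ e₁₂ →
    done (m ∸ depth rootNode , m∸n≤m m (depth rootNode) , refl , (v₀ , v₁ , e₁ , e₄ , e₆) , e₁₀ ,
          located rootNode z≤n e₈ e₁₁ e₁₂ refl refl)
    where
    words = L₀ ∷ n ∷ root ∷ 2 ^ half ∷ []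
    base = off + length R₀
    top≡ : top ≡ base + 4
    top≡ = trans (cong (λ r → off + length r) R≡) (trans (cong (off +_) (length-++ R₀)) (sym (+-assoc off (length R₀) 4)))
    4≤top : 4 ≤ top
    4≤top = subst (4 ≤_) (sym top≡) (m≤n+m 4 base)
    header : top ∸ 4 ≡ base + 0
    header = trans (cong (_∸ 4) top≡) (trans (m+n∸n≡m base 4) (sym (+-identityʳ base)))
    hdr : ∀ j {v} → nth words j ≡ just v → At R (base + j) v
    hdr j {v} e = subst (λ R → At R (base + j) v) (sym R≡) (cell (segment-end R₀ words) e)
    hdr+ : ∀ j {v} → nth words j ≡ just v → At R (base + 0 + j) v
    hdr+ j {v} e = subst (λ b → At R b v) (cong (_+ j) (sym (+-identityʳ base))) (hdr j e)
    hdr+1 : ∀ j {v} → nth words (1 + j) ≡ just v → At R (base + 0 + 1 + j) v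
    hdr+1 j {v} e = subst (λ b → At R b v) (lem base j) (hdr (1 + j) e)
      where
      lem : ∀ b j → b + (1 + j) ≡ b + 0 + 1 + j
      lem = solve-∀
    hdr+1+1 : ∀ j {v} → nth words (2 + j) ≡ just v → At R (base + 0 + 1 + 1 + j) v
    hdr+1+1 j {v} e = subst (λ b → At R b v) (lem base j) (hdr (2 + j) e)
      where
      lem : ∀ b j → b + (2 + j) ≡ b + 0 + 1 + 1 + j
      lem = solve-∀
    half< : ∀ {v} → 1 ≤ v → ⌊ v /2⌋ < v
    half< {suc v} _ = ⌊n/2⌋<n v

  descend-exec : ∀ {i} → Mem μ → Descending μ i ρ μ → value (ρ 9) ≢ 0 →
                 Exec ρ μ descend 44 (λ ρ′ μ′ → ∃ λ j → j < i × Descending μ j ρ′ μ′)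
  descend-exec {μ} {ρ} {i} mem (_ , (v₀ , v₁ , v₂ , v₄ , v₅) , v₇ ,
      located {a} {e} {S} (node {d = d} {dict = dict} a₀ a₁ a₂ a₃ a₄ a₅ ne <n e≤d d≤n perm seg agr tab≤ table child) e≤m v₆ v₈ v₉ occ i≡) nz =
    go (nth-defined P d<m)
    where
    d<m : d < m
    d<m = bit-<-≢0 d m (λ z → nz (trans v₉ z))
    go : (∃ λ y → nth P d ≡ just y) → Exec ρ μ descend 44 (λ ρ′ μ′ → ∃ λ j → j < i × Descending μ j ρ′ μ′)
    go (y , Pd≡) =
      add: v₀ v₈ (fits (+-monoʳ-≤ top (≤-trans d≤n (≤-trans (m≤m+n n n) (≤-trans (m≤m+n _ (n * k)) (≤-trans (m≤m+n _ k) (m≤m+n _ 99))))))) λ x₁ e₁ →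
      load: e₁ (Read.pattern′ mem Pd≡) (
      const: (small 5 (≤ᵇ⇒≤ 5 99 tt)) λ x₂ e₂ →
      add: v₆ e₂ (<-trans (at-< a₅) top-fits) λ x₃ e₃ →
      loadR: mem e₃ a₅ (<-trans (at-< (Probe.multAt probe₁)) top-fits) λ x₄ e₄ →
      div: refl v₇ λ x₅ e₅ →
      probe: mem probe₁ (<-trans (at-< (Probe.multAt probe₂)) top-fits) v₂ e₄ e₅ λ _ _ _ _ _ _ _ x₆ e₆ →
      probe: mem probe₂ (<-trans (at-< (Probe.multAt probe₃)) top-fits) v₂ e₆ e₅ λ _ _ _ _ _ _ _ x₇ e₇ →
      mod: refl v₇ λ x₈ e₈ →
      probe: mem probe₃ (<-trans (at-< (Probe.multAt probe₄)) top-fits) v₂ e₇ e₈ λ _ _ _ _ _ _ _ x₉ e₉ →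
      probe: mem probe₄ (<-trans (at-< (depth-at nd)) top-fits) v₂ e₉ e₈ λ _ _ _ _ _ _ _ x₁₀ e₁₀ →
      const: (small 0 z≤n) λ x₁₁ e₁₁ →
      add: e₁₀ e₁₁ (subst (_< 2 ^ w) (sym (+-identityʳ _)) (<-trans (at-< (depth-at nd)) top-fits)) λ x₁₂ e₁₂ →
      loadR: mem (trans e₁₂ (+-identityʳ _)) (depth-at nd) (n-fits (depth-≤n nd)) λ x₁₃ e₁₃ →
      lt: e₁₃ v₁ 1<2^w λ x₁₄ e₁₄ →
      done (m ∸ depth nd , subst (m ∸ depth nd <_) (sym i≡) smaller , refl , (v₀ , v₁ , v₂ , v₄ , v₅) , v₇ ,
            located nd d<m (trans e₁₂ (+-identityʳ _)) e₁₃ e₁₄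
              (trans occ (sym (filter-refine matches? (λ i → letter i d ≟ᴹ just x) S next-letter))) refl))
      where
      ch = child (<-≤-trans d<m m≤n) (value y)
      x = proj₁ ch
      nd = proj₁ (proj₂ (proj₂ (proj₂ ch)))
      open Lookup (proj₁ (proj₂ (proj₂ ch)))
      smaller : m ∸ depth nd < m ∸ d
      smaller = ≤-<-trans (∸-monoʳ-≤ m (depth-≥ nd)) (∸-monoʳ-< ≤-refl d<m)
      -- An occurrence in `S` is continued by `P[d]`, so this letter is present and the dictionary
      -- is exact for it. Without occurrences the claim is vacuous, and an arbitrary child does no
      -- harm.
      next-letter : ∀ {j} → j ∈ S → substring T j m ≡ P → letter j d ≡ just x
      next-letter {j} j∈ e = trans y-next (cong just (sym (proj₂ (proj₂ (proj₂ (proj₂ ch))) j∈ y-next)))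
        where
        y-next : letter j d ≡ just (value y)
        y-next = cong (Maybe.map value) (trans (substring-nth T P e d<m) Pd≡)

  product-≢0 : ∀ {a b} → (a * b) % 2 ^ w ≢ 0 → a ≢ 0 × b ≢ 0
  product-≢0 {a} {b} nz = (λ { refl → nz zero%}) , λ { refl → nz (trans (cong (_% 2 ^ w) (*-zeroʳ a)) zero%) }
    where
    zero% : 0 % 2 ^ w ≡ 0
    zero% = m<n⇒m%n≡m (small 0 z≤n)

  product-≡0 : ∀ {a b} → a ≤ 1 → b ≤ 1 → (a * b) % 2 ^ w ≡ 0 → a ≢ 0 → b ≡ 0
  product-≡0 {zero}          _        _        _ nz = contradiction refl nz
  product-≡0 {suc zero} {b}  _        b≤1      z _  =
    trans (sym (trans (cong (_% 2 ^ w) (+-identityʳ b)) (m<n⇒m%n≡m (≤-<-trans b≤1 1<2^w)))) z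
  product-≡0 {suc (suc _)} (s≤s ()) _ _ _

  too-long : ∀ {i} → i < n → n < i + m → substring T i m ≢ P
  too-long {i} i<n n< e≡ = contradiction (trans (sym (proj₂ (nth-defined P l<m))) (trans (sym (substring-nth T P e≡ l<m)) outside)) λ ()
    where
    l = n ∸ i
    l<m : l < m
    l<m = +-cancelˡ-< i l m (subst (_< i + m) (sym (m+[n∸m]≡n (<⇒≤ i<n))) n<)
    outside : nth T (i + l) ≡ nothing
    outside = nth-undefined T (≤-reflexive (sym (m+[n∸m]≡n (<⇒≤ i<n))))

  -- The registers that `statAt` spares: 3 and 12 are its scratch space. In this Boolean form,
  -- closed instances are proved by `tt`.
  Kept : ℕ → Set
  Kept r = Bool.T ((r <ᵇ 40) ∧ not (r ≡ᵇ 3) ∧ not (r ≡ᵇ 12))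

  kept : ∀ r → Kept r → r < 40 × r ≢ 3 × r ≢ 12
  kept r h with r <ᵇ 40 in e₁ | r ≡ᵇ 3 in e₂ | r ≡ᵇ 12 in e₃
  ... | true | false | false = <ᵇ⇒< r 40 (subst Bool.T (sym e₁) tt)
                             , (λ { refl → contradiction e₂ λ () }) , (λ { refl → contradiction e₃ λ () })

  update-≢ : ∀ (ρ : Regs w) {x r r′} → r′ ≢ r → (ρ [ r ↦ x ]) r′ ≡ ρ r′
  update-≢ ρ {r = r} {r′} ne with r′ ≡ᵇ r in e
  ... | true  = contradiction (≡ᵇ⇒≡ r′ r (subst Bool.T (sym e) tt)) ne
  ... | false = refl

  record Stores (ρ : Regs w) (b : ℕ) (xs : List (Word w)) : Set where
    constructor stores
    field
      register : ∀ {j x} → nth xs j ≡ just x → ρ (b + j) ≡ x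

  open Stores

  statistic : ℕ → V
  statistic i = Stat i (i + m ∸ 1)

  statAt-exec : ∀ b {i} → Mem μ → Base ρ → value (ρ 17) ≡ i → i < n → i + m ≤ n →
                Exec ρ μ (statAt (40 + b)) (8 + t) (λ ρ′ μ′ → Mem μ′ × (∀ r → Kept r → ρ′ r ≡ ρ r) ×
                  (∀ r → r < b → ρ′ (40 + r) ≡ ρ (40 + r)) × Stores ρ′ (40 + b) (toList (encode (statistic i))))
  statAt-exec {μ} {ρ} b {i} mem (v₀ , v₁ , v₂ , v₄ , v₅) v₁₇ i<n i+m≤n = arguments ⟫ λ {ρ₁} → call {ρ₁}
    where
    β = 40 + b
    Ready : Regs w → Memory w → Set
    Ready ρ₁ μ₁ = μ₁ ≡ μ × (∀ r → Kept r → ρ₁ r ≡ ρ r) × (∀ r → r < b → ρ₁ (40 + r) ≡ ρ (40 + r)) ×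
                  value (ρ₁ (β + 0)) ≡ L₀ × value (ρ₁ (β + 1)) ≡ i × value (ρ₁ (β + 2)) ≡ i + m ∸ 1 × value (ρ₁ (β + 3)) ≡ n
    fits-n : ∀ {a} → a ≤ n → a + 0 < 2 ^ w
    fits-n {a} a≤ = subst (_< 2 ^ w) (sym (+-identityʳ a)) (n-fits a≤)
    arguments : Exec ρ μ _ 8 Ready
    arguments =
      add: v₁₇ v₁ (n-fits i+m≤n) λ x₁ e₁ →
      sub: e₁ v₂ (≤-trans 1≤m (m≤n+m m i)) λ x₂ e₂ →
      const: (small 0 z≤n) λ x₃ e₃ →
      add: v₄ e₃ (subst (_< 2 ^ w) (sym (+-identityʳ L₀)) (≤-<-trans (≤-trans (m≤m+n L₀ n) (m≤m+n off (length R))) top-fits)) λ x₄ e₄ →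
      add: v₁₇ e₃ (fits-n (<⇒≤ i<n)) λ x₅ e₅ →
      add: e₂ e₃ (fits-n (≤-trans (m∸n≤m (i + m) 1) i+m≤n)) λ x₆ e₆ →
      add: v₅ e₃ (fits-n ≤-refl) λ x₇ e₇ →
      done (state x₁ x₂ x₃ x₄ x₅ x₆ x₇ e₄ e₅ e₆ e₇)
      where
      state : ∀ x₁ x₂ x₃ x₄ x₅ x₆ x₇ → value x₄ ≡ L₀ + 0 → value x₅ ≡ i + 0 → value x₆ ≡ i + m ∸ 1 + 0 → value x₇ ≡ n + 0 →
              Ready (ρ [ 12 ↦ x₁ ] [ 12 ↦ x₂ ] [ 3 ↦ x₃ ] [ β + 0 ↦ x₄ ] [ β + 1 ↦ x₅ ] [ β + 2 ↦ x₆ ] [ β + 3 ↦ x₇ ]) μ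
      state x₁ x₂ x₃ x₄ x₅ x₆ x₇ e₄ e₅ e₆ e₇ = refl
        , (λ r kr → let r< , r≢3 , r≢12 = kept r kr in
            trans (below r (<-≤-trans r< (m≤m+n 40 b))) (trans (update-≢ ρ₂ r≢3) (trans (update-≢ ρ₁ r≢12) (update-≢ ρ r≢12))))
        , (λ r r<b → below (40 + r) (+-monoʳ-< 40 r<b))
        , trans (cong value (trans (update-below ρ₆ (above 0 3 (s≤s z≤n))) (trans (update-below ρ₅ (above 0 2 (s≤s z≤n)))
            (trans (update-below ρ₄ (above 0 1 (s≤s z≤n))) (update-at ρ₃ (β + 0)))))) (trans e₄ (+-identityʳ _))
        , trans (cong value (trans (update-below ρ₆ (above 1 3 (s≤s (s≤s z≤n)))) (trans (update-below ρ₅ (above 1 2 (s≤s (s≤s z≤n))))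
            (update-at ρ₄ (β + 1))))) (trans e₅ (+-identityʳ _))
        , trans (cong value (trans (update-below ρ₆ (above 2 3 (s≤s (s≤s (s≤s z≤n))))) (update-at ρ₅ (β + 2)))) (trans e₆ (+-identityʳ _))
        , trans (cong value (update-at ρ₆ (β + 3))) (trans e₇ (+-identityʳ _))
        where
        ρ₁ = ρ [ 12 ↦ x₁ ]
        ρ₂ = ρ₁ [ 12 ↦ x₂ ]
        ρ₃ = ρ₂ [ 3 ↦ x₃ ]
        ρ₄ = ρ₃ [ β + 0 ↦ x₄ ]
        ρ₅ = ρ₄ [ β + 1 ↦ x₅ ]
        ρ₆ = ρ₅ [ β + 2 ↦ x₆ ]
        above : ∀ j l → j < l → β + j < β + l
        above j l = +-monoʳ-< β
        below : ∀ r → r < β → (ρ₆ [ β + 3 ↦ x₇ ]) r ≡ ρ₃ r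
        below r r< = trans (update-below ρ₆ (<-≤-trans r< (m≤m+n β 3))) (trans (update-below ρ₅ (<-≤-trans r< (m≤m+n β 2)))
          (trans (update-below ρ₄ (<-≤-trans r< (m≤m+n β 1))) (update-below ρ₃ (<-≤-trans r< (m≤m+n β 0)))))
    call : ∀ {ρ₁ μ₁} → Ready ρ₁ μ₁ → Exec ρ₁ μ₁ (shift β statProgram) t (λ ρ′ μ′ → Mem μ′ × (∀ r → Kept r → ρ′ r ≡ ρ r) ×
                  (∀ r → r < b → ρ′ (40 + r) ≡ ρ (40 + r)) × Stores ρ′ (40 + b) (toList (encode (statistic i))))
    call {ρ₁} (refl , keep , acc , w₀ , w₁ , w₂ , w₃) = run mem
      where
      i≤j : i ≤ i + m ∸ 1
      i≤j = ≤-trans (m≤m+n i (m ∸ 1)) (≤-reflexive (sym (+-∸-assoc i 1≤m)))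
      j<n : i + m ∸ 1 < n
      j<n = <-≤-trans (∸-monoʳ-< z<s (≤-trans 1≤m (m≤n+m m i))) i+m≤n
      run : Mem μ → _
      run (D , valid , refl , refl) = finish (S.correct ((i , i + m ∸ 1) , i≤j , j<n) valid (λ r → ρ₁ (β + r)) given)
        where
        given : (λ r → ρ₁ (β + r)) Holds (word (length D) ∷ word i ∷ word (i + m ∸ 1) ∷ word n ∷ [])
        given zero                         = ≡-word w₀
        given (suc zero)                   = ≡-word w₁
        given (suc (suc zero))             = ≡-word w₂
        given (suc (suc (suc zero)))       = ≡-word w₃
        finish : (∃ λ t′ → ∃ λ ρ′ → ∃ λ D′ → ((λ r → ρ₁ (β + r)) , D ++ T) ⊢ statProgram ⇓[ t′ ] (ρ′ , D′ ++ T)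
                   × t′ ≤ t × S.Valid D′ × ρ′ Holds toList (encode (statistic i))) → _
        finish (t′ , ρ′ , D′ , d , t′≤ , valid′ , holds)
          with σ , d′ , h , keep′ ← shift-run d β (map word R ++ P) ρ₁ (λ _ → refl) =
          t′ , σ , (D′ ++ T) ++ (map word R ++ P) , d′ , t′≤
          , (D′ , valid′ , same-length , refl)
          , (λ r kr → trans (keep′ (<-≤-trans (proj₁ (kept r kr)) (m≤m+n 40 b))) (keep r kr))
          , (λ r r<b → trans (keep′ (+-monoʳ-< 40 r<b)) (acc r r<b))
          , stores λ {j} e → trans (h j) (holds⇒nth {xs = toList (encode (statistic i))} holds e)
          where
          -- Validity bounds the length only from above; that it is unchanged follows from the run
          -- itself.
          same-length : length D′ ≡ length D
          same-length = +-cancelʳ-≡ n (length D′) (length D)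
            (trans (sym (length-++ D′)) (trans (length-preserved d) (length-++ D)))

  combine-exec : ∀ u v → Stores ρ 40 (toList (encode u)) → Stores ρ (40 + k) (toList (encode v)) →
                 Exec ρ μ (shift 40 combineProgram) t (λ ρ′ μ′ → μ′ ≡ μ × (∀ r → r < 40 → ρ′ r ≡ ρ r) × Stores ρ′ 40 (toList (encode (u ⊙ v))))
  combine-exec {ρ} {μ} u v hu hv = finish (combines u v (λ r → ρ (40 + r))
      (holds-++ {ρ = λ r → ρ (40 + r)} (toList (encode u)) (register hu) (λ {j} e → trans (cong (λ l → ρ (40 + (l + j))) (length-toList (encode u))) (register hv e))))
    where
    finish : (∃ λ t′ → ∃ λ ρ′ → ((λ r → ρ (40 + r)) , []) ⊢ combineProgram ⇓[ t′ ] (ρ′ , []) × t′ ≤ t × ρ′ Holds toList (encode (u ⊙ v))) → _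
    finish (t′ , ρ′ , d , t′≤ , holds) with σ , d′ , h , keep ← shift-run d 40 μ ρ (λ _ → refl) =
      t′ , σ , μ , d′ , t′≤ , refl , (λ r → keep) , stores λ {j} e → trans (h j) (holds⇒nth {xs = toList (encode (u ⊙ v))} holds e)

  Answered : List (Word w) → Memory w → Regs w → Memory w → Set
  Answered ws μ ρ μ′ = μ′ ≡ μ × ρ 0 ≡ word 1 × Stores ρ 1 ws

  k-fits : ∀ {a} → a ≤ k → a < 2 ^ w
  k-fits h = fits (≤-trans h (≤-trans (≤-trans (m≤n+m k (n + n + n * k)) (m≤m+n _ 99)) (m≤n+m _ top)))

  fetch-exec : ∀ ws {base} c → length ws ≡ k → c ≤ k → value (ρ 0) ≡ base → (∀ {j x} → nth ws j ≡ just x → nth μ (base + j) ≡ just x) →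
               (∀ {j x} → c ≤ j → nth ws j ≡ just x → ρ (1 + j) ≡ x) → base + k < 2 ^ w →
               Exec ρ μ (fetch c) (c * 3 + 2) (Answered ws μ)
  fetch-exec ws zero    len c≤ v₀ mem h base-fits = const: 1<2^w λ x e → done (refl , ≡-word e , stores (h z≤n))
  fetch-exec {ρ} {μ} ws {base} (suc c) len c<k v₀ mem h base-fits = go (nth-defined ws (subst (c <_) (sym len) c<k))
    where
    go : (∃ λ y → nth ws c ≡ just y) → Exec ρ μ (fetch (suc c)) (suc c * 3 + 2) (Answered ws μ)
    go (y , wc) =
      const: (k-fits (<⇒≤ c<k)) λ x₁ e₁ →
      add: v₀ (trans (cong value (update-at ρ (suc c))) e₁) (<-trans (+-monoʳ-< base c<k) base-fits) λ x₂ e₂ →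
      load: (trans (cong value (update-at (ρ [ suc c ↦ x₁ ]) (suc c))) e₂) (mem wc) (
      fetch-exec ws c len (<⇒≤ c<k) v₀ mem (next x₁ x₂) base-fits)
      where
      next : ∀ x₁ x₂ {j x} → c ≤ j → nth ws j ≡ just x → (ρ [ suc c ↦ x₁ ] [ suc c ↦ x₂ ] [ suc c ↦ y ]) (1 + j) ≡ x
      next x₁ x₂ {j} c≤j e with m≤n⇒m<n∨m≡n c≤j
      ... | inj₂ refl = trans (update-at (ρ [ suc c ↦ x₁ ] [ suc c ↦ x₂ ]) (suc c)) (just-injective (trans (sym wc) e))
      ... | inj₁ c<j  = trans (update-≢ (ρ [ suc c ↦ x₁ ] [ suc c ↦ x₂ ]) ne) (trans (update-≢ (ρ [ suc c ↦ x₁ ]) ne) (trans (update-≢ ρ ne) (h c<j e)))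
        where
        ne : suc j ≢ suc c
        ne e = <⇒≢ c<j (sym (suc-injective e))

  copy-exec : ∀ ws i c → length ws ≡ k → i + c ≡ k → value (ρ 0) ≡ 0 → (∀ {j x} → i ≤ j → nth ws j ≡ just x → ρ (40 + j) ≡ x) →
              (∀ {j x} → j < i → nth ws j ≡ just x → ρ (1 + j) ≡ x) → Exec ρ μ (copyOut i c) (c + 2) (Answered ws μ)
  copy-exec ws i zero    len i≡ v₀ src dst = const: 1<2^w λ x e → done (refl , ≡-word e ,
    stores λ {j} wj → dst (subst (j <_) (trans len (trans (sym i≡) (+-identityʳ i))) (nth-< ws wj)) wj)
  copy-exec {ρ} {μ} ws i (suc c) len i≡ v₀ src dst =
    add: refl v₀ (subst (_< 2 ^ w) (sym (+-identityʳ _)) (value-< _)) λ x e →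
    copy-exec ws (suc i) c len (trans (sym (+-suc i c)) i≡) v₀
      (λ {j} i<j wj → trans (update-≢ ρ {x} (λ e≡ → <⇒≢ (≤-trans i<j (m≤n+m j 39)) (sym (suc-injective e≡)))) (src (<⇒≤ i<j) wj))
      (λ {j} j≤i wj → copied x e wj (m≤n⇒m<n∨m≡n (s≤s⁻¹ j≤i)))
    where
    copied : ∀ x → value x ≡ value (ρ (40 + i)) + 0 → ∀ {j y} → nth ws j ≡ just y → j < i ⊎ j ≡ i → (ρ [ suc i ↦ x ]) (1 + j) ≡ y
    copied x e wj (inj₁ j<i)  = trans (update-≢ ρ (λ e≡ → <⇒≢ j<i (suc-injective e≡))) (dst j<i wj)
    copied x e wj (inj₂ refl) = trans (update-at ρ (suc i)) (trans (value-injective (trans e (+-identityʳ _))) (src ≤-refl wj))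

  record Arrival : Set where
    field
      {a e d start tab i₀} : ℕ
      {S fs}               : List ℕ
      a₀     : At R a d
      a₁     : At R (a + 1) start
      a₂     : At R (a + 2) (length S)
      a₃     : At R (a + 3) e
      a₄     : At R (a + 4) tab
      <n     : All (_< n) S
      e≤m    : e ≤ m
      m≤d    : m ≤ d
      perm   : i₀ ∷ fs ↭ S
      seg    : Segment R start (i₀ ∷ fs)
      agr    : Agree S d
      tab≤   : tab ≤ off + length R
      stored : ∀ m → e ≤ m → m ≤ d → m ≤ length S → Segment R (tab + (m ∸ e) * k) (answerFor m S)
      occ    : Occ T P ≡ filter matches? S

  module AtNode (arrival : Arrival) where

    open Arrival arrival

    i₀∈ : i₀ ∈ S
    i₀∈ = ∈-resp-↭ perm (here refl)

    i₀<n : i₀ < n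
    i₀<n = All.lookup <n i₀∈

    start<top : start < top
    start<top = ≤-<-trans (m≤m+n start 0) (at-< (cell seg {0} refl))

    last-defined : ∀ {A : Set} (x : A) xs → ∃ λ y → nth (x ∷ xs) (length xs) ≡ just y
    last-defined x xs = nth-defined (x ∷ xs) (n<1+n (length xs))

    -- The positions occupy one memory cell each, all below `top`, so their number fits into a word.
    size≤top : length S ≤ top
    size≤top = subst (_≤ top) (↭-length perm)
      (≤-<-trans (m≤n+m (length fs) start) (at-< (cell seg (proj₂ (last-defined i₀ fs)))))

    size-fits : length S < 2 ^ w
    size-fits = ≤-<-trans size≤top top-fits

    NodeRegs : Regs w → Set
    NodeRegs ρ = Base ρ × value (ρ 6) ≡ a × value (ρ 15) ≡ start × value (ρ 16) ≡ length S × value (ρ 17) ≡ i₀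

    -- As long as `flag` is nonzero, the suffix is long enough and the first `count` letters match;
    -- once it is zero, a mismatch is certain.
    record Progress (i : ℕ) (ρ : Regs w) : Set where
      constructor progress
      field
        {count flag} : ℕ
        r₁₈     : value (ρ 18) ≡ count
        r₁₉     : value (ρ 19) ≡ flag
        r₉      : value (ρ 9) ≡ (bit (count <ᵇ m) * flag) % 2 ^ w
        count≤  : count ≤ m
        flag≤1  : flag ≤ 1
        prefix  : flag ≢ 0 → i₀ + m ≤ n × (∀ {l} → l < count → nth T (i₀ + l) ≡ nth P l)
        differ  : flag ≡ 0 → substring T i₀ m ≢ P
        measure : i ≡ m ∸ count

    Verifying : Memory w → ℕ → Regs w → Memory w → Set
    Verifying μ i ρ μ′ = μ′ ≡ μ × NodeRegs ρ × Progress i ρ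

    i₀+m-fits : i₀ + m < 2 ^ w
    i₀+m-fits = 2n+99 (≤-trans (+-mono-≤ (<⇒≤ i₀<n) m≤n) (m≤m+n (n + n) 99))

    represent-exec : Mem μ → Base ρ → value (ρ 6) ≡ a → Exec ρ μ represent 12 (λ ρ′ μ′ → Verifying μ m ρ′ μ′)
    represent-exec mem (v₀ , v₁ , v₂ , v₄ , v₅) v₆ =
      add: v₆ v₂ (<-trans (at-< a₁) top-fits) λ x₁ e₁ →
      loadR: mem e₁ a₁ (<-trans start<top top-fits) λ x₂ e₂ →
      add: e₁ v₂ (<-trans (at-< a₂′) top-fits) λ x₃ e₃ →
      loadR: mem e₃ a₂′ size-fits λ x₄ e₄ →
      loadR: mem (trans e₂ (sym (+-identityʳ start))) (cell seg {0} refl) (n-fits (<⇒≤ i₀<n)) λ x₅ e₅ →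
      add: e₅ v₁ i₀+m-fits λ x₆ e₆ →
      add: v₅ v₂ (2n+99 (≤-trans (+-monoʳ-≤ n (≤ᵇ⇒≤ 1 99 tt)) (+-monoˡ-≤ 99 (m≤m+n n n)))) λ x₇ e₇ →
      lt: e₆ e₇ 1<2^w λ x₈ e₈ →
      const: (small 0 z≤n) λ x₉ e₉ →
      lt: e₉ v₁ 1<2^w λ x₁₀ e₁₀ →
      mul: e₁₀ e₈ λ x₁₁ e₁₁ →
      done (refl , ((v₀ , v₁ , v₂ , v₄ , v₅) , v₆ , e₂ , e₄ , e₅) ,
        progress e₉ e₈ e₁₁ z≤n (bit-≤1 _)
          (λ nz → s≤s⁻¹ (subst (i₀ + m <_) (+-comm n 1) (bit-<-≢0 (i₀ + m) (n + 1) nz)) , λ ())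
          (λ z → too-long i₀<n (subst (_≤ i₀ + m) (+-comm n 1) (bit-<-≡0 (i₀ + m) (n + 1) z)))
          refl)
      where
      a₂′ : At R (a + 1 + 1) (length S)
      a₂′ = subst (λ b → At R b (length S)) (sym (+-assoc a 1 1)) a₂

    verify-exec : ∀ {i} → Mem μ → Verifying μ i ρ μ → value (ρ 9) ≢ 0 →
                  Exec ρ μ verify 10 (λ ρ′ μ′ → ∃ λ j → j < i × Verifying μ j ρ′ μ′)
    verify-exec {μ} {ρ} {i} mem (_ , ((v₀ , v₁ , v₂ , v₄ , v₅) , v₆ , v₁₅ , v₁₆ , v₁₇) ,
        progress {count} {flag} v₁₈ v₁₉ v₉ count≤ flag≤1 prefix differ i≡) nz =
      go (nth-defined T {i₀ + count} i₀+count<n) (nth-defined P count<m)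
      where
      nzs : bit (count <ᵇ m) ≢ 0 × flag ≢ 0
      nzs = product-≢0 {bit (count <ᵇ m)} {flag} (λ z → nz (trans v₉ z))
      count<m : count < m
      count<m = bit-<-≢0 count m (proj₁ nzs)
      i₀+m≤n = proj₁ (prefix (proj₂ nzs))
      agreed = proj₂ (prefix (proj₂ nzs))
      i₀+count<n : i₀ + count < n
      i₀+count<n = <-≤-trans (+-monoʳ-< i₀ count<m) i₀+m≤n
      text-fits : L₀ + i₀ + count < 2 ^ w
      text-fits = <-trans (subst (_< off) (sym (+-assoc L₀ i₀ count)) (+-monoʳ-< L₀ i₀+count<n))
        (≤-<-trans (m≤m+n off (length R)) top-fits)
      go : (∃ λ x → nth T (i₀ + count) ≡ just x) → (∃ λ y → nth P count ≡ just y) →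
           Exec ρ μ verify 10 (λ ρ′ μ′ → ∃ λ j → j < i × Verifying μ j ρ′ μ′)
      go (x , Tx) (y , Py) =
        add: v₄ v₁₇ (≤-<-trans (m≤m+n _ count) text-fits) λ x₁ e₁ →
        add: e₁ v₁₈ text-fits λ x₂ e₂ →
        load: (trans e₂ (+-assoc L₀ i₀ count)) (Read.text mem Tx) (
        add: v₀ v₁₈ (fits (+-monoʳ-≤ top (≤-trans count≤ (≤-trans m≤n (≤-trans (m≤m+n n n) (≤-trans (m≤m+n _ (n * k)) (≤-trans (m≤m+n _ k) (m≤m+n _ 99)))))))) λ x₃ e₃ →
        load: e₃ (Read.pattern′ mem Py) (
        eq: refl refl 1<2^w λ x₄ e₄ →
        add: v₁₈ v₂ (2n+99 (≤-trans (+-mono-≤ (≤-trans count≤ m≤n) (≤ᵇ⇒≤ 1 99 tt)) (+-monoˡ-≤ 99 (m≤m+n n n)))) λ x₅ e₅ →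
        lt: e₅ v₁ 1<2^w λ x₆ e₆ →
        mul: e₆ e₄ λ x₇ e₇ →
        done (m ∸ (count + 1) , subst (m ∸ (count + 1) <_) (sym i≡) (∸-monoʳ-< (m<m+n count z<s) (subst (_≤ m) (+-comm 1 count) count<m)) ,
          refl , ((v₀ , v₁ , v₂ , v₄ , v₅) , v₆ , v₁₅ , v₁₆ , v₁₇) ,
          progress e₅ e₄ e₇ (subst (_≤ m) (+-comm 1 count) count<m) (bit-≤1 _)
            (λ nz′ → i₀+m≤n , λ l< → extend (value-injective (bit-≡-≢0 (value x) (value y) nz′)) (m≤n⇒m<n∨m≡n (s≤s⁻¹ (<-≤-trans l< (≤-reflexive (+-comm count 1))))))
            (λ z e≡ → bit-≡-≡0 (value x) (value y) z (cong value (just-injective (trans (sym Tx) (trans (substring-nth T P e≡ count<m) Py)))))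
            refl)))
        where
        extend : x ≡ y → ∀ {l} → l < count ⊎ l ≡ count → nth T (i₀ + l) ≡ nth P l
        extend _   (inj₁ l<)   = agreed l<
        extend x≡y (inj₂ refl) = trans Tx (trans (cong just x≡y) (sym Py))

    verified : ∀ {i ρ} → Progress i ρ → value (ρ 9) ≡ 0 → value (ρ 19) ≢ 0 → substring T i₀ m ≡ P
    verified (progress {count} {flag} v₁₈ v₁₉ v₉ count≤ flag≤1 prefix differ _) z nz = nth-substring T P λ l<m →
      proj₂ (prefix flag≢0) (<-≤-trans l<m (≮⇒≥ λ count<m →
        flag≢0 (product-≡0 {bit (count <ᵇ m)} {flag} (bit-≤1 (count <ᵇ m)) flag≤1 (trans (sym v₉) z) (λ b → contradiction (bit-<-≡0 count m b) (<⇒≱ count<m)))))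
      where
      flag≢0 : flag ≢ 0
      flag≢0 f = nz (trans v₁₉ f)

    refuted : ∀ {i ρ} → Progress i ρ → value (ρ 19) ≡ 0 → substring T i₀ m ≢ P
    refuted (progress v₁₈ v₁₉ v₉ count≤ flag≤1 prefix differ _) z = differ (trans (sym v₁₉) z)

    all-alike : ∀ {i j} → i ∈ S → j ∈ S → substring T i m ≡ P → substring T j m ≡ P
    all-alike i∈ j∈ e≡ = nth-substring T P λ l<m →
      trans (map-value-injective (agree agr j∈ i∈ (<-≤-trans l<m m≤d))) (substring-nth T P e≡ l<m)

    occ-all : substring T i₀ m ≡ P → Occ T P ≡ S
    occ-all e≡ = trans occ (filter-all matches? (All.tabulate λ i∈ → all-alike i₀∈ i∈ e≡))

    occ-none : substring T i₀ m ≢ P → Occ T P ≡ []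
    occ-none ne = trans occ (filter-none matches? (All.tabulate λ i∈ e≡ → ne (all-alike i∈ i₀∈ e≡)))

    total : V
    total = foldl _⊙_ (statistic i₀) (map statistic fs)

    aggregate-S : aggregate _⊙_ (map statistic S) ≡ just total
    aggregate-S = aggregate-↭ semigroup (↭-map statistic (↭-sym perm))

    ws : List (Word w)
    ws = toList (encode total)

    len-ws : length ws ≡ k
    len-ws = length-toList (encode total)

    tabulated-exec : Mem μ → Base ρ → value (ρ 6) ≡ a → m ≤ length S → Exec ρ μ tabulated (9 + (k * 3 + 2)) (Answered ws μ)
    tabulated-exec {μ} mem (v₀ , v₁ , v₂ , v₄ , v₅) v₆ m≤S =
      const: (small 3 (≤ᵇ⇒≤ 3 99 tt)) λ x₁ e₁ →
      add: v₆ e₁ (<-trans (at-< a₃) top-fits) λ x₂ e₂ →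
      loadR: mem e₂ a₃ (n-fits (≤-trans e≤m m≤n)) λ x₃ e₃ →
      add: e₂ v₂ (<-trans (at-< a₄′) top-fits) λ x₄ e₄ →
      loadR: mem e₄ a₄′ (≤-<-trans tab≤ top-fits) λ x₅ e₅ →
      sub: v₁ e₃ e≤m λ x₆ e₆ →
      const: (k-fits ≤-refl) λ x₇ e₇ →
      mul: e₆ e₇ λ x₈ e₈ →
      add: e₅ (trans e₈ (m<n⇒m%n≡m (≤-<-trans (≤-trans (m≤m+n _ k) (m≤n+m _ tab)) (subst (_< 2 ^ w) (+-assoc tab _ k) base-fits)))) (≤-<-trans (m≤m+n _ k) base-fits) λ x₉ e₉ →
      fetch-exec ws k len-ws ≤-refl e₉ entry (λ k≤j wj → contradiction (subst (_ <_) len-ws (nth-< ws wj)) (≤⇒≯ k≤j)) base-fits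
      where
      a₄′ : At R (a + 3 + 1) tab
      a₄′ = subst (λ b → At R b tab) (sym (+-assoc a 3 1)) a₄
      base-fits : tab + (m ∸ e) * k + k < 2 ^ w
      base-fits = fits (≤-trans (≤-reflexive (+-assoc tab _ k)) (+-mono-≤ tab≤ (≤-trans
        (+-monoˡ-≤ k (≤-trans (*-monoˡ-≤ k (≤-trans (m∸n≤m m e) m≤n)) (m≤n+m (n * k) (n + n)))) (m≤m+n _ 99))))
      entry : ∀ {j x} → nth ws j ≡ just x → nth μ (tab + (m ∸ e) * k + j) ≡ just x
      entry {j} {x} wj = trans (Read.static mem (cell (stored m e≤m m≤d m≤S) (trans (cong (λ v → nth (map value (encoding v)) j) aggregate-S) (nth-map value ws wj))))
        (cong just (sym (≡-word {x} refl)))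

    -- `us` are the positions already folded in after `i₀`, `vs` those still to come; the length of
    -- `vs` is the variant.
    Enumerating : ℕ → Regs w → Memory w → Set
    Enumerating i ρ μ = Mem μ × Base ρ × value (ρ 15) ≡ start × value (ρ 16) ≡ length S ×
      ∃ λ us → ∃ λ vs → fs ≡ us ++ vs × value (ρ 18) ≡ suc (length us) × value (ρ 9) ≡ bit (suc (length us) <ᵇ length S) ×
      Stores ρ 40 (toList (encode (foldl _⊙_ (statistic i₀) (map statistic us)))) × i ≡ length vs

    in-range : ∀ {i} → i ∈ i₀ ∷ fs → substring T i₀ m ≡ P → i < n × i + m ≤ n
    in-range i∈ e≡ = let i∈S = ∈-resp-↭ perm i∈ ; i<n = All.lookup <n i∈S in
      i<n , ≮⇒≥ λ n< → too-long i<n n< (all-alike i₀∈ i∈S e≡)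

    base-kept : ∀ {ρ ρ′ : Regs w} → (∀ r → Kept r → ρ′ r ≡ ρ r) → Base ρ → Base ρ′
    base-kept {ρ} {ρ′} keep (v₀ , v₁ , v₂ , v₄ , v₅) =
      via 0 tt v₀ , via 1 tt v₁ , via 2 tt v₂ , via 4 tt v₄ , via 5 tt v₅
      where
      via : ∀ r {v} → Kept r → value (ρ r) ≡ v → value (ρ′ r) ≡ v
      via r kr e = trans (cong value (keep r kr)) e

    accumulate-exec : ∀ {i} → substring T i₀ m ≡ P → Enumerating i ρ μ → value (ρ 9) ≢ 0 →
                      Exec ρ μ accumulate (3 + ((8 + t) + (t + 3))) (λ ρ′ μ′ → ∃ λ j → j < i × Enumerating j ρ′ μ′)
    accumulate-exec e≡ (_ , _ , _ , _ , us , [] , refl , _ , v₉ , _) nz =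
      contradiction (bit-<-≢0 (suc (length us)) (length S) (λ z → nz (trans v₉ z)))
        (<-irrefl (trans (cong (suc ∘ length) (sym (++-identityʳ us))) (↭-length perm)))
    accumulate-exec {ρ} {μ} {i} e≡ (mem , base@(v₀ , v₁ , v₂ , v₄ , v₅) , v₁₅ , v₁₆ , us , f ∷ vs , refl , v₁₈ , v₉ , acc , i≡) nz =
      position ⟫ λ (mem₁ , base₁ , w₁₅ , w₁₆ , w₁₇ , w₁₈ , acc₁) →
      statAt-exec k mem₁ base₁ w₁₇ (proj₁ f-range) (proj₂ f-range) ⟫ λ {ρ₂} (mem₂ , keep₂ , accs , new) →
      combine-exec u (statistic f) (stores λ {j} wj → trans (accs j (subst (j <_) (length-toList (encode u)) (nth-< (toList (encode u)) wj))) (register acc₁ wj)) new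
        ⟫ λ {ρ₃} (μ₃≡ , keep₃ , acc₃) →
      finish (subst Mem (sym μ₃≡) mem₂)
        (base-kept {ρ₂} {ρ₃} (λ r kr → keep₃ r (proj₁ (kept r kr))) (base-kept keep₂ base₁))
        (trans (cong value (trans (keep₃ 15 (<ᵇ⇒< 15 40 tt)) (keep₂ 15 tt))) w₁₅)
        (trans (cong value (trans (keep₃ 16 (<ᵇ⇒< 16 40 tt)) (keep₂ 16 tt))) w₁₆)
        (trans (cong value (trans (keep₃ 18 (<ᵇ⇒< 18 40 tt)) (keep₂ 18 tt))) w₁₈) acc₃
      where
      u = foldl _⊙_ (statistic i₀) (map statistic us)
      count = suc (length us)
      f-at : nth (i₀ ∷ us ++ f ∷ vs) count ≡ just f
      f-at = trans (cong (nth (us ++ f ∷ vs)) (sym (+-identityʳ (length us)))) (nth-++ʳ us 0)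
      f-range = in-range (there (∈-++⁺ʳ us (here refl))) e≡
      Positioned : Regs w → Memory w → Set
      Positioned ρ μ = Mem μ × Base ρ × value (ρ 15) ≡ start × value (ρ 16) ≡ length S × value (ρ 17) ≡ f × value (ρ 18) ≡ count ×
        Stores ρ 40 (toList (encode u))
      position : Exec ρ μ (op add 3 15 18 ⨾ load 17 3 ⨾ skip) 3 Positioned
      position =
        add: v₁₅ v₁₈ (<-trans (at-< (cell seg f-at)) top-fits) λ x₁ e₁ →
        loadR: mem e₁ (cell seg f-at) (n-fits (<⇒≤ (proj₁ f-range))) λ x₂ e₂ →
        done (mem , base , v₁₅ , v₁₆ , e₂ , v₁₈ , stores (register acc))
      grown : length (us ++ f ∷ []) ≡ count
      grown = trans (length-++ us) (+-comm (length us) 1)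
      finish : ∀ {ρ μ} → Mem μ → Base ρ → value (ρ 15) ≡ start → value (ρ 16) ≡ length S → value (ρ 18) ≡ count →
               Stores ρ 40 (toList (encode (u ⊙ statistic f))) →
               Exec ρ μ (op add 18 18 2 ⨾ op lt 9 18 16 ⨾ skip) 3 (λ ρ′ μ′ → ∃ λ j → j < i × Enumerating j ρ′ μ′)
      finish mem (v₀ , v₁ , v₂ , v₄ , v₅) v₁₅ v₁₆ v₁₈ acc =
        add: v₁₈ v₂ (<-trans (subst (_< top + 1) (+-comm 1 count) (s≤s′ count<)) (top+small 1 (≤ᵇ⇒≤ 1 99 tt))) λ x₁ e₁ →
        lt: e₁ v₁₆ 1<2^w λ x₂ e₂ →
        done (length vs , subst (length vs <_) (sym i≡) ≤-refl , mem , (v₀ , v₁ , v₂ , v₄ , v₅) , v₁₅ , v₁₆ ,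
          us ++ f ∷ [] , vs , sym (++-assoc us (f ∷ []) vs) ,
          trans e₁ (trans (+-comm count 1) (cong suc (sym grown))) ,
          trans e₂ (cong (λ c → bit (c <ᵇ length S)) (trans (+-comm count 1) (cong suc (sym grown)))) ,
          stores (λ {j} wj → register acc (trans (cong (λ v → nth (toList (encode v)) j) (sym extended)) wj)) , refl)
        where
        count< : count < top
        count< = ≤-<-trans (m≤n+m count start) (at-< (cell seg f-at))
        s≤s′ : ∀ {c} → c < top → 1 + c < top + 1
        s≤s′ {c} c< = subst (1 + c <_) (+-comm 1 top) (s≤s c<)
        extended : foldl _⊙_ (statistic i₀) (map statistic (us ++ f ∷ [])) ≡ u ⊙ statistic f
        extended = trans (cong (foldl _⊙_ (statistic i₀)) (map-++ statistic us (f ∷ []))) (foldl-++ _⊙_ (statistic i₀) (map statistic us) (statistic f ∷ []))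

    enumerate-time = (8 + t) + (3 + (suc (length fs * suc (3 + ((8 + t) + (t + 3)))) + suc (k + 2)))

    Answers : Regs w → Memory w → Set
    Answers ρ μ = Mem μ × ρ 0 ≡ word 1 × Stores ρ 1 ws

    enumerate-exec : substring T i₀ m ≡ P → Mem μ → NodeRegs ρ → Exec ρ μ enumerate enumerate-time Answers
    enumerate-exec {μ} {ρ} e≡ mem (base , v₆ , v₁₅ , v₁₆ , v₁₇) =
      statAt-exec 0 mem base v₁₇ (proj₁ (in-range (here refl) e≡)) (proj₂ (in-range (here refl) e≡)) ⟫ λ (mem₁ , keep , _ , acc) →
      init mem₁ (base-kept keep base) (trans (cong value (keep 15 tt)) v₁₅) (trans (cong value (keep 16 tt)) v₁₆) acc ⟫ λ inv →
      loop Enumerating (accumulate-exec e≡) inv ⟫ λ ((_ , inv′) , z) → output inv′ z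
      where
      init : ∀ {ρ μ} → Mem μ → Base ρ → value (ρ 15) ≡ start → value (ρ 16) ≡ length S → Stores ρ 40 (toList (encode (statistic i₀))) →
             Exec ρ μ (const 18 1 ⨾ op lt 9 18 16 ⨾ skip) 3 (Enumerating (length fs))
      init mem base v₁₅ v₁₆ acc =
        const: 1<2^w λ x₁ e₁ →
        lt: e₁ v₁₆ 1<2^w λ x₂ e₂ →
        done (mem , base , v₁₅ , v₁₆ , [] , fs , refl , e₁ , e₂ , stores (register acc) , refl)
      output : ∀ {i ρ μ} → Enumerating i ρ μ → value (ρ 9) ≡ 0 → Exec ρ μ (const 0 0 ⨾ copyOut 0 k) (suc (k + 2)) Answers
      output {ρ = ρ} {μ} (mem , _ , _ , _ , us , v ∷ vs , refl , _ , v₉ , _) z = contradiction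
        (subst (suc (length us) <_) (trans (cong suc (sym (length-++ us))) (↭-length perm)) (s≤s (m<m+n (length us) z<s)))
        (≤⇒≯ (bit-<-≡0 (suc (length us)) (length S) (trans (sym v₉) z)))
      output {ρ = ρ} {μ} (mem , _ , _ , _ , us , [] , fs≡ , _ , v₉ , acc , _) z =
        const: (small 0 z≤n) λ x e → answered (copy-exec ws 0 k len-ws refl e (λ {j} _ wj → register acc (trans (cong (λ us → nth (toList (encode (foldl _⊙_ (statistic i₀) (map statistic us)))) j) (trans (sym (++-identityʳ us)) (sym fs≡))) wj)) (λ ()))
        where
        answered : ∀ {ρ p c} → Exec ρ μ p c (Answered ws μ) → Exec ρ μ p c Answers
        answered (t , ρ , μ , d , t≤ , μ≡ , a₀ , a₁) = t , ρ , μ , d , t≤ , subst Mem (sym μ≡) mem , a₀ , a₁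

    Correct : Regs w → Memory w → Set
    Correct ρ μ = Mem μ × ρ Holds encodeMaybe encode (aggregate _⊙_ (map statistic (Occ T P)))

    -- Dominates both branches: at most `m` rounds of enumeration, since it is chosen only if
    -- `length S < m`, and `k * 3` steps for fetching a table row.
    Bound : ℕ
    Bound = (8 + t) + (3 + (suc (m * suc (3 + ((8 + t) + (t + 3)))) + suc (k + 2))) + k * 3

    answers⇒correct : substring T i₀ m ≡ P → ∀ {ρ μ} → Answers ρ μ → Correct ρ μ
    answers⇒correct e≡ {ρ} (mem , a₀ , a₁) = mem ,
      subst (λ o → ρ Holds encodeMaybe encode (aggregate _⊙_ (map statistic o))) (sym (occ-all e≡))
        (subst (λ v → ρ Holds encodeMaybe encode v) (sym aggregate-S) (nth⇒holds {ρ = ρ} {xs = word 1 ∷ ws} λ { {zero} refl → a₀ ; {suc j} wj → register a₁ wj }))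

    postcondition : ∀ {p c} {Q Q′ : Regs w → Memory w → Set} → (∀ {ρ μ} → Q ρ μ → Q′ ρ μ) → Exec ρ μ p c Q → Exec ρ μ p c Q′
    postcondition f (t , ρ , μ , d , t≤ , post) = t , ρ , μ , d , t≤ , f post

    found-exec : substring T i₀ m ≡ P → Mem μ → NodeRegs ρ → Exec ρ μ (op lt 9 16 1 ⨾ ifnz 9 enumerate tabulated) (2 + Bound) Correct
    found-exec {μ} {ρ} e≡ mem (base@(v₀ , v₁ , v₂ , v₄ , v₅) , v₆ , v₁₅ , v₁₆ , v₁₇) =
      lt: v₁₆ v₁ 1<2^w λ x e → branch x e (value x ≟ 0)
      where
      branch : ∀ x → value x ≡ bit (length S <ᵇ m) → Dec (value x ≡ 0) → Exec (ρ [ 9 ↦ x ]) μ (ifnz 9 enumerate tabulated) (1 + Bound) Correct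
      branch x e (no nz) = ifnz-then nz (weaken time (postcondition (answers⇒correct e≡)
        (enumerate-exec e≡ mem (base , v₆ , v₁₅ , v₁₆ , v₁₇))))
        where
        few : length fs ≤ m
        few = ≤-trans (n≤1+n _) (≤-trans (≤-reflexive (↭-length perm)) (<⇒≤ (bit-<-≢0 (length S) m (λ z → nz (trans e z)))))
        time : enumerate-time ≤ Bound
        time = ≤-trans (+-monoʳ-≤ (8 + t) (+-monoʳ-≤ 3 (+-monoˡ-≤ (suc (k + 2)) (s≤s (*-monoˡ-≤ (suc (3 + ((8 + t) + (t + 3)))) few))))) (m≤m+n _ (k * 3))
      branch x e (yes z) = ifnz-else z (weaken time (postcondition (λ (μ≡ , a₀ , a₁) → answers⇒correct e≡ (subst Mem (sym μ≡) mem , a₀ , a₁))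
        (tabulated-exec mem base v₆ (bit-<-≡0 (length S) m (trans (sym e) z)))))
        where
        time : 9 + (k * 3 + 2) ≤ Bound
        time = ≤-trans (≤-reflexive (lem (k * 3))) (+-monoˡ-≤ (k * 3) (+-mono-≤ (m≤m+n 8 t) (m≤m+n 3 _)))
          where
          lem : ∀ a → 9 + (a + 2) ≡ (8 + 3) + a
          lem = solve-∀

    finish-exec : Mem μ → Base ρ → value (ρ 6) ≡ a →
                  Exec ρ μ (represent ⨾ while 9 verify ⨾ ifnz 19 (op lt 9 16 1 ⨾ ifnz 9 enumerate tabulated) (const 0 0 ⨾ skip))
                    (12 + (suc (m * 11) + suc (2 + Bound))) Correct
    finish-exec {μ} mem base v₆ =
      represent-exec mem base v₆ ⟫ λ inv →
      loop (Verifying μ) (λ {i} {ρ} {μ′} inv nz → verify-step inv nz) inv ⟫ λ {ρ₁} ((_ , μ≡ , regs , prog) , z) →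
      decide (subst Mem (sym μ≡) mem) regs prog z (value (ρ₁ 19) ≟ 0)
      where
      verify-step : ∀ {i ρ μ′} → Verifying μ i ρ μ′ → value (ρ 9) ≢ 0 → Exec ρ μ′ verify 10 (λ ρ′ μ″ → ∃ λ j → j < i × Verifying μ j ρ′ μ″)
      verify-step (refl , rest) nz = verify-exec mem (refl , rest) nz
      decide : ∀ {i ρ μ} → Mem μ → NodeRegs ρ → Progress i ρ → value (ρ 9) ≡ 0 → Dec (value (ρ 19) ≡ 0) →
               Exec ρ μ (ifnz 19 (op lt 9 16 1 ⨾ ifnz 9 enumerate tabulated) (const 0 0 ⨾ skip)) (suc (2 + Bound)) Correct
      decide mem regs prog z (no nz) = ifnz-then nz (found-exec (verified prog z nz) mem regs)
      decide {ρ = ρ} mem regs prog z (yes z₁₉) = ifnz-else z₁₉ (const: (small 0 z≤n) λ x e → done (mem ,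
        subst (λ o → (ρ [ 0 ↦ x ]) Holds encodeMaybe encode (aggregate _⊙_ (map statistic o))) (sym (occ-none (refuted prog z₁₉)))
          (λ { zero → ≡-word e })))

  Time : ℕ
  Time = 13 + (suc (m * 45) + (12 + (suc (m * 11) + suc (2 + ((8 + t) + (3 + (suc (m * suc (3 + ((8 + t) + (t + 3)))) + suc (k + 2))) + k * 3)))))

  query-exec : Mem μ → value (ρ 0) ≡ top → value (ρ 1) ≡ m →
               Exec ρ μ query Time (λ ρ′ μ′ → Mem μ′ × ρ′ Holds encodeMaybe encode (aggregate _⊙_ (map statistic (Occ T P))))
  query-exec {μ} {ρ} mem v₀ v₁ =
    setup-exec mem v₀ v₁ ⟫ λ (_ , i≤m , inv) →
    weaken (s≤s (*-monoˡ-≤ 45 i≤m)) (loop (Descending μ) (λ inv nz → descend-step inv nz) inv) ⟫ λ ((_ , inv) , z) → rest inv z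
    where
    descend-step : ∀ {i ρ μ′} → Descending μ i ρ μ′ → value (ρ 9) ≢ 0 → Exec ρ μ′ descend 44 (λ ρ′ μ″ → ∃ λ j → j < i × Descending μ j ρ′ μ″)
    descend-step (refl , rest) nz = descend-exec mem (refl , rest) nz
    rest : ∀ {i ρ μ′} → Descending μ i ρ μ′ → value (ρ 9) ≡ 0 → Exec ρ μ′ _ _ _
    rest (refl , base , v₇ , located (node {d = d} {F = []} a₀ a₁ a₂ a₃ a₄ a₅ ne <n e≤d d≤n perm seg agr tab≤ table child) e≤m v₆ v₈ v₉ occ _) z =
      contradiction (subst (1 ≤_) (sym (↭-length perm)) ne) λ ()
    rest (refl , base , v₇ , located (node {d = d} {F = i₀ ∷ fs} a₀ a₁ a₂ a₃ a₄ a₅ ne <n e≤d d≤n perm seg agr tab≤ table child) e≤m v₆ v₈ v₉ occ _) z =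
      AtNode.finish-exec arrival mem base v₆
      where
      arrival : Arrival
      arrival = record
        { a₀ = a₀ ; a₁ = a₁ ; a₂ = a₂ ; a₃ = a₃ ; a₄ = a₄ ; <n = <n ; e≤m = e≤m ; m≤d = bit-<-≡0 d m (trans (sym v₉) z)
        ; perm = perm ; seg = seg ; agr = agr ; tab≤ = tab≤ ; stored = table ; occ = occ }

-- Assembling the data structure

module Construction
  {w k t s : ℕ} {statProgram combineProgram : Program} (T : Text w) {V : Set} (encode : V → Vec (Word w) k)
  (Stat : ℕ → ℕ → V) (_⊙_ : Op₂ V) (semigroup : IsCommutativeSemigroup _≡_ _⊙_)
  (statStructure : DataStructure statProgram s (statQuery T encode Stat) (λ _ → t))
  (combines : Combines combineProgram encode _⊙_ t)
  (1≤n : 1 ≤ length T) (addressable : (200 + 10 * k + 10 * t) * (length T + s) ≤ 2 ^ w)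
  where

  private
    c n L₀ off : ℕ
    -- One constant for space, time and addressability. Space with its safety margin takes
    -- `192 + 4 * k` words per letter of the text; a query takes `116 + 4 * k + 3 * t` steps for one
    -- letter and `71 + 2 * t` for each further one.
    c = 200 + 10 * k + 10 * t
    n = length T

    module S = DataStructure statStructure

    L₀ = length (proj₁ S.initial)
    off = L₀ + n

    L₀≤s : L₀ ≤ s
    L₀≤s = S.space (proj₂ S.initial)

    1≤w : 1 ≤ w
    1≤w = go w (≤-trans (*-mono-≤ (m≤m+n 2 (198 + 10 * k + 10 * t)) (≤-trans 1≤n (m≤m+n n s))) addressable)
      where
      go : ∀ w → 2 * 1 ≤ 2 ^ w → 1 ≤ w
      go zero    (s≤s ())
      go (suc w) _ = s≤s z≤n

    open Memory off
    open Tree {w} {k} T encode Stat _⊙_ 1≤w off hiding (n)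

    tree : Result (upTo n) 0
    tree = build n (upTo n) 0 (≤-reflexive (length-upTo n)) (upTo⁺ n) (All.tabulate ∈-upTo⁻) (agreeing λ _ _ ()) z≤n

    F : List ℕ
    F = proj₁ tree

    placed : ∃ λ ν → ∃ λ a → length ν + 182 ≤ Cost (length (upTo n)) 0 × Node (F ++ ν) a (upTo n) 0
    -- The array of positions opens `R`; all nodes point into it.
    placed = proj₂ (proj₂ tree) (≤-trans 1≤n (≤-reflexive (sym (length-upTo n)))) F (off + 0) (segment-end [] F)

    ν : List ℕ
    ν = proj₁ placed

    root : ℕ
    root = proj₁ (proj₂ placed)

    header R : List ℕ
    header = L₀ ∷ n ∷ root ∷ 2 ^ ⌊ w /2⌋ ∷ []
    R = (F ++ ν) ++ header

    rootNode : Node R root (upTo n) 0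
    rootNode = node-mono header (proj₂ (proj₂ (proj₂ placed)))

    length-R : length R + 178 ≤ n + (188 * n + k * suc n)
    length-R = begin
      length R + 178                     ≡⟨ cong (_+ 178) (trans (length-++ (F ++ ν)) (cong (_+ 4) (length-++ F))) ⟩
      length F + length ν + 4 + 178      ≡⟨ lem (length F) (length ν) ⟩
      length F + (length ν + 182)        ≤⟨ +-mono-≤ (≤-reflexive (trans (↭-length (proj₁ (proj₂ tree))) (length-upTo n)))
                                              (subst (λ l → length ν + 182 ≤ Cost l 0) (length-upTo n) (proj₁ (proj₂ (proj₂ placed)))) ⟩
      n + (188 * n + k * suc n)          ∎
      where
      open ≤-Reasoning
      lem : ∀ a b → a + b + 4 + 178 ≡ a + (b + 182)
      lem = solve-∀

    room : off + length R + (n + n + n * k + k + 100) ≤ c * (n + s)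
    room = begin
      off + length R + (n + n + n * k + k + 100)       ≤⟨ m≤m+n _ 78 ⟩
      off + length R + (n + n + n * k + k + 100) + 78  ≡⟨ lem₁ L₀ n (length R) k ⟩
      L₀ + (length R + 178) + (3 * n + n * k + k)      ≤⟨ +-monoˡ-≤ (3 * n + n * k + k) (+-mono-≤ L₀≤s length-R) ⟩
      s + (n + (188 * n + k * suc n)) + (3 * n + n * k + k)
                                                       ≡⟨ lem₂ s n k ⟩
      s + (192 + 2 * k) * n + 2 * k * 1                ≤⟨ +-monoʳ-≤ (s + (192 + 2 * k) * n) (*-monoʳ-≤ (2 * k) 1≤n) ⟩
      s + (192 + 2 * k) * n + 2 * k * n                ≤⟨ m≤m+n _ ((8 + 6 * k + 10 * t) * n + (199 + 10 * k + 10 * t) * s) ⟩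
      s + (192 + 2 * k) * n + 2 * k * n + ((8 + 6 * k + 10 * t) * n + (199 + 10 * k + 10 * t) * s)
                                                       ≡⟨ lem₃ s n k t ⟩
      c * (n + s)                                      ∎
      where
      open ≤-Reasoning
      lem₁ : ∀ a n r k → a + n + r + (n + n + n * k + k + 100) + 78 ≡ a + (r + 178) + (3 * n + n * k + k)
      lem₁ = solve-∀
      lem₂ : ∀ s n k → s + (n + (188 * n + k * (1 + n))) + (3 * n + n * k + k) ≡ s + (192 + 2 * k) * n + 2 * k * 1
      lem₂ = solve-∀
      lem₃ : ∀ s n k t → s + (192 + 2 * k) * n + 2 * k * n + ((8 + 6 * k + 10 * t) * n + (199 + 10 * k + 10 * t) * s) ≡ (200 + 10 * k + 10 * t) * (n + s)
      lem₃ = solve-∀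

    Valid : Memory w → Set
    Valid D = ∃ λ D′ → S.Valid D′ × length D′ ≡ L₀ × D ≡ (D′ ++ T) ++ map word R

    length-valid : ∀ {D} → Valid D → length D ≡ off + length R
    length-valid (D′ , _ , len , refl) = trans (length-++ (D′ ++ T))
      (cong₂ _+_ (trans (length-++ D′) (cong (_+ n) len)) (length-map word R))

  structure : DataStructure (Code.query k statProgram combineProgram) (c * (n + s)) (aggregateQuery T encode Stat _⊙_) (λ (P , _) → c * length P)
  structure = record
    { Valid   = Valid
    ; initial = _ , proj₁ S.initial , proj₂ S.initial , refl , refl
    ; space   = λ v → ≤-trans (≤-reflexive (length-valid v)) (≤-trans (m≤m+n _ _) room)
    ; correct = correct
    }
    where
    open Execution w
    correct : ∀ (q : Pattern T) {D} → Valid D → ∀ ρ → ρ Holds (word (length D) ∷ word (length (proj₁ q)) ∷ []) →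
              ∃ λ t′ → ∃ λ ρ′ → ∃ λ D′ → (ρ , D ++ proj₁ q) ⊢ Code.query k statProgram combineProgram ⇓[ t′ ] (ρ′ , D′ ++ proj₁ q)
                × t′ ≤ c * length (proj₁ q) × Valid D′ × ρ′ Holds Query.answer (aggregateQuery T encode Stat _⊙_ q)
    correct (P , 1≤m , m≤n) {D} valid@(D₀ , v , len , D≡) ρ holds =
      finish (query-exec (D₀ , v , len , trans (cong (_++ P) D≡) (++-assoc (D₀ ++ T) (map word R) P))
        (trans (cong value (holds zero)) (trans (value-word-< (subst (_< 2 ^ w) (sym (length-valid valid)) top-fits)) (length-valid valid)))
        (trans (cong value (holds (suc zero))) (value-word-< (n-fits m≤n))))
      where
      setting : Setting w k t statProgram combineProgram
      setting = record
        { T = T ; P = P ; encode = encode ; Stat = Stat ; _⊙_ = _⊙_ ; semigroup = semigroup ; statStructure = statStructure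
        ; combines = combines ; 1≤w = 1≤w ; L₀ = L₀ ; R = R ; R₀ = F ++ ν ; root = root ; R≡ = refl ; rootNode = rootNode
        ; room = ≤-trans room addressable ; 1≤m = 1≤m ; m≤n = m≤n }
      open Correctness setting
      finish : Exec ρ (D ++ P) (Code.query k statProgram combineProgram) Time
                 (λ ρ′ μ′ → Mem μ′ × ρ′ Holds encodeMaybe encode (aggregate _⊙_ (map statistic (Occ T P)))) → _
      finish (t′ , ρ′ , μ′ , d , t′≤ , (D₁ , v₁ , len₁ , μ′≡) , answer) =
        t′ , ρ′ , (D₁ ++ T) ++ map word R
        , subst (λ μ → (ρ , D ++ P) ⊢ Code.query k statProgram combineProgram ⇓[ t′ ] (ρ′ , μ)) (trans μ′≡ (sym (++-assoc (D₁ ++ T) (map word R) P))) d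
        , ≤-trans t′≤ (time (length P) 1≤m) , (D₁ , v₁ , len₁ , refl) , answer
        where
        time : ∀ m → 1 ≤ m → 13 + (suc (m * 45) + (12 + (suc (m * 11) + suc (2 + ((8 + t) + (3 + (suc (m * suc (3 + ((8 + t) + (t + 3)))) + suc (k + 2))) + k * 3))))) ≤ c * m
        time (suc m) _ = m+n≤o⇒m≤o (13 + _) (≤-reflexive (lem m t k))
          where
          lem : ∀ m t k → 13 + (1 + ((1 + m) * 45) + (12 + (1 + ((1 + m) * 11) + (1 + (2 + ((8 + t) + (3 + (1 + ((1 + m) * (1 + (3 + ((8 + t) + (t + 3))))) + (1 + (k + 2)))) + k * 3))))))
                  + (84 + 129 * m + 6 * k + 10 * (k * m) + 7 * t + 8 * (t * m)) ≡ (200 + 10 * k + 10 * t) * (1 + m)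
          lem = solve-∀

corollary3p2 : (k t : ℕ) (statProgram combineProgram : Program) →
    ∃ λ (queryProgram : Program) → ∃ λ (c : ℕ) →
    (w : ℕ) (T : Text w)
    (V : Set) (encode : V → Vec (Word w) k)
    (Stat : ℕ → ℕ → V) (_⊙_ : Op₂ V) →
    IsCommutativeSemigroup _≡_ _⊙_ →
    (s : ℕ) →
    DataStructure statProgram s (statQuery T encode Stat) (λ _ → t) →
    Combines combineProgram encode _⊙_ t →
    c * (length T + s) ≤ 2 ^ w →
    DataStructure queryProgram (c * (length T + s))
    (aggregateQuery T encode Stat _⊙_) (λ (P , _) → c * length P)
corollary3p2 k t statProgram combineProgram =
  Code.query k statProgram combineProgram , 200 + 10 * k + 10 * t , λ where
    -- The empty text has no patterns. It is treated apart because `addressable` does not force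
    -- `1 ≤ w` if `s` is zero as well.
    w [] V encode Stat _⊙_ semigroup s statStructure combines addressable → record
      { Valid = _≡ [] ; initial = [] , refl ; space = λ { refl → z≤n }
      ; correct = λ (P , 1≤m , m≤0) → contradiction (≤-trans 1≤m m≤0) λ () }
    w T@(_ ∷ _) V encode Stat _⊙_ semigroup s statStructure combines addressable →
      Construction.structure T encode Stat _⊙_ semigroup statStructure combines (s≤s z≤n) addressable
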